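{- Let $\psi$ be any nontrivial additive character of $\mathbb{F}_q$, $q=2^r$. Then for $n=1,3,5,\dots$, $$\sum_{w\in DC^-(n,q)}\psi(\mathrm{Tr}\,w)=A^-(n,q)K(\psi;1),$$ and for $n=2,4,6,\dots$, $$\sum_{w\in DC^+(n,q)}\psi(\mathrm{Tr}\,w)=q^{ -1}A^+(n,q)K_{GL(2,q)}(\psi;1)=A^+(n,q)\big(K(\psi;1)^2+q^2-q\big).$$
   Context: $q=2^r$; $\mathrm{Tr}\,w$ is the matrix trace. $Sp(2n,q)=\{w\in GL(2n,\mathbb{F}_q):{}^twJw=J\}$, $J=\begin{pmatrix}0&1_n\\1_n&0\end{pmatrix}$. $P=P(2n,q)$ is the subgroup of all $\begin{pmatrix}A&0\\0&{}^tA^{ -1}\end{pmatrix}\begin{pmatrix}1_n&B\\0&1_n\end{pmatrix}$, $A\in GL(n,\mathbb{F}_q)$, $B$ symmetric $n\times n$ over $\mathbb{F}_q$. For $0\le s\le n$, $\sigma_s=\begin{pmatrix}0&0&1_s&0\\0&1_{n-s}&0&0\\1_s&0&0&0\\0&0&0&1_{n-s}\end{pmatrix}$ (block sizes $s,n-s,s,n-s$). For odd $n$, $DC^-(n,q)=P\sigma_{n-1}P$; for even $n$, $DC^+(n,q)=P\sigma_{n-2}P$. $\left[\begin{smallmatrix}n\\ s\end{smallmatrix}\right]_q=\prod_{j=0}^{s-1}\frac{q^{n-j}-1}{q^{s-j}-1}$. $A^-(n,q)=q^{\frac14(5n^2-1)}\left[\begin{smallmatrix}n\\1\end{smallmatrix}\right]_q\prod_{j=1}^{(n-1)/2}(q^{2j-1}-1)$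 for $n$ odd; $A^+(n,q)=q^{\frac14(5n^2-2n)}\left[\begin{smallmatrix}n\\2\end{smallmatrix}\right]_q\prod_{j=1}^{(n-2)/2}(q^{2j-1}-1)$ for $n$ even (empty products $=1$). $K(\psi;a)=\sum_{\alpha\in\mathbb{F}_q^*}\psi(\alpha+a\alpha^{ -1})$, and $K_{GL(2,q)}(\psi;a)=\sum_{w\in GL(2,\mathbb{F}_q)}\psi(\mathrm{Tr}\,w+a\,\mathrm{Tr}\,w^{ -1})$. -}

module Defs where

open import Level using (0ℓ)
open import Data.Nat as ℕ using (ℕ; zero; suc; _∸_; _<ᵇ_; _≡ᵇ_)
import Data.Nat.DivMod as ℕD
open import Data.Bool using (Bool; true; false; if_then_else_; _∧_)
open import Data.Fin using (Fin; toℕ)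
open import Data.List using (List; []; _∷_; map; concatMap; allFin; foldr)
open import Data.List.Membership.Propositional using (_∈_)
open import Data.List.Relation.Unary.Unique.Propositional using (Unique)
open import Data.Vec as V using (Vec; []; _∷_; tabulate; lookup)
import Data.Vec.Properties as VP
open import Data.Integer as ℤ using (ℤ)
open import Data.Product using (Σ; ∃; _×_; _,_)
open import Relation.Nullary using (¬_; Dec; does)
open import Relation.Binary.PropositionalEquality using (_≡_)
open import Relation.Binary.Definitions using (DecidableEquality)
open import Algebra.Structures using (IsCommutativeRing)
open import Function.Bundles using (_↔_; Inverse)
open import Function.Bundles using (_⇔_)

record FiniteField (r : ℕ) : Set₁ where
  field
    F    : Set
    _+_  : F → F → F
    _*_  : F → F → F
    -_   : F → F
    0#   : F
    1#   : F
    isCommutativeRing : IsCommutativeRing _≡_ _+_ _*_ -_ 0# 1#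
    0≢1  : ¬ (0# ≡ 1#)
    _⁻¹  : F → F
    ⁻¹-inverse : ∀ x → ¬ (x ≡ 0#) → x * (x ⁻¹) ≡ 1#
    _≟_  : DecidableEquality F
    enum : Fin (2 ℕ.^ r) ↔ F

  infixl 6 _+_
  infixl 7 _*_

  q : ℕ
  q = 2 ℕ.^ r

  elems : List F
  elems = map (Inverse.to enum) (allFin q)

  Mat : ℕ → Set
  Mat m = Vec (Vec F m) m

  entry : ∀ {m} → Mat m → Fin m → Fin m → F
  entry w i j = lookup (lookup w i) j

  sumF : ∀ {m} → (Fin m → F) → F
  sumF {zero}  f = 0#
  sumF {suc m} f = f Fin.zero + sumF (λ i → f (Fin.suc i))
    where import Data.Fin as Fin

  _⊗_ : ∀ {m} → Mat m → Mat m → Mat m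
  v ⊗ w = tabulate λ i → tabulate λ j → sumF λ k → entry v i k * entry w k j

  transpose : ∀ {m} → Mat m → Mat m
  transpose w = tabulate λ i → tabulate λ j → entry w j i

  zeroM : ∀ {m} → Mat m
  zeroM = tabulate λ _ → tabulate λ _ → 0#

  idM : ∀ {m} → Mat m
  idM = tabulate λ i → tabulate λ j → if does (toℕ i ℕ.≟ toℕ j) then 1# else 0#

  Tr : ∀ {m} → Mat m → F
  Tr w = sumF λ i → entry w i i

  Symmetric : ∀ {m} → Mat m → Set
  Symmetric B = transpose B ≡ B

  _≟M_ : ∀ {m} → DecidableEquality (Mat m)
  _≟M_ = VP.≡-dec (VP.≡-dec _≟_)

  allVecs : ∀ k → List (Vec F k)
  allVecs zero    = [] ∷ []
  allVecs (suc k) = concatMap (λ x → map (x ∷_) (allVecs k)) elems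

  allMats : ∀ m → List (Mat m)
  allMats m = allVecsOf m
    where
    allVecsOf : ∀ k → List (Vec (Vec F m) k)
    allVecsOf zero    = [] ∷ []
    allVecsOf (suc k) = concatMap (λ x → map (x ∷_) (allVecsOf k)) (allVecs m)

  block : ∀ {n} → Mat n → Mat n → Mat n → Mat n → Mat (n ℕ.+ n)
  block {n} X Y Z W =
    V.zipWith V._++_ X Y V.++ V.zipWith V._++_ Z W

  -- the Siegel parabolic P(2n,q):
  -- ( A 0 ; 0 ᵗA⁻¹ ) ( 1 B ; 0 1 ),  A ∈ GL(n), B symmetric.
  -- A⁻¹ is recorded as a two-sided inverse A'.
  InP : ∀ n → Mat (n ℕ.+ n) → Set
  InP n w = Σ (Mat n) λ A → Σ (Mat n) λ A' → Σ (Mat n) λ B →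
              (A ⊗ A' ≡ idM) × (A' ⊗ A ≡ idM) × Symmetric B ×
              (w ≡ block A zeroM zeroM (transpose A') ⊗ block idM B zeroM idM)

  -- σ_s with block sizes s, n-s, s, n-s (indices 0..2n-1)
  σ : ∀ n (s : ℕ) → Mat (n ℕ.+ n)
  σ n s = tabulate λ i → tabulate λ j → if e (toℕ i) (toℕ j) then 1# else 0#
    where
    e : ℕ → ℕ → Bool
    e a b with a <ᵇ n | b <ᵇ n
    ... | true  | true  = (a ≡ᵇ b) ∧ ((s <ᵇ a) Data.Bool.∨ (s ≡ᵇ a))
    ... | true  | false = (b ≡ᵇ (a ℕ.+ n)) ∧ (a <ᵇ s)
    ... | false | true  = (a ≡ᵇ (b ℕ.+ n)) ∧ (b <ᵇ s)
    ... | false | false = (a ≡ᵇ b) ∧ ((n ℕ.+ s <ᵇ a) Data.Bool.∨ (n ℕ.+ s ≡ᵇ a))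

  InPσP : ∀ n (s : ℕ) → Mat (n ℕ.+ n) → Set
  InPσP n s w = Σ (Mat (n ℕ.+ n)) λ p₁ → Σ (Mat (n ℕ.+ n)) λ p₂ →
                  InP n p₁ × InP n p₂ × (w ≡ (p₁ ⊗ σ n s) ⊗ p₂)

  InDC⁻ : ∀ n → Mat (n ℕ.+ n) → Set
  InDC⁻ n = InPσP n (n ∸ 1)

  InDC⁺ : ∀ n → Mat (n ℕ.+ n) → Set
  InDC⁺ n = InPσP n (n ∸ 2)

  -- additive characters (values in ℤ ⊂ ℂ; in char. 2 they are ±1-valued)

  record AddChar : Set where
    field
      ψ     : F → ℤ
      ψ-0   : ψ 0# ≡ ℤ.1ℤ
      ψ-hom : ∀ x y → ψ (x + y) ≡ ψ x ℤ.* ψ y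

  apply : AddChar → F → ℤ
  apply = AddChar.ψ

  Nontrivial : AddChar → Set
  Nontrivial χ = ∃ λ x → ¬ (AddChar.ψ χ x ≡ ℤ.1ℤ)

  sumℤ : ∀ {A : Set} → (A → ℤ) → List A → ℤ
  sumℤ f = foldr (λ x acc → f x ℤ.+ acc) ℤ.0ℤ

  K : AddChar → F → ℤ
  K χ a = sumℤ (λ α → if does (α ≟ 0#) then ℤ.0ℤ
                       else AddChar.ψ χ (α + a * (α ⁻¹))) elems

  -- K_{GL(2,q)}(ψ;a) = Σ_{w ∈ GL(2,q)} ψ(Tr w + a Tr w⁻¹),
  -- summing over pairs (w , v) with v the two-sided inverse of w.
  K-GL2 : AddChar → F → ℤ
  K-GL2 χ a = sumℤ (λ w → sumℤ (λ v →
      if does ((w ⊗ v) ≟M idM) ∧ does ((v ⊗ w) ≟M idM)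
      then AddChar.ψ χ (Tr w + a * Tr v) else ℤ.0ℤ) (allMats 2)) (allMats 2)

  -- sum of ψ(Tr w) over a finite set of matrices, presented by a
  -- duplicate-free list enumerating it exactly
  Enumerates : ∀ {m} → List (Mat m) → (Mat m → Set) → Set
  Enumerates ws S = Unique ws × (∀ w → (w ∈ ws) ⇔ S w)

prod1 : ℕ → (ℕ → ℕ) → ℕ
prod1 zero    f = 1
prod1 (suc m) f = prod1 m f ℕ.* f (suc m)

-- exact division (divisor 0 never occurs below)
_div_ : ℕ → ℕ → ℕ
m div zero  = 0
m div suc k = m ℕD./ suc k

-- Gaussian binomial [n s]_q = ∏_{j=0}^{s-1} (q^{n-j}-1)/(q^{s-j}-1)
gauss : ℕ → ℕ → ℕ → ℕ
gauss q n s = prod1 s (λ i → q ℕ.^ (n ∸ (i ∸ 1)) ∸ 1)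
              div prod1 s (λ i → q ℕ.^ (s ∸ (i ∸ 1)) ∸ 1)

A⁻ : ℕ → ℕ → ℕ
A⁻ q n = q ℕ.^ ((5 ℕ.* n ℕ.* n ∸ 1) ℕD./ 4) ℕ.* gauss q n 1
         ℕ.* prod1 ((n ∸ 1) ℕD./ 2) (λ j → q ℕ.^ (2 ℕ.* j ∸ 1) ∸ 1)

A⁺ : ℕ → ℕ → ℕ
A⁺ q n = q ℕ.^ ((5 ℕ.* n ℕ.* n ∸ 2 ℕ.* n) ℕD./ 4) ℕ.* gauss q n 2
         ℕ.* prod1 ((n ∸ 2) ℕD./ 2) (λ j → q ℕ.^ (2 ℕ.* j ∸ 1) ∸ 1)

{-# OPTIONS --safe #-}

-- P is a group, so counting the pairs (p₁ , p₂) ∈ P × P by the value of p₁ σ p₂ gives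
-- |H| ∑_{w ∈ PσP} ψ(Tr w) = |P| ∑_{p ∈ P} ψ(Tr pσ), where H = { p ∈ P : σpσ ∈ P }.
-- Writing p through A ∈ GL(n) and a symmetric B, and cutting at s (n = s + t, σ = σ_s), the
-- group H is given by A₁₂ = 0 and B₁₁ = 0, while the sum of ψ(Tr pσ) over B vanishes unless
-- A₁₂ = 0 and A₁₁ is alternating. Hence the sum is the number of invertible alternating
-- s × s matrices times K_{GL(t)}(ψ;1), times orders of groups. These orders and the number
-- of alternating matrices follow by recursion from the transitivity of GL on nonzero rows,
-- and K_{GL(2)} splits according to whether the upper right entry vanishes.
-- Characteristic 2 is not read off from |F| = 2^r, but from the existence of a nontrivial
-- character with values in ℤ.

module Submission where

open import Defs
open import Data.Bool using (Bool; true; false; if_then_else_; _∧_; _∨_)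
import Data.Bool.Properties as BoolP
open import Data.Fin using (Fin; zero; suc; toℕ; _↑ˡ_; _↑ʳ_; splitAt)
import Data.Fin.Properties as FinP
open import Data.Integer as ℤ using (ℤ; 0ℤ; 1ℤ; +_; +≤+)
import Data.Integer.Properties as ℤP
open import Data.Integer.Tactic.RingSolver using (solve-∀)
open import Data.List using (List; []; _∷_; map; concatMap; foldr; length; allFin)
import Data.List.Properties as ListP
open import Data.List.Membership.Propositional using (_∈_; lose)
open import Data.List.Membership.Propositional.Properties using (∈-map⁺; ∈-allFin)
open import Data.List.Relation.Unary.All.Properties using (All¬⇒¬Any)
open import Data.List.Relation.Unary.AllPairs using ([]; _∷_)
open import Data.List.Relation.Unary.Any using (here; there; any?; satisfied)
open import Data.List.Relation.Unary.Unique.Propositional using (Unique)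
import Data.List.Relation.Unary.Unique.Propositional.Properties as UniqueP
open import Data.Nat using (ℕ; zero; suc; NonZero; z≤n; s≤s; _≥_; _<ᵇ_; _≡ᵇ_)
import Data.Nat as ℕ
import Data.Nat.Properties as ℕP
import Data.Nat.DivMod as ℕD
open import Data.Nat.DivMod using (_%_)
import Data.Nat.Tactic.RingSolver as ℕRing
open import Data.Product using (Σ; ∃; ∃₂; _×_; _,_; proj₁; proj₂; uncurry)
import Data.Product.Properties as ProdP
open import Data.Sum using (inj₁; inj₂)
open import Data.Unit using (⊤; tt)
open import Data.Vec as V using (Vec; []; _∷_; lookup; tabulate)
import Data.Vec.Properties as VP
open import Function using (_∘_; id; _⇔_; mk⇔; Equivalence; Inverse)
open import Relation.Nullary using (¬_; Dec; yes; no; does; _×-dec_; _→-dec_; ¬?; contradiction)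
open import Relation.Nullary.Decidable using (map′; decidable-stable; dec-true; dec-false)
open import Relation.Binary.Definitions using (DecidableEquality)
open import Relation.Binary.PropositionalEquality hiding ([_]; J)
open import Algebra.Bundles using (CommutativeRing)
import Algebra.Properties.AbelianGroup ℤP.+-0-abelianGroup as ℤ+
import Algebra.Properties.CommutativeSemigroup as CommutativeSemigroupP
open ≡-Reasoning

-- In both cases s is even: s = n - 1 for odd n, s = n - 2 for even n. Hence nonsingular alternating
-- s × s matrices exist, and t = n - s is 1 or 2, so the factor K_{GL(t)}(ψ;1) is the Kloosterman
-- sum itself or the one for GL(2). The latter carries an extra factor q, which cancels the q in
-- |GL(2)| = (q² - 1) q (q - 1). Alternating matrices enter because e ↦ tr(ae) vanishes on all
-- symmetric e exactly when a is alternating; any other a makes the character sum over e vanish.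
-- Closure of P under products and inverses is hidden by the coordinates (A, B). P is therefore
-- identified with the symplectic matrices whose lower left block is zero; the coordinates are used
-- only for summation. Since sums take values in ℤ, nothing is divided: identities stay multiplied
-- out and nonzero common factors are cancelled at the end. The truncated division in the Gaussian
-- binomials is made exact by explicit geometric sums.

module FiniteSums where

  -- Integer sums over finite types and their decidable subsets

  open import Data.Integer using (_+_; _*_; _-_)

  𝟙 : {P : Set} → Dec P → ℤ
  𝟙 p = if does p then 1ℤ else 0ℤ

  𝟙-yes : {P : Set} (p : Dec P) → P → 𝟙 p ≡ 1ℤ
  𝟙-yes p h rewrite dec-true p h = refl

  𝟙-no : {P : Set} (p : Dec P) → ¬ P → 𝟙 p ≡ 0ℤ
  𝟙-no p h rewrite dec-false p h = refl

  𝟙-cong : {P Q : Set} (p : Dec P) (q : Dec Q) → (P → Q) → (Q → P) → 𝟙 p ≡ 𝟙 q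
  𝟙-cong (yes a) q to from = sym (𝟙-yes q (to a))
  𝟙-cong (no ¬a) q to from = sym (𝟙-no q (¬a ∘ from))

  𝟙-× : {P Q : Set} (p : Dec P) (q : Dec Q) → 𝟙 (p ×-dec q) ≡ 𝟙 p * 𝟙 q
  𝟙-× (yes _) (yes _) = refl
  𝟙-× (yes _) (no _)  = refl
  𝟙-× (no _)  (yes _) = refl
  𝟙-× (no _)  (no _)  = refl

  𝟙-*-cong : {P : Set} (p : Dec P) {a b : ℤ} → (P → a ≡ b) → 𝟙 p * a ≡ 𝟙 p * b
  𝟙-*-cong (yes h) eq = cong (1ℤ *_) (eq h)
  𝟙-*-cong (no _)  eq = refl

  𝟙≥0 : {P : Set} (p : Dec P) → 0ℤ ℤ.≤ 𝟙 p
  𝟙≥0 (yes _) = +≤+ z≤n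
  𝟙≥0 (no _)  = +≤+ z≤n

  opaque
    ∑ˡ : {A : Set} → List A → (A → ℤ) → ℤ
    ∑ˡ xs f = foldr (λ x acc → f x + acc) 0ℤ xs

    ∑ˡ-cong : {A : Set} → ∀ xs {f g : A → ℤ} → (∀ x → f x ≡ g x) → ∑ˡ xs f ≡ ∑ˡ xs g
    ∑ˡ-cong []       e = refl
    ∑ˡ-cong (x ∷ xs) e = cong₂ _+_ (e x) (∑ˡ-cong xs e)

    ∑ˡ-mono : {A : Set} → ∀ xs {f g : A → ℤ} → (∀ x → f x ℤ.≤ g x) → ∑ˡ xs f ℤ.≤ ∑ˡ xs g
    ∑ˡ-mono []       e = ℤP.≤-refl
    ∑ˡ-mono (x ∷ xs) e = ℤP.+-mono-≤ (e x) (∑ˡ-mono xs e)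

    ∑ˡ-zero : {A : Set} → ∀ xs → ∑ˡ {A} xs (λ _ → 0ℤ) ≡ 0ℤ
    ∑ˡ-zero []       = refl
    ∑ˡ-zero (x ∷ xs) = trans (ℤP.+-identityˡ _) (∑ˡ-zero xs)

    ∑ˡ-+ : {A : Set} → ∀ xs (f g : A → ℤ) → ∑ˡ xs (λ x → f x + g x) ≡ ∑ˡ xs f + ∑ˡ xs g
    ∑ˡ-+ []       f g = refl
    ∑ˡ-+ (x ∷ xs) f g rewrite ∑ˡ-+ xs f g = interchange (f x) (g x) _ _
      where
      interchange : ∀ a b c d → a + b + (c + d) ≡ a + c + (b + d)
      interchange = solve-∀

    ∑ˡ-*ˡ : {A : Set} → ∀ xs c (f : A → ℤ) → ∑ˡ xs (λ x → c * f x) ≡ c * ∑ˡ xs f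
    ∑ˡ-*ˡ []       c f = sym (ℤP.*-zeroʳ c)
    ∑ˡ-*ˡ (x ∷ xs) c f rewrite ∑ˡ-*ˡ xs c f = sym (ℤP.*-distribˡ-+ c (f x) _)

    ∑ˡ-++ : {A : Set} → ∀ xs ys (f : A → ℤ) → ∑ˡ (xs Data.List.++ ys) f ≡ ∑ˡ xs f + ∑ˡ ys f
    ∑ˡ-++ []       ys f = sym (ℤP.+-identityˡ _)
    ∑ˡ-++ (x ∷ xs) ys f rewrite ∑ˡ-++ xs ys f = sym (ℤP.+-assoc (f x) _ _)

    ∑ˡ-𝟙-∈ : {A : Set} → ∀ (_≟_ : DecidableEquality A) a xs → ∑ˡ xs (λ x → 𝟙 (x ≟ a)) ≡ 1ℤ → a ∈ xs
    ∑ˡ-𝟙-∈ _≟_ a [] ()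
    ∑ˡ-𝟙-∈ _≟_ a (x ∷ xs) e with x ≟ a
    ... | yes x≡a = here (sym x≡a)
    ... | no _    = there (∑ˡ-𝟙-∈ _≟_ a xs (trans (sym (ℤP.+-identityˡ _)) e))

    ∑ˡ-foldr : {A : Set} → ∀ xs (f : A → ℤ) → ∑ˡ xs f ≡ foldr (λ x acc → f x + acc) 0ℤ xs
    ∑ˡ-foldr xs f = refl

    ∑ˡ-singleton : {A : Set} → ∀ x (f : A → ℤ) → ∑ˡ (x ∷ []) f ≡ f x
    ∑ˡ-singleton x f = ℤP.+-identityʳ (f x)

    ∑ˡ-𝟙-∉ : {A : Set} → ∀ (_≟_ : DecidableEquality A) a xs → ¬ (a ∈ xs) →
      ∑ˡ xs (λ x → 𝟙 (a ≟ x)) ≡ 0ℤ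
    ∑ˡ-𝟙-∉ _≟_ a [] ∉ = refl
    ∑ˡ-𝟙-∉ _≟_ a (x ∷ xs) ∉ =
      cong₂ _+_ (𝟙-no (a ≟ x) (∉ ∘ here)) (∑ˡ-𝟙-∉ _≟_ a xs (∉ ∘ there))

    ∑ˡ-𝟙-unique : {A : Set} → ∀ (_≟_ : DecidableEquality A) a xs → Unique xs → a ∈ xs →
      ∑ˡ xs (λ x → 𝟙 (a ≟ x)) ≡ 1ℤ
    ∑ˡ-𝟙-unique _≟_ a (.a ∷ xs) (≢s ∷ u) (here refl) =
      cong₂ _+_ (𝟙-yes (a ≟ a) refl) (∑ˡ-𝟙-∉ _≟_ a xs (All¬⇒¬Any ≢s))
    ∑ˡ-𝟙-unique _≟_ a (x ∷ xs) (≢s ∷ u) (there i) =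
      cong₂ _+_ (𝟙-no (a ≟ x) (λ { refl → All¬⇒¬Any ≢s i })) (∑ˡ-𝟙-unique _≟_ a xs u i)

    ∑ˡ-map : ∀ {A B : Set} (g : A → B) xs (f : B → ℤ) → ∑ˡ (map g xs) f ≡ ∑ˡ xs (f ∘ g)
    ∑ˡ-map g []       f = refl
    ∑ˡ-map g (x ∷ xs) f = cong (λ t → f (g x) + t) (∑ˡ-map g xs f)

    ∑ˡ-concatMap : ∀ {A B : Set} (g : A → List B) xs (f : B → ℤ) →
      ∑ˡ (concatMap g xs) f ≡ ∑ˡ xs (λ x → ∑ˡ (g x) f)
    ∑ˡ-concatMap g []       f = refl
    ∑ˡ-concatMap g (x ∷ xs) f = trans (∑ˡ-++ (g x) _ f) (cong (λ t → ∑ˡ (g x) f + t) (∑ˡ-concatMap g xs f))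

    ∑ˡ-swap : ∀ {A B : Set} xs ys (f : A → B → ℤ) →
      ∑ˡ xs (λ x → ∑ˡ ys (f x)) ≡ ∑ˡ ys (λ y → ∑ˡ xs (λ x → f x y))
    ∑ˡ-swap []       ys f = sym (∑ˡ-zero ys)
    ∑ˡ-swap (x ∷ xs) ys f =
      trans (cong (λ t → ∑ˡ ys (f x) + t) (∑ˡ-swap xs ys f)) (sym (∑ˡ-+ ys (f x) _))

  -- `sift` encodes in one equation that every element occurs exactly once in `elements`: f = 1
  -- gives the multiplicity. In this form it collapses inner sums directly.
  record Finite (X : Set) : Set where
    infix 4 _≟_
    field
      _≟_      : DecidableEquality X
      elements : List X
      sift     : ∀ a (f : X → ℤ) → ∑ˡ elements (λ x → 𝟙 (x ≟ a) * f x) ≡ f a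

  open Finite {{...}} using (_≟_; elements; sift) public

  ∑ : {X : Set} {{_ : Finite X}} → (X → ℤ) → ℤ
  ∑ {X} f = ∑ˡ (elements {X}) f

  -- A subset enters as a weight 0 or 1 on the ambient type, so interchange of sums and change of
  -- variables need no subtypes.
  ∑⟨_⟩ : {X : Set} {{_ : Finite X}} {P : X → Set} → (∀ x → Dec (P x)) → (X → ℤ) → ℤ
  ∑⟨ P? ⟩ f = ∑ (λ x → 𝟙 (P? x) * f x)

  module _ {X : Set} {{_ : Finite X}} where

    ∈-elements : ∀ (a : X) → a ∈ elements
    ∈-elements a = ∑ˡ-𝟙-∈ _≟_ a elements
      (trans (∑ˡ-cong elements (λ x → sym (ℤP.*-identityʳ _))) (sift a (λ _ → 1ℤ)))

    -- Decidable quantifiers are what allows membership in a double coset, or being alternating, to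
    -- serve as a weight in a sum.
    ∃? : {P : X → Set} → (∀ x → Dec (P x)) → Dec (∃ P)
    ∃? P? = map′ satisfied (λ (x , px) → lose (∈-elements x) px) (any? P? elements)

    ∀? : {P : X → Set} → (∀ x → Dec (P x)) → Dec (∀ x → P x)
    ∀? P? with ∃? (¬? ∘ P?)
    ... | yes (x , ¬px) = no (λ h → ¬px (h x))
    ... | no ¬∃         = yes (λ x → decidable-stable (P? x) (λ ¬px → ¬∃ (x , ¬px)))

    ∑-cong : {f g : X → ℤ} → (∀ x → f x ≡ g x) → ∑ f ≡ ∑ g
    ∑-cong = ∑ˡ-cong elements

    ∑-+ : (f g : X → ℤ) → ∑ (λ x → f x + g x) ≡ ∑ f + ∑ g
    ∑-+ = ∑ˡ-+ elements

    ∑-*ˡ : ∀ c (f : X → ℤ) → ∑ (λ x → c * f x) ≡ c * ∑ f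
    ∑-*ˡ = ∑ˡ-*ˡ elements

    ∑-*ʳ : ∀ c (f : X → ℤ) → ∑ (λ x → f x * c) ≡ ∑ f * c
    ∑-*ʳ c f = trans (∑-cong (λ x → ℤP.*-comm (f x) c))
                     (trans (∑-*ˡ c f) (ℤP.*-comm c _))

    ∑-swap : {Y : Set} {{_ : Finite Y}} (f : X → Y → ℤ) →
      ∑ (λ x → ∑ (f x)) ≡ ∑ (λ y → ∑ (λ x → f x y))
    ∑-swap = ∑ˡ-swap elements elements

    -- By sifting, `f a` is the sum of f cut down to the single point a, hence at most the whole
    -- sum.
    ∑-nonneg-zero : (f : X → ℤ) → (∀ x → 0ℤ ℤ.≤ f x) → ∑ f ≡ 0ℤ → ∀ a → f a ≡ 0ℤ
    ∑-nonneg-zero f f≥0 e a = ℤP.≤-antisym fa≤0 (f≥0 a)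
      where
      bound : ∀ x → 𝟙 (x ≟ a) * f x ℤ.≤ f x
      bound x with x ≟ a
      ... | yes _ = ℤP.≤-reflexive (ℤP.*-identityˡ (f x))
      ... | no _  = ℤP.≤-trans (ℤP.≤-reflexive (ℤP.*-zeroˡ (f x))) (f≥0 x)
      fa≤0 : f a ℤ.≤ 0ℤ
      fa≤0 = ℤP.≤-trans (ℤP.≤-reflexive (sym (sift a f)))
               (ℤP.≤-trans (∑ˡ-mono elements bound) (ℤP.≤-reflexive e))

  module _ {X : Set} {{_ : Finite X}} {P : X → Set} (P? : ∀ x → Dec (P x)) where

    ∑⟨⟩-cong : {f g : X → ℤ} → (∀ x → P x → f x ≡ g x) → ∑⟨ P? ⟩ f ≡ ∑⟨ P? ⟩ g
    ∑⟨⟩-cong e = ∑-cong (λ x → 𝟙-*-cong (P? x) (e x))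

    ∑⟨⟩-iff : {Q : X → Set} (Q? : ∀ x → Dec (Q x)) {f : X → ℤ} →
      (∀ x → P x → Q x) → (∀ x → Q x → P x) → ∑⟨ P? ⟩ f ≡ ∑⟨ Q? ⟩ f
    ∑⟨⟩-iff Q? {f} to from =
      ∑-cong (λ x → cong (_* f x) (𝟙-cong (P? x) (Q? x) (to x) (from x)))

    ∑⟨⟩-*ˡ : ∀ c (f : X → ℤ) → ∑⟨ P? ⟩ (λ x → c * f x) ≡ c * ∑⟨ P? ⟩ f
    ∑⟨⟩-*ˡ c f = trans (∑-cong (λ x → shuffle (𝟙 (P? x)) c (f x))) (∑-*ˡ c _)
      where
      shuffle : ∀ a b d → a * (b * d) ≡ b * (a * d)
      shuffle = solve-∀

    ∑⟨⟩-*ʳ : ∀ c (f : X → ℤ) → ∑⟨ P? ⟩ (λ x → f x * c) ≡ ∑⟨ P? ⟩ f * c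
    ∑⟨⟩-*ʳ c f = trans (∑-cong (λ x → sym (ℤP.*-assoc (𝟙 (P? x)) (f x) c))) (∑-*ʳ c _)

    ∑⟨⟩-const : ∀ c → ∑⟨ P? ⟩ (λ _ → c) ≡ ∑⟨ P? ⟩ (λ _ → 1ℤ) * c
    ∑⟨⟩-const c = trans (∑⟨⟩-cong (λ _ _ → sym (ℤP.*-identityˡ c))) (∑⟨⟩-*ʳ c _)

    ∑⟨⟩-empty : (∀ x → ¬ P x) → ∀ f → ∑⟨ P? ⟩ f ≡ 0ℤ
    ∑⟨⟩-empty ¬P f = trans
      (∑-cong (λ x → trans (cong (_* f x) (𝟙-no (P? x) (¬P x))) (ℤP.*-zeroˡ (f x))))
      (∑ˡ-zero elements)

    ∑⟨⟩-refine : {Q : X → Set} (Q? : ∀ x → Dec (Q x)) (f : X → ℤ) →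
      ∑⟨ P? ⟩ (λ x → 𝟙 (Q? x) * f x) ≡ ∑⟨ (λ x → P? x ×-dec Q? x) ⟩ f
    ∑⟨⟩-refine Q? f = ∑-cong (λ x →
      trans (sym (ℤP.*-assoc (𝟙 (P? x)) _ (f x)))
            (cong (_* f x) (sym (𝟙-× (P? x) (Q? x)))))

    ∑⟨⟩-split : {Q : X → Set} (Q? : ∀ x → Dec (Q x)) (f : X → ℤ) →
      ∑⟨ P? ⟩ f ≡ ∑⟨ (λ x → P? x ×-dec Q? x) ⟩ f + ∑⟨ (λ x → P? x ×-dec ¬? (Q? x)) ⟩ f
    ∑⟨⟩-split Q? f = trans (∑-cong pointwise) (∑-+ _ _)
      where
      pointwise : ∀ x → 𝟙 (P? x) * f x ≡
        𝟙 (P? x ×-dec Q? x) * f x + 𝟙 (P? x ×-dec ¬? (Q? x)) * f x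
      pointwise x with P? x | Q? x
      ... | yes _ | yes _ = lem (f x) where
        lem : ∀ a → 1ℤ * a ≡ 1ℤ * a + 0ℤ * a
        lem = solve-∀
      ... | yes _ | no _  = lem (f x) where
        lem : ∀ a → 1ℤ * a ≡ 0ℤ * a + 1ℤ * a
        lem = solve-∀
      ... | no _  | yes _ = refl
      ... | no _  | no _  = refl

    ∑⟨⟩-swap : {Y : Set} {{_ : Finite Y}} {Q : Y → Set} (Q? : ∀ y → Dec (Q y))
      (f : X → Y → ℤ) →
      ∑⟨ P? ⟩ (λ x → ∑⟨ Q? ⟩ (f x)) ≡ ∑⟨ Q? ⟩ (λ y → ∑⟨ P? ⟩ (λ x → f x y))
    ∑⟨⟩-swap Q? f =
      trans (∑-cong (λ x → sym (∑-*ˡ (𝟙 (P? x)) _)))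
      (trans (∑-swap _)
      (∑-cong (λ y → trans (∑-cong (λ x → shuffle (𝟙 (P? x)) (𝟙 (Q? y)) (f x y)))
                           (∑-*ˡ (𝟙 (Q? y)) _))))
      where
      shuffle : ∀ a b d → a * (b * d) ≡ b * (a * d)
      shuffle = solve-∀

    -- Each x lies over the single value y = φ x, so after interchanging the sums, sifting at φ x
    -- removes the sum over y.
    ∑⟨⟩-fibres : {Y : Set} {{_ : Finite Y}} (φ : X → Y) (f : X → ℤ) →
      ∑⟨ P? ⟩ f ≡ ∑ (λ y → ∑⟨ (λ x → P? x ×-dec (φ x ≟ y)) ⟩ f)
    ∑⟨⟩-fibres φ f = trans (∑-cong (λ x → sym (fibre x))) (∑-swap _)
      where
      fibre : ∀ x → ∑ (λ y → 𝟙 (P? x ×-dec (φ x ≟ y)) * f x) ≡ 𝟙 (P? x) * f x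
      fibre x = trans
        (∑-cong (λ y → trans (cong (_* f x) (trans (𝟙-× (P? x) (φ x ≟ y))
            (trans (ℤP.*-comm (𝟙 (P? x)) _)
                   (cong (_* 𝟙 (P? x)) (𝟙-cong (φ x ≟ y) (y ≟ φ x) sym sym)))))
          (ℤP.*-assoc (𝟙 (y ≟ φ x)) _ _)))
        (sift (φ x) (λ _ → 𝟙 (P? x) * f x))

  -- Both sides equal the sum over pairs (x , y) with y = φ x, equivalently x = γ y.
  ∑⟨⟩-bij : {X Y : Set} {{_ : Finite X}} {{_ : Finite Y}}
    {P : X → Set} (P? : ∀ x → Dec (P x)) {Q : Y → Set} (Q? : ∀ y → Dec (Q y))
    (φ : X → Y) (γ : Y → X) →
    (∀ x → P x → Q (φ x)) → (∀ y → Q y → P (γ y)) →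
    (∀ x → P x → γ (φ x) ≡ x) → (∀ y → Q y → φ (γ y) ≡ y) →
    {f : X → ℤ} {g : Y → ℤ} → (∀ y → Q y → f (γ y) ≡ g y) →
    ∑⟨ P? ⟩ f ≡ ∑⟨ Q? ⟩ g
  ∑⟨⟩-bij P? Q? φ γ P⇒Q Q⇒P γφ φγ {f} {g} fg =
    trans (∑⟨⟩-fibres P? φ f) (∑-cong λ y → trans (at y) (sum-point y))
    where
    at : ∀ y → ∑⟨ (λ x → P? x ×-dec (φ x ≟ y)) ⟩ f ≡
               ∑ (λ x → 𝟙 (x ≟ γ y) * (𝟙 (Q? y) * f x))
    at y = ∑-cong (λ x → trans
      (cong (_* f x) (trans
        (𝟙-cong (P? x ×-dec (φ x ≟ y)) ((x ≟ γ y) ×-dec Q? y)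
          (λ { (p , refl) → sym (γφ x p) , P⇒Q x p })
          (λ { (refl , q) → Q⇒P y q , φγ y q }))
        (𝟙-× (x ≟ γ y) (Q? y))))
      (ℤP.*-assoc (𝟙 (x ≟ γ y)) _ _))
    sum-point : ∀ y → ∑ (λ x → 𝟙 (x ≟ γ y) * (𝟙 (Q? y) * f x)) ≡ 𝟙 (Q? y) * g y
    sum-point y = trans (sift (γ y) (λ x → 𝟙 (Q? y) * f x)) (𝟙-*-cong (Q? y) (fg y))

  ∑-bij : {X Y : Set} {{_ : Finite X}} {{_ : Finite Y}} (φ : X → Y) (γ : Y → X) →
    (∀ x → γ (φ x) ≡ x) → (∀ y → φ (γ y) ≡ y) →
    {f : X → ℤ} {g : Y → ℤ} → (∀ y → f (γ y) ≡ g y) → ∑ f ≡ ∑ g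
  ∑-bij φ γ γφ φγ {f} {g} fg =
    trans (∑-cong (λ x → sym (ℤP.*-identityˡ (f x))))
    (trans (∑⟨⟩-bij (λ _ → yes tt) (λ _ → yes tt) φ γ (λ _ _ → tt) (λ _ _ → tt)
      (λ x _ → γφ x) (λ y _ → φγ y) (λ y _ → fg y))
    (∑-cong (λ y → ℤP.*-identityˡ (g y))))

  -- Passage from the lists of the statement to weighted sums: the multiplicity of x in a
  -- duplicate-free list enumerating S is the indicator of S at x.
  ∑-enumerated : {X : Set} {{_ : Finite X}} {S : X → Set} (S? : ∀ x → Dec (S x)) →
    ∀ {ws} → Unique ws → (∀ x → x ∈ ws ⇔ S x) → ∀ f → ∑ˡ ws f ≡ ∑⟨ S? ⟩ f
  ∑-enumerated S? {ws} uniq enum f =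
    trans (∑ˡ-cong ws (λ w → sym (sift w f)))
    (trans (∑ˡ-swap ws elements _)
    (∑-cong (λ x → trans (∑ˡ-cong ws (λ w → ℤP.*-comm (𝟙 (x ≟ w)) (f x)))
      (trans (∑ˡ-*ˡ ws (f x) _) (trans (ℤP.*-comm (f x) _)
        (cong (_* f x) (mult x)))))))
    where
    mult : ∀ x → ∑ˡ ws (λ w → 𝟙 (x ≟ w)) ≡ 𝟙 (S? x)
    mult x with S? x
    ... | yes s = ∑ˡ-𝟙-unique _≟_ x ws uniq (Equivalence.from (enum x) s)
    ... | no ¬s = ∑ˡ-𝟙-∉ _≟_ x ws (¬s ∘ Equivalence.to (enum x))

  module _ {X Y : Set} {{_ : Finite X}} {{_ : Finite Y}} where

    private
      pairs : List (X × Y)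
      pairs = concatMap (λ x → map (x ,_) elements) elements

      ∑ˡ-pairs : (f : X × Y → ℤ) → ∑ˡ pairs f ≡ ∑ (λ x → ∑ (λ y → f (x , y)))
      ∑ˡ-pairs f = trans (∑ˡ-concatMap _ elements f) (∑-cong (λ x → ∑ˡ-map (x ,_) elements f))

    instance
      finite-× : Finite (X × Y)
      finite-× = record
        { _≟_ = ProdP.≡-dec _≟_ _≟_
        ; elements = pairs
        ; sift = λ (a , b) f → trans (∑ˡ-pairs _)
            (trans (∑-cong (λ x → trans
              (∑-cong (λ y → trans (cong (_* f (x , y)) (trans
                (𝟙-cong (ProdP.≡-dec _≟_ _≟_ (x , y) (a , b)) ((y ≟ b) ×-dec (x ≟ a))
                  (λ { refl → refl , refl }) (λ { (refl , refl) → refl }))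
                (𝟙-× (y ≟ b) (x ≟ a)))) (ℤP.*-assoc (𝟙 (y ≟ b)) _ _)))
              (sift b (λ y → 𝟙 (x ≟ a) * f (x , y)))))
            (sift a (λ x → f (x , b))))
        }

    ∑-× : (f : X × Y → ℤ) → ∑ f ≡ ∑ (λ x → ∑ (λ y → f (x , y)))
    ∑-× = ∑ˡ-pairs

    ∑⟨⟩-× : {R : X × Y → Set} (R? : ∀ z → Dec (R z)) {P : X → Set} (P? : ∀ x → Dec (P x))
      {Q : X → Y → Set} (Q? : ∀ x y → Dec (Q x y)) →
      (∀ x y → R (x , y) → P x × Q x y) → (∀ x y → P x → Q x y → R (x , y)) →
      (f : X × Y → ℤ) →
      ∑⟨ R? ⟩ f ≡ ∑⟨ P? ⟩ (λ x → ∑⟨ Q? x ⟩ (λ y → f (x , y)))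
    ∑⟨⟩-× R? P? Q? to from f = trans (∑-× _) (∑-cong λ x → trans
      (∑-cong (λ y → trans (cong (_* f (x , y))
          (trans (𝟙-cong (R? (x , y)) (P? x ×-dec Q? x y) (to x y) (uncurry (from x y)))
                 (𝟙-× (P? x) (Q? x y))))
        (ℤP.*-assoc (𝟙 (P? x)) _ _)))
      (∑-*ˡ (𝟙 (P? x)) _))

  vectors : {A : Set} → List A → ∀ n → List (Vec A n)
  vectors xs zero    = [] ∷ []
  vectors xs (suc n) = concatMap (λ x → map (x ∷_) (vectors xs n)) xs

  instance
    finite-Vec : {A : Set} {n : ℕ} {{_ : Finite A}} → Finite (Vec A n)
    finite-Vec {A} {n} = record
      { _≟_ = _≟ⱽ_ ; elements = vectors elements n ; sift = siftⱽ n }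
      where
      _≟ⱽ_ : ∀ {n} → DecidableEquality (Vec A n)
      _≟ⱽ_ = VP.≡-dec _≟_
      ∷-dec : ∀ {n} x (xs : Vec A n) a as → 𝟙 ((x ∷ xs) ≟ⱽ (a ∷ as)) ≡ 𝟙 (xs ≟ⱽ as) * 𝟙 (x ≟ a)
      ∷-dec x xs a as = trans
        (𝟙-cong ((x ∷ xs) ≟ⱽ (a ∷ as)) ((xs ≟ⱽ as) ×-dec (x ≟ a))
          (λ { refl → refl , refl }) (λ { (refl , refl) → refl }))
        (𝟙-× (xs ≟ⱽ as) (x ≟ a))
      siftⱽ : ∀ n (a : Vec A n) f → ∑ˡ (vectors elements n) (λ x → 𝟙 (x ≟ⱽ a) * f x) ≡ f a
      siftⱽ zero    []       f = trans (∑ˡ-singleton [] _) (ℤP.*-identityˡ (f []))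
      siftⱽ (suc n) (a ∷ as) f =
        trans (∑ˡ-concatMap _ elements _)
        (trans (∑-cong (λ x → trans (∑ˡ-map (x ∷_) (vectors elements n) _)
          (trans (∑ˡ-cong (vectors elements n) (λ xs →
              trans (cong (_* f (x ∷ xs)) (∷-dec x xs a as)) (ℤP.*-assoc (𝟙 (xs ≟ⱽ as)) _ _)))
            (siftⱽ n as (λ xs → 𝟙 (x ≟ a) * f (x ∷ xs))))))
        (sift a (λ x → f (x ∷ as))))

  ∣_∣ : (X : Set) {{_ : Finite X}} → ℤ
  ∣ X ∣ = ∑ {X} (λ _ → 1ℤ)

  ∑-const : {X : Set} {{_ : Finite X}} → ∀ c → ∑ {X} (λ _ → c) ≡ ∣ X ∣ * c
  ∑-const {X} c = trans (∑-cong {X} (λ _ → sym (ℤP.*-identityˡ c))) (∑-*ʳ c _)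

  -- The number of preimages of y is 1 or 0 according as y is a value or not; since the
  -- numbers of preimages add up to |X|, there is no y that is not a value.
  injective⇒surjective : {X : Set} {{_ : Finite X}} (f : X → X) →
    (∀ x y → f x ≡ f y → x ≡ y) → ∀ y → ∃ (λ x → f x ≡ y)
  injective⇒surjective {X} f inj y with ∃? (λ x → f x ≟ y)
  ... | yes e = e
  ... | no ¬e = contradiction (trans (sym (𝟙-yes (missed? y) ¬e)) missed-zero) λ ()
    where
    image? : ∀ y → Dec (∃ (λ x → f x ≡ y))
    image? y = ∃? (λ x → f x ≟ y)
    missed? : ∀ y → Dec (¬ ∃ (λ x → f x ≡ y))
    missed? y = ¬? (image? y)
    preimages : ∀ y (d : Dec (∃ (λ x → f x ≡ y))) → ∑ (λ x → 𝟙 (f x ≟ y)) ≡ 𝟙 d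
    preimages y (yes (x₀ , refl)) = trans
      (∑-cong (λ x → trans (𝟙-cong (f x ≟ f x₀) (x ≟ x₀) (inj x x₀) (cong f))
                           (sym (ℤP.*-identityʳ _))))
      (sift x₀ (λ _ → 1ℤ))
    preimages y (no ¬e) = trans (∑-cong (λ x → 𝟙-no (f x ≟ y) (λ e → ¬e (x , e)))) (∑ˡ-zero (elements {X}))
    complement : ∀ {P : Set} (d : Dec P) → 𝟙 d + 𝟙 (¬? d) ≡ 1ℤ
    complement (yes _) = refl
    complement (no _)  = refl
    total : ∑ (λ y → 𝟙 (image? y)) ≡ ∣ X ∣
    total = trans (∑-cong (λ y → sym (preimages y (image? y)))) (trans (∑-swap _)
      (∑-cong (λ x → trans (∑-cong (λ y → trans (𝟙-cong (f x ≟ y) (y ≟ f x) sym sym)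
                                                (sym (ℤP.*-identityʳ _))))
                           (sift (f x) (λ _ → 1ℤ)))))
    none-missed : ∑ (λ y → 𝟙 (missed? y)) ≡ 0ℤ
    none-missed = ℤ+.∙-cancelˡ ∣ X ∣ _ _ (trans (cong (_+ ∑ (λ y → 𝟙 (missed? y))) (sym total))
      (trans (sym (∑-+ _ _)) (trans (∑-cong (λ y → complement (image? y))) (sym (ℤP.+-identityʳ ∣ X ∣)))))
    missed-zero : 𝟙 (missed? y) ≡ 0ℤ
    missed-zero = ∑-nonneg-zero _ (λ y → 𝟙≥0 (missed? y)) none-missed y

  uniqueFinite : {X : Set} → DecidableEquality X → ∀ xs → Unique xs → (∀ x → x ∈ xs) → Finite X
  uniqueFinite _≟_ xs uniq complete = record
    { _≟_ = _≟_
    ; elements = xs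
    ; sift = λ a f → trans
        (∑ˡ-cong xs (λ x → trans (𝟙-*-cong (x ≟ a) (cong f))
          (trans (ℤP.*-comm (𝟙 (x ≟ a)) (f a)) (cong (f a *_) (𝟙-cong (x ≟ a) (a ≟ x) sym sym)))))
        (trans (∑ˡ-*ˡ xs (f a) _)
        (trans (cong (f a *_) (∑ˡ-𝟙-unique _≟_ a xs uniq (complete a))) (ℤP.*-identityʳ (f a))))
    }

  count-≢ : {X : Set} {{_ : Finite X}} (a : X) → ∑ (λ x → 𝟙 (¬? (x ≟ a))) ≡ ∣ X ∣ - 1ℤ
  count-≢ {X} a = begin
    ∑ (λ x → 𝟙 (¬? (x ≟ a)))           ≡⟨ add-sub _ (∑ (λ x → 𝟙 (x ≟ a))) ⟩
    ∑ (λ x → 𝟙 (¬? (x ≟ a))) + ∑ (λ x → 𝟙 (x ≟ a)) - ∑ (λ x → 𝟙 (x ≟ a))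
      ≡⟨ cong₂ _-_ (trans (sym (∑-+ _ _)) (∑-cong (λ x → complement (x ≟ a))))
           (trans (∑-cong (λ x → sym (ℤP.*-identityʳ (𝟙 (x ≟ a))))) (sift a (λ _ → 1ℤ))) ⟩
    ∣ X ∣ - 1ℤ                          ∎
    where
    open ≡-Reasoning
    add-sub : ∀ a b → a ≡ a + b - b
    add-sub = solve-∀
    complement : ∀ {P : Set} (d : Dec P) → 𝟙 (¬? d) + 𝟙 d ≡ 1ℤ
    complement (yes _) = refl
    complement (no _)  = refl

  opaque
    unfolding ∑ˡ

    ∑ˡ-length : {A : Set} (xs : List A) → ∑ˡ xs (λ _ → 1ℤ) ≡ + Data.List.length xs
    ∑ˡ-length []       = refl
    ∑ˡ-length (x ∷ xs) = cong (ℤ._+_ 1ℤ) (∑ˡ-length xs)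

  card-Vec : {A : Set} {{_ : Finite A}} → ∀ n → ∣ Vec A (suc n) ∣ ≡ ∣ A ∣ * ∣ Vec A n ∣
  card-Vec {A} n = trans
    (∑-bij {Y = A × Vec A n} (λ { (x ∷ xs) → x , xs }) (λ (x , xs) → x ∷ xs)
      (λ { (_ ∷ _) → refl }) (λ _ → refl) (λ _ → refl))
    (trans (∑-× {A} {Vec A n} (λ _ → 1ℤ)) (∑-const {A} ∣ Vec A n ∣))

  card-Vec-^ : {A : Set} {{_ : Finite A}} → ∀ k → ∣ A ∣ ≡ + k → ∀ n → ∣ Vec A n ∣ ≡ + (k ℕ.^ n)
  card-Vec-^ k e zero    = ∑ˡ-singleton _ _
  card-Vec-^ {A} k e (suc n) = trans (card-Vec n)
    (trans (cong₂ _*_ e (card-Vec-^ {A} k e n)) (sym (ℤP.pos-* k (k ℕ.^ n))))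

-- Rectangular and block matrices over the field

module Matrices {r} (𝔽 : FiniteField r) where

  open import Data.Nat using (_+_)
  open FiniteSums

  open FiniteField 𝔽 public
    renaming (_+_ to infixl 6 _+ᶠ_; _*_ to infixl 7 _*ᶠ_; -_ to -ᶠ_; _≟_ to _≟ᶠ_; _⁻¹ to _⁻¹ᶠ)

  F-ring : CommutativeRing _ _
  F-ring = record { isCommutativeRing = isCommutativeRing }

  module Fᴿ = CommutativeRing F-ring
  module F+ = CommutativeSemigroupP Fᴿ.+-commutativeSemigroup

  instance
    finite-F : Finite F
    finite-F = uniqueFinite _≟ᶠ_ elems
      (UniqueP.map⁺ to-injective (UniqueP.allFin⁺ q))
      (λ x → subst (_∈ elems) (Inverse.strictlyInverseˡ enum x)
               (∈-map⁺ (Inverse.to enum) (∈-allFin (Inverse.from enum x))))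
      where
      to-injective : ∀ {i j} → Inverse.to enum i ≡ Inverse.to enum j → i ≡ j
      to-injective {i} {j} e = trans (sym (Inverse.strictlyInverseʳ enum i))
        (trans (cong (Inverse.from enum) e) (Inverse.strictlyInverseʳ enum j))

  opaque
    ∑ᶠ : ∀ {n} → (Fin n → F) → F
    ∑ᶠ = sumF

    ∑ᶠ-cong : ∀ {n} {f g : Fin n → F} → (∀ i → f i ≡ g i) → ∑ᶠ f ≡ ∑ᶠ g
    ∑ᶠ-cong {zero}  e = refl
    ∑ᶠ-cong {suc n} e = cong₂ _+ᶠ_ (e zero) (∑ᶠ-cong (e ∘ suc))

    ∑ᶠ-zero : ∀ n → ∑ᶠ {n} (λ _ → 0#) ≡ 0#
    ∑ᶠ-zero zero    = refl
    ∑ᶠ-zero (suc n) = trans (Fᴿ.+-identityˡ _) (∑ᶠ-zero n)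

    ∑ᶠ-+ : ∀ {n} (f g : Fin n → F) → ∑ᶠ (λ i → f i +ᶠ g i) ≡ ∑ᶠ f +ᶠ ∑ᶠ g
    ∑ᶠ-+ {zero}  f g = sym (Fᴿ.+-identityˡ 0#)
    ∑ᶠ-+ {suc n} f g = trans (cong (f zero +ᶠ g zero +ᶠ_) (∑ᶠ-+ (f ∘ suc) (g ∘ suc)))
      (F+.interchange (f zero) (g zero) (∑ᶠ (f ∘ suc)) (∑ᶠ (g ∘ suc)))

    ∑ᶠ-*ˡ : ∀ {n} c (f : Fin n → F) → ∑ᶠ (λ i → c *ᶠ f i) ≡ c *ᶠ ∑ᶠ f
    ∑ᶠ-*ˡ {zero}  c f = sym (Fᴿ.zeroʳ c)
    ∑ᶠ-*ˡ {suc n} c f = trans (cong (c *ᶠ f zero +ᶠ_) (∑ᶠ-*ˡ c (f ∘ suc)))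
      (sym (Fᴿ.distribˡ c (f zero) _))

    ∑ᶠ-*ʳ : ∀ {n} c (f : Fin n → F) → ∑ᶠ (λ i → f i *ᶠ c) ≡ ∑ᶠ f *ᶠ c
    ∑ᶠ-*ʳ c f = trans (∑ᶠ-cong (λ i → Fᴿ.*-comm (f i) c))
      (trans (∑ᶠ-*ˡ c f) (Fᴿ.*-comm c _))

    ∑ᶠ-swap : ∀ {m n} (f : Fin m → Fin n → F) →
      ∑ᶠ (λ i → ∑ᶠ (f i)) ≡ ∑ᶠ (λ j → ∑ᶠ (λ i → f i j))
    ∑ᶠ-swap {zero} {n} f = sym (∑ᶠ-zero n)
    ∑ᶠ-swap {suc m} f = trans (cong (∑ᶠ (f zero) +ᶠ_) (∑ᶠ-swap (f ∘ suc)))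
      (sym (∑ᶠ-+ (f zero) _))

    ∑ᶠ-++ : ∀ a {b} (f : Fin (a + b) → F) →
      ∑ᶠ f ≡ ∑ᶠ (λ i → f (i ↑ˡ b)) +ᶠ ∑ᶠ (λ j → f (a ↑ʳ j))
    ∑ᶠ-++ zero    f = sym (Fᴿ.+-identityˡ _)
    ∑ᶠ-++ (suc a) f = trans (cong (f zero +ᶠ_) (∑ᶠ-++ a (f ∘ suc))) (sym (Fᴿ.+-assoc _ _ _))

  -- Kronecker delta on natural numbers, as in `idM`, which compares the values `toℕ`; passing to a
  -- block then only shifts the arguments.
  δ : ℕ → ℕ → F
  δ i j = if does (i ℕ.≟ j) then 1# else 0#

  δ-sym : ∀ i j → δ i j ≡ δ j i
  δ-sym zero    zero    = refl
  δ-sym zero    (suc j) = refl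
  δ-sym (suc i) zero    = refl
  δ-sym (suc i) (suc j) = δ-sym i j

  opaque
    unfolding ∑ᶠ

    ∑ᶠ-δ : ∀ {n} (i : Fin n) (f : Fin n → F) → ∑ᶠ (λ k → δ (toℕ i) (toℕ k) *ᶠ f k) ≡ f i
    ∑ᶠ-δ {suc n} zero f = trans
      (cong₂ _+ᶠ_ (Fᴿ.*-identityˡ _)
        (trans (∑ᶠ-cong (λ k → Fᴿ.zeroˡ (f (suc k)))) (∑ᶠ-zero n)))
      (Fᴿ.+-identityʳ _)
    ∑ᶠ-δ {suc n} (suc i) f = trans
      (cong₂ _+ᶠ_ (Fᴿ.zeroˡ (f zero)) (∑ᶠ-δ i (f ∘ suc))) (Fᴿ.+-identityˡ _)

  Mx : ℕ → ℕ → Set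
  Mx m n = Vec (Vec F n) m

  opaque
    at : ∀ {m n} → Mx m n → Fin m → Fin n → F
    at M i j = lookup (lookup M i) j

    mk : ∀ {m n} → (Fin m → Fin n → F) → Mx m n
    mk f = tabulate (λ i → tabulate (f i))

    at-mk : ∀ {m n} (f : Fin m → Fin n → F) i j → at (mk f) i j ≡ f i j
    at-mk f i j = trans (cong (λ v → lookup v j) (VP.lookup∘tabulate _ i)) (VP.lookup∘tabulate (f i) j)

    Vec-ext : {A : Set} → ∀ {n} (u v : Vec A n) → (∀ i → lookup u i ≡ lookup v i) → u ≡ v
    Vec-ext u v e = trans (sym (VP.tabulate∘lookup u)) (trans (VP.tabulate-cong e) (VP.tabulate∘lookup v))

    ext : ∀ {m n} {A B : Mx m n} → (∀ i j → at A i j ≡ at B i j) → A ≡ B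
    ext {A = A} {B} e = Vec-ext A B (λ i → Vec-ext _ _ (e i))

  -- The case distinction behind all block identities: an index of a + b lies among the first a or
  -- among the last b.
  ↑-cover : ∀ a {b} {P : Fin (a + b) → Set} →
    (∀ i → P (i ↑ˡ b)) → (∀ j → P (a ↑ʳ j)) → ∀ k → P k
  ↑-cover a {b} {P} l r k with splitAt a k in eq
  ... | inj₁ i = subst P (FinP.splitAt⁻¹-↑ˡ eq) (l i)
  ... | inj₂ j = subst P (FinP.splitAt⁻¹-↑ʳ eq) (r j)

  infixl 6 _⊞_
  infixl 7 _∙_
  infixr 7 _·_
  infix 8 _ᵀ

  opaque
    unfolding at ∑ᶠ

    _⊞_ : ∀ {m n} → Mx m n → Mx m n → Mx m n
    A ⊞ B = mk (λ i j → at A i j +ᶠ at B i j)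

    _·_ : ∀ {m n} → F → Mx m n → Mx m n
    c · A = mk (λ i j → c *ᶠ at A i j)

    _∙_ : ∀ {l m n} → Mx l m → Mx m n → Mx l n
    A ∙ B = mk (λ i j → ∑ᶠ (λ k → at A i k *ᶠ at B k j))

    _ᵀ : ∀ {m n} → Mx m n → Mx n m
    A ᵀ = mk (λ i j → at A j i)

    𝟘 : ∀ {m n} → Mx m n
    𝟘 = mk (λ _ _ → 0#)

    I : ∀ {n} → Mx n n
    I = mk (λ i j → δ (toℕ i) (toℕ j))

    tr : ∀ {n} → Mx n n → F
    tr A = ∑ᶠ (λ i → at A i i)

    hcat : ∀ {m a b} → Mx m a → Mx m b → Mx m (a + b)
    hcat A B = V.zipWith V._++_ A B

    vcat : ∀ {a b n} → Mx a n → Mx b n → Mx (a + b) n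
    vcat A B = A V.++ B

    at≡entry : ∀ {n} (A : Mat n) i j → at A i j ≡ entry A i j
    at≡entry A i j = refl

    ∙≡⊗ : ∀ {n} (A B : Mat n) → A ∙ B ≡ A ⊗ B
    ∙≡⊗ A B = refl

    ᵀ≡transpose : ∀ {n} (A : Mat n) → A ᵀ ≡ transpose A
    ᵀ≡transpose A = refl

    𝟘≡zeroM : ∀ {n} → 𝟘 {n} {n} ≡ zeroM
    𝟘≡zeroM = refl

    I≡idM : ∀ {n} → I {n} ≡ idM
    I≡idM = refl

    tr≡Tr : ∀ {n} (A : Mat n) → tr A ≡ Tr A
    tr≡Tr A = refl

    vcat-hcat≡block : ∀ {n} (X Y Z W : Mat n) → vcat (hcat X Y) (hcat Z W) ≡ block X Y Z W
    vcat-hcat≡block X Y Z W = refl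

    at-⊞ : ∀ {m n} (A B : Mx m n) i j → at (A ⊞ B) i j ≡ at A i j +ᶠ at B i j
    at-⊞ A B = at-mk _

    at-· : ∀ {m n} c (A : Mx m n) i j → at (c · A) i j ≡ c *ᶠ at A i j
    at-· c A = at-mk _

    at-∙ : ∀ {l m n} (A : Mx l m) (B : Mx m n) i j →
      at (A ∙ B) i j ≡ ∑ᶠ (λ k → at A i k *ᶠ at B k j)
    at-∙ A B = at-mk _

    at-ᵀ : ∀ {m n} (A : Mx m n) i j → at (A ᵀ) i j ≡ at A j i
    at-ᵀ A = at-mk _

    at-𝟘 : ∀ {m n} i j → at (𝟘 {m} {n}) i j ≡ 0#
    at-𝟘 = at-mk _

    at-I : ∀ {n} i j → at (I {n}) i j ≡ δ (toℕ i) (toℕ j)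
    at-I = at-mk _

    tr-at : ∀ {n} (A : Mx n n) → tr A ≡ ∑ᶠ (λ i → at A i i)
    tr-at A = refl

    at-hcatˡ : ∀ {m a b} (A : Mx m a) (B : Mx m b) i j → at (hcat A B) i (j ↑ˡ b) ≡ at A i j
    at-hcatˡ A B i j = trans (cong (λ v → lookup v (j ↑ˡ _)) (VP.lookup-zipWith _ i A B))
      (VP.lookup-++ˡ (lookup A i) _ j)

    at-hcatʳ : ∀ {m a b} (A : Mx m a) (B : Mx m b) i j → at (hcat A B) i (a ↑ʳ j) ≡ at B i j
    at-hcatʳ A B i j = trans (cong (λ v → lookup v (_ ↑ʳ j)) (VP.lookup-zipWith _ i A B))
      (VP.lookup-++ʳ (lookup A i) _ j)

    at-vcatˡ : ∀ {a b n} (A : Mx a n) (B : Mx b n) i j → at (vcat A B) (i ↑ˡ b) j ≡ at A i j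
    at-vcatˡ A B i j = cong (λ v → lookup v j) (VP.lookup-++ˡ A B i)

    at-vcatʳ : ∀ {a b n} (A : Mx a n) (B : Mx b n) i j → at (vcat A B) (a ↑ʳ i) j ≡ at B i j
    at-vcatʳ A B i j = cong (λ v → lookup v j) (VP.lookup-++ʳ A B i)

  ⊞-assoc : ∀ {m n} (A B C : Mx m n) → (A ⊞ B) ⊞ C ≡ A ⊞ (B ⊞ C)
  ⊞-assoc A B C = ext λ i j → begin
    at (A ⊞ B ⊞ C) i j                    ≡⟨ at-⊞ (A ⊞ B) C i j ⟩
    at (A ⊞ B) i j +ᶠ at C i j            ≡⟨ cong (_+ᶠ _) (at-⊞ A B i j) ⟩
    at A i j +ᶠ at B i j +ᶠ at C i j      ≡⟨ Fᴿ.+-assoc _ _ _ ⟩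
    at A i j +ᶠ (at B i j +ᶠ at C i j)    ≡⟨ cong (at A i j +ᶠ_) (at-⊞ B C i j) ⟨
    at A i j +ᶠ at (B ⊞ C) i j            ≡⟨ at-⊞ A (B ⊞ C) i j ⟨
    at (A ⊞ (B ⊞ C)) i j                  ∎

  ⊞-comm : ∀ {m n} (A B : Mx m n) → A ⊞ B ≡ B ⊞ A
  ⊞-comm A B = ext λ i j → trans (at-⊞ A B i j) (trans (Fᴿ.+-comm _ _) (sym (at-⊞ B A i j)))

  ⊞-identityˡ : ∀ {m n} (A : Mx m n) → 𝟘 ⊞ A ≡ A
  ⊞-identityˡ A = ext λ i j → trans (at-⊞ 𝟘 A i j)
    (trans (cong (_+ᶠ at A i j) (at-𝟘 i j)) (Fᴿ.+-identityˡ _))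

  ⊞-identityʳ : ∀ {m n} (A : Mx m n) → A ⊞ 𝟘 ≡ A
  ⊞-identityʳ A = trans (⊞-comm A 𝟘) (⊞-identityˡ A)

  ∙-assoc : ∀ {k l m n} (A : Mx k l) (B : Mx l m) (C : Mx m n) → (A ∙ B) ∙ C ≡ A ∙ (B ∙ C)
  ∙-assoc A B C = ext λ i j → begin
    at ((A ∙ B) ∙ C) i j
      ≡⟨ at-∙ (A ∙ B) C i j ⟩
    ∑ᶠ (λ k → at (A ∙ B) i k *ᶠ at C k j)
      ≡⟨ ∑ᶠ-cong (λ k → trans (cong (_*ᶠ at C k j) (at-∙ A B i k)) (sym (∑ᶠ-*ʳ _ _))) ⟩
    ∑ᶠ (λ k → ∑ᶠ (λ l → at A i l *ᶠ at B l k *ᶠ at C k j))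
      ≡⟨ ∑ᶠ-swap _ ⟩
    ∑ᶠ (λ l → ∑ᶠ (λ k → at A i l *ᶠ at B l k *ᶠ at C k j))
      ≡⟨ ∑ᶠ-cong (λ l → trans (∑ᶠ-cong (λ k → Fᴿ.*-assoc _ _ _)) (∑ᶠ-*ˡ _ _)) ⟩
    ∑ᶠ (λ l → at A i l *ᶠ ∑ᶠ (λ k → at B l k *ᶠ at C k j))
      ≡⟨ ∑ᶠ-cong (λ l → cong (at A i l *ᶠ_) (sym (at-∙ B C l j))) ⟩
    ∑ᶠ (λ l → at A i l *ᶠ at (B ∙ C) l j)
      ≡⟨ at-∙ A (B ∙ C) i j ⟨
    at (A ∙ (B ∙ C)) i j ∎

  ∙-identityˡ : ∀ {m n} (A : Mx m n) → I ∙ A ≡ A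
  ∙-identityˡ A = ext λ i j → trans (at-∙ I A i j)
    (trans (∑ᶠ-cong (λ k → cong (_*ᶠ at A k j) (at-I i k))) (∑ᶠ-δ i _))

  ∙-identityʳ : ∀ {m n} (A : Mx m n) → A ∙ I ≡ A
  ∙-identityʳ A = ext λ i j → trans (at-∙ A I i j)
    (trans (∑ᶠ-cong (λ k → trans (Fᴿ.*-comm _ _)
      (cong (_*ᶠ at A i k) (trans (at-I k j) (δ-sym (toℕ k) (toℕ j)))))) (∑ᶠ-δ j _))

  ∙-zeroˡ : ∀ {l m n} (A : Mx m n) → 𝟘 {l} ∙ A ≡ 𝟘
  ∙-zeroˡ {m = m} A = ext λ i j → trans (at-∙ 𝟘 A i j)
    (trans (∑ᶠ-cong (λ k → trans (cong (_*ᶠ at A k j) (at-𝟘 i k)) (Fᴿ.zeroˡ _)))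
    (trans (∑ᶠ-zero m) (sym (at-𝟘 i j))))

  ∙-zeroʳ : ∀ {l m n} (A : Mx l m) → A ∙ 𝟘 {m} {n} ≡ 𝟘
  ∙-zeroʳ {m = m} A = ext λ i j → trans (at-∙ A 𝟘 i j)
    (trans (∑ᶠ-cong (λ k → trans (cong (at A i k *ᶠ_) (at-𝟘 k j)) (Fᴿ.zeroʳ _)))
    (trans (∑ᶠ-zero m) (sym (at-𝟘 i j))))

  ∙-distribˡ-⊞ : ∀ {l m n} (A : Mx l m) (B C : Mx m n) → A ∙ (B ⊞ C) ≡ A ∙ B ⊞ A ∙ C
  ∙-distribˡ-⊞ A B C = ext λ i j → trans (at-∙ A (B ⊞ C) i j)
    (trans (∑ᶠ-cong (λ k → trans (cong (at A i k *ᶠ_) (at-⊞ B C k j)) (Fᴿ.distribˡ _ _ _)))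
    (trans (∑ᶠ-+ _ _)
    (trans (cong₂ _+ᶠ_ (sym (at-∙ A B i j)) (sym (at-∙ A C i j))) (sym (at-⊞ _ _ i j)))))

  ∙-distribʳ-⊞ : ∀ {l m n} (A : Mx m n) (B C : Mx l m) → (B ⊞ C) ∙ A ≡ B ∙ A ⊞ C ∙ A
  ∙-distribʳ-⊞ A B C = ext λ i j → trans (at-∙ (B ⊞ C) A i j)
    (trans (∑ᶠ-cong (λ k → trans (cong (_*ᶠ at A k j) (at-⊞ B C i k)) (Fᴿ.distribʳ _ _ _)))
    (trans (∑ᶠ-+ _ _)
    (trans (cong₂ _+ᶠ_ (sym (at-∙ B A i j)) (sym (at-∙ C A i j))) (sym (at-⊞ _ _ i j)))))

  ∙-·ʳ : ∀ {l m n} c (A : Mx l m) (B : Mx m n) → A ∙ (c · B) ≡ c · (A ∙ B)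
  ∙-·ʳ c A B = ext λ i j → trans (at-∙ A (c · B) i j)
    (trans (∑ᶠ-cong (λ k → trans (cong (at A i k *ᶠ_) (at-· c B k j))
      (trans (sym (Fᴿ.*-assoc _ _ _)) (trans (cong (_*ᶠ at B k j) (Fᴿ.*-comm _ c)) (Fᴿ.*-assoc _ _ _)))))
    (trans (∑ᶠ-*ˡ c _)
    (trans (cong (c *ᶠ_) (sym (at-∙ A B i j))) (sym (at-· c (A ∙ B) i j)))))

  ᵀ-· : ∀ {m n} c (A : Mx m n) → (c · A) ᵀ ≡ c · A ᵀ
  ᵀ-· c A = ext λ i j → trans (at-ᵀ (c · A) i j) (trans (at-· c A j i)
    (trans (cong (c *ᶠ_) (sym (at-ᵀ A i j))) (sym (at-· c (A ᵀ) i j))))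

  ᵀ-involutive : ∀ {m n} (A : Mx m n) → A ᵀ ᵀ ≡ A
  ᵀ-involutive A = ext λ i j → trans (at-ᵀ (A ᵀ) i j) (at-ᵀ A j i)

  ᵀ-∙ : ∀ {l m n} (A : Mx l m) (B : Mx m n) → (A ∙ B) ᵀ ≡ B ᵀ ∙ A ᵀ
  ᵀ-∙ A B = ext λ i j → trans (at-ᵀ (A ∙ B) i j) (trans (at-∙ A B j i)
    (trans (∑ᶠ-cong (λ k → trans (Fᴿ.*-comm _ _) (sym (cong₂ _*ᶠ_ (at-ᵀ B i k) (at-ᵀ A k j)))))
    (sym (at-∙ (B ᵀ) (A ᵀ) i j))))

  ᵀ-⊞ : ∀ {m n} (A B : Mx m n) → (A ⊞ B) ᵀ ≡ A ᵀ ⊞ B ᵀ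
  ᵀ-⊞ A B = ext λ i j → trans (at-ᵀ (A ⊞ B) i j) (trans (at-⊞ A B j i)
    (trans (sym (cong₂ _+ᶠ_ (at-ᵀ A i j) (at-ᵀ B i j))) (sym (at-⊞ (A ᵀ) (B ᵀ) i j))))

  ᵀ-I : ∀ {n} → I {n} ᵀ ≡ I
  ᵀ-I = ext λ i j → trans (at-ᵀ I i j)
    (trans (at-I j i) (trans (δ-sym (toℕ j) (toℕ i)) (sym (at-I i j))))

  ᵀ-𝟘 : ∀ {m n} → 𝟘 {m} {n} ᵀ ≡ 𝟘
  ᵀ-𝟘 = ext λ i j → trans (at-ᵀ 𝟘 i j) (trans (at-𝟘 j i) (sym (at-𝟘 i j)))

  tr-⊞ : ∀ {n} (A B : Mx n n) → tr (A ⊞ B) ≡ tr A +ᶠ tr B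
  tr-⊞ A B = trans (tr-at (A ⊞ B)) (trans (∑ᶠ-cong (λ i → at-⊞ A B i i))
    (trans (∑ᶠ-+ _ _) (sym (cong₂ _+ᶠ_ (tr-at A) (tr-at B)))))

  tr-· : ∀ {n} c (A : Mx n n) → tr (c · A) ≡ c *ᶠ tr A
  tr-· c A = trans (tr-at (c · A)) (trans (∑ᶠ-cong (λ i → at-· c A i i))
    (trans (∑ᶠ-*ˡ c _) (cong (c *ᶠ_) (sym (tr-at A)))))

  tr-ᵀ : ∀ {n} (A : Mx n n) → tr (A ᵀ) ≡ tr A
  tr-ᵀ A = trans (tr-at (A ᵀ)) (trans (∑ᶠ-cong (λ i → at-ᵀ A i i)) (sym (tr-at A)))

  tr-𝟘 : ∀ n → tr (𝟘 {n}) ≡ 0#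
  tr-𝟘 n = trans (tr-at 𝟘) (trans (∑ᶠ-cong (λ i → at-𝟘 i i)) (∑ᶠ-zero n))

  tr-∙-comm : ∀ {m n} (A : Mx m n) (B : Mx n m) → tr (A ∙ B) ≡ tr (B ∙ A)
  tr-∙-comm A B = begin
    tr (A ∙ B)                                     ≡⟨ tr-at (A ∙ B) ⟩
    ∑ᶠ (λ i → at (A ∙ B) i i)                    ≡⟨ ∑ᶠ-cong (λ i → at-∙ A B i i) ⟩
    ∑ᶠ (λ i → ∑ᶠ (λ k → at A i k *ᶠ at B k i)) ≡⟨ ∑ᶠ-swap _ ⟩
    ∑ᶠ (λ k → ∑ᶠ (λ i → at A i k *ᶠ at B k i))
      ≡⟨ ∑ᶠ-cong (λ k → ∑ᶠ-cong (λ i → Fᴿ.*-comm (at A i k) _)) ⟩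
    ∑ᶠ (λ k → ∑ᶠ (λ i → at B k i *ᶠ at A i k)) ≡⟨ ∑ᶠ-cong (λ k → at-∙ B A k k) ⟨
    ∑ᶠ (λ k → at (B ∙ A) k k)                    ≡⟨ tr-at (B ∙ A) ⟨
    tr (B ∙ A)                                     ∎

  opaque
    left : ∀ a b {m} → Mx m (a + b) → Mx m a
    left a b M = mk (λ i j → at M i (j ↑ˡ b))

    right : ∀ a b {m} → Mx m (a + b) → Mx m b
    right a b M = mk (λ i j → at M i (a ↑ʳ j))

    top : ∀ a b {n} → Mx (a + b) n → Mx a n
    top a b M = mk (λ i j → at M (i ↑ˡ b) j)

    bot : ∀ a b {n} → Mx (a + b) n → Mx b n
    bot a b M = mk (λ i j → at M (a ↑ʳ i) j)

    left-hcat : ∀ {a b m} (A : Mx m a) (B : Mx m b) → left a b (hcat A B) ≡ A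
    left-hcat A B = ext λ i j → trans (at-mk _ i j) (at-hcatˡ A B i j)

    right-hcat : ∀ {a b m} (A : Mx m a) (B : Mx m b) → right a b (hcat A B) ≡ B
    right-hcat A B = ext λ i j → trans (at-mk _ i j) (at-hcatʳ A B i j)

    top-vcat : ∀ {a b n} (A : Mx a n) (B : Mx b n) → top a b (vcat A B) ≡ A
    top-vcat A B = ext λ i j → trans (at-mk _ i j) (at-vcatˡ A B i j)

    bot-vcat : ∀ {a b n} (A : Mx a n) (B : Mx b n) → bot a b (vcat A B) ≡ B
    bot-vcat A B = ext λ i j → trans (at-mk _ i j) (at-vcatʳ A B i j)

    hcat-η : ∀ a b {m} (M : Mx m (a + b)) → hcat (left a b M) (right a b M) ≡ M
    hcat-η a b M = ext λ i → ↑-cover a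
      (λ j → trans (at-hcatˡ _ _ i j) (at-mk _ i j))
      (λ j → trans (at-hcatʳ _ _ i j) (at-mk _ i j))

    vcat-η : ∀ a b {n} (M : Mx (a + b) n) → vcat (top a b M) (bot a b M) ≡ M
    vcat-η a b M = ext λ i j → ↑-cover a {P = λ i → at (vcat (top a b M) (bot a b M)) i j ≡ at M i j}
      (λ i → trans (at-vcatˡ _ _ i j) (at-mk _ i j))
      (λ i → trans (at-vcatʳ _ _ i j) (at-mk _ i j)) i

  hcat-injective : ∀ {m a b} {A A′ : Mx m a} {B B′ : Mx m b} →
    hcat A B ≡ hcat A′ B′ → A ≡ A′ × B ≡ B′
  hcat-injective {a = a} {b} e =
    trans (sym (left-hcat _ _)) (trans (cong (left a b) e) (left-hcat _ _)) ,
    trans (sym (right-hcat _ _)) (trans (cong (right a b) e) (right-hcat _ _))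

  vcat-injective : ∀ {a b n} {A A′ : Mx a n} {B B′ : Mx b n} →
    vcat A B ≡ vcat A′ B′ → A ≡ A′ × B ≡ B′
  vcat-injective {a = a} {b} e =
    trans (sym (top-vcat _ _)) (trans (cong (top a b) e) (top-vcat _ _)) ,
    trans (sym (bot-vcat _ _)) (trans (cong (bot a b) e) (bot-vcat _ _))

  hcat-∙-vcat : ∀ {m a b n} (A : Mx m a) (B : Mx m b) (C : Mx a n) (D : Mx b n) →
    hcat A B ∙ vcat C D ≡ A ∙ C ⊞ B ∙ D
  hcat-∙-vcat {a = a} {b} A B C D = ext λ i j → begin
    at (hcat A B ∙ vcat C D) i j
      ≡⟨ at-∙ _ _ i j ⟩
    ∑ᶠ (λ k → at (hcat A B) i k *ᶠ at (vcat C D) k j)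
      ≡⟨ ∑ᶠ-++ a _ ⟩
    ∑ᶠ (λ k → at (hcat A B) i (k ↑ˡ b) *ᶠ at (vcat C D) (k ↑ˡ b) j) +ᶠ
    ∑ᶠ (λ k → at (hcat A B) i (a ↑ʳ k) *ᶠ at (vcat C D) (a ↑ʳ k) j)
      ≡⟨ cong₂ _+ᶠ_ (∑ᶠ-cong (λ k → cong₂ _*ᶠ_ (at-hcatˡ A B i k) (at-vcatˡ C D k j)))
                    (∑ᶠ-cong (λ k → cong₂ _*ᶠ_ (at-hcatʳ A B i k) (at-vcatʳ C D k j))) ⟩
    ∑ᶠ (λ k → at A i k *ᶠ at C k j) +ᶠ ∑ᶠ (λ k → at B i k *ᶠ at D k j)
      ≡⟨ cong₂ _+ᶠ_ (at-∙ A C i j) (at-∙ B D i j) ⟨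
    at (A ∙ C) i j +ᶠ at (B ∙ D) i j
      ≡⟨ at-⊞ _ _ i j ⟨
    at (A ∙ C ⊞ B ∙ D) i j ∎

  ∙-hcat : ∀ {l m a b} (A : Mx l m) (B : Mx m a) (C : Mx m b) →
    A ∙ hcat B C ≡ hcat (A ∙ B) (A ∙ C)
  ∙-hcat {a = a} A B C = ext λ i → ↑-cover a
    (λ j → trans (at-∙ _ _ i _) (trans (∑ᶠ-cong (λ k → cong (at A i k *ᶠ_) (at-hcatˡ B C k j)))
      (sym (trans (at-hcatˡ _ _ i j) (at-∙ A B i j)))))
    (λ j → trans (at-∙ _ _ i _) (trans (∑ᶠ-cong (λ k → cong (at A i k *ᶠ_) (at-hcatʳ B C k j)))
      (sym (trans (at-hcatʳ _ _ i j) (at-∙ A C i j)))))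

  ᵀ-hcat : ∀ {m a b} (A : Mx m a) (B : Mx m b) → hcat A B ᵀ ≡ vcat (A ᵀ) (B ᵀ)
  ᵀ-hcat {a = a} {b} A B = ext λ i j →
    ↑-cover a {P = λ i → at (hcat A B ᵀ) i j ≡ at (vcat (A ᵀ) (B ᵀ)) i j}
    (λ i → trans (at-ᵀ _ (i ↑ˡ b) j) (trans (at-hcatˡ A B j i)
      (sym (trans (at-vcatˡ (A ᵀ) (B ᵀ) i j) (at-ᵀ A i j)))))
    (λ i → trans (at-ᵀ _ (a ↑ʳ i) j) (trans (at-hcatʳ A B j i)
      (sym (trans (at-vcatʳ (A ᵀ) (B ᵀ) i j) (at-ᵀ B i j))))) i

  ᵀ-vcat : ∀ {a b n} (A : Mx a n) (B : Mx b n) → vcat A B ᵀ ≡ hcat (A ᵀ) (B ᵀ)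
  ᵀ-vcat A B = begin
    vcat A B ᵀ                     ≡⟨ cong₂ (λ X Y → vcat X Y ᵀ) (ᵀ-involutive A) (ᵀ-involutive B) ⟨
    vcat (A ᵀ ᵀ) (B ᵀ ᵀ) ᵀ         ≡⟨ cong _ᵀ (ᵀ-hcat (A ᵀ) (B ᵀ)) ⟨
    hcat (A ᵀ) (B ᵀ) ᵀ ᵀ           ≡⟨ ᵀ-involutive _ ⟩
    hcat (A ᵀ) (B ᵀ)               ∎

  vcat-∙ : ∀ {a b m n} (A : Mx a m) (B : Mx b m) (C : Mx m n) →
    vcat A B ∙ C ≡ vcat (A ∙ C) (B ∙ C)
  vcat-∙ {a} {b} A B C = ext λ i j →
    ↑-cover a {P = λ i → at (vcat A B ∙ C) i j ≡ at (vcat (A ∙ C) (B ∙ C)) i j}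
    (λ i → trans (at-∙ _ _ (i ↑ˡ b) j)
      (trans (∑ᶠ-cong (λ k → cong (_*ᶠ at C k j) (at-vcatˡ A B i k)))
      (sym (trans (at-vcatˡ (A ∙ C) (B ∙ C) i j) (at-∙ A C i j)))))
    (λ i → trans (at-∙ _ _ (a ↑ʳ i) j)
      (trans (∑ᶠ-cong (λ k → cong (_*ᶠ at C k j) (at-vcatʳ A B i k)))
      (sym (trans (at-vcatʳ (A ∙ C) (B ∙ C) i j) (at-∙ B C i j))))) i

  hcat-⊞ : ∀ {m a b} (A A′ : Mx m a) (B B′ : Mx m b) →
    hcat A B ⊞ hcat A′ B′ ≡ hcat (A ⊞ A′) (B ⊞ B′)
  hcat-⊞ {a = a} A A′ B B′ = ext λ i → ↑-cover a
    (λ j → trans (at-⊞ _ _ i _) (trans (cong₂ _+ᶠ_ (at-hcatˡ A B i j) (at-hcatˡ A′ B′ i j))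
      (sym (trans (at-hcatˡ _ _ i j) (at-⊞ A A′ i j)))))
    (λ j → trans (at-⊞ _ _ i _) (trans (cong₂ _+ᶠ_ (at-hcatʳ A B i j) (at-hcatʳ A′ B′ i j))
      (sym (trans (at-hcatʳ _ _ i j) (at-⊞ B B′ i j)))))

  vcat-⊞ : ∀ {a b n} (A A′ : Mx a n) (B B′ : Mx b n) →
    vcat A B ⊞ vcat A′ B′ ≡ vcat (A ⊞ A′) (B ⊞ B′)
  vcat-⊞ {a} {b} A A′ B B′ = ext λ i j →
    ↑-cover a {P = λ i → at (vcat A B ⊞ vcat A′ B′) i j ≡ at (vcat (A ⊞ A′) (B ⊞ B′)) i j}
    (λ i → trans (at-⊞ _ _ (i ↑ˡ b) j) (trans (cong₂ _+ᶠ_ (at-vcatˡ A B i j) (at-vcatˡ A′ B′ i j))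
      (sym (trans (at-vcatˡ _ _ i j) (at-⊞ A A′ i j)))))
    (λ i → trans (at-⊞ _ _ (a ↑ʳ i) j) (trans (cong₂ _+ᶠ_ (at-vcatʳ A B i j) (at-vcatʳ A′ B′ i j))
      (sym (trans (at-vcatʳ _ _ i j) (at-⊞ B B′ i j))))) i

  δ-↑ˡ↑ʳ : ∀ {a} b (i : Fin a) (j : Fin b) → δ (toℕ (i ↑ˡ b)) (toℕ (a ↑ʳ j)) ≡ 0#
  δ-↑ˡ↑ʳ b zero    j = refl
  δ-↑ˡ↑ʳ b (suc i) j = δ-↑ˡ↑ʳ b i j

  δ-↑ʳ : ∀ a i j → δ (a + i) (a + j) ≡ δ i j
  δ-↑ʳ zero    i j = refl
  δ-↑ʳ (suc a) i j = δ-↑ʳ a i j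

  blk : ∀ {a b c d} → Mx a c → Mx a d → Mx b c → Mx b d → Mx (a + b) (c + d)
  blk X Y Z W = vcat (hcat X Y) (hcat Z W)

  I-blk : ∀ a b → I {a + b} ≡ blk (I {a}) 𝟘 𝟘 (I {b})
  I-blk a b = ext λ i j →
    ↑-cover a {P = λ i → at I i j ≡ at (blk {a} {b} {a} {b} I 𝟘 𝟘 I) i j}
    (λ i → trans (↑-cover a {P = λ j → at I (i ↑ˡ b) j ≡ at (hcat I 𝟘) i j}
       (λ j → trans (at-I _ _) (trans (cong₂ δ (FinP.toℕ-↑ˡ i b) (FinP.toℕ-↑ˡ j b))
         (sym (trans (at-hcatˡ _ _ i j) (at-I i j)))))
       (λ j → trans (at-I _ _) (trans (δ-↑ˡ↑ʳ b i j) (sym (trans (at-hcatʳ _ _ i j) (at-𝟘 i j))))) j)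
       (sym (at-vcatˡ _ _ i j)))
    (λ i → trans (↑-cover a {P = λ j → at I (a ↑ʳ i) j ≡ at (hcat 𝟘 I) i j}
       (λ j → trans (at-I _ _) (trans (δ-sym (toℕ (a ↑ʳ i)) _) (trans (δ-↑ˡ↑ʳ b j i)
         (sym (trans (at-hcatˡ _ _ i j) (at-𝟘 i j))))))
       (λ j → trans (at-I _ _) (trans (cong₂ δ (FinP.toℕ-↑ʳ a i) (FinP.toℕ-↑ʳ a j))
         (trans (δ-↑ʳ a (toℕ i) (toℕ j)) (sym (trans (at-hcatʳ _ _ i j) (at-I i j)))))) j)
       (sym (at-vcatʳ _ _ i j))) i

  𝟘-hcat : ∀ {m} a b → 𝟘 {m} {a + b} ≡ hcat (𝟘 {n = a}) (𝟘 {n = b})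
  𝟘-hcat a b = ext λ i → ↑-cover a
    (λ j → trans (at-𝟘 i (j ↑ˡ b)) (sym (trans (at-hcatˡ (𝟘 {n = a}) (𝟘 {n = b}) i j) (at-𝟘 i j))))
    (λ j → trans (at-𝟘 i (a ↑ʳ j)) (sym (trans (at-hcatʳ (𝟘 {n = a}) (𝟘 {n = b}) i j) (at-𝟘 i j))))

  𝟘-vcat : ∀ a b {n} → 𝟘 {a + b} {n} ≡ vcat (𝟘 {a}) (𝟘 {b})
  𝟘-vcat a b = begin
    𝟘               ≡⟨ ᵀ-𝟘 ⟨
    𝟘 ᵀ             ≡⟨ cong _ᵀ (𝟘-hcat a b) ⟩
    hcat (𝟘 {n = a}) (𝟘 {n = b}) ᵀ ≡⟨ ᵀ-hcat 𝟘 𝟘 ⟩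
    vcat (𝟘 ᵀ) (𝟘 ᵀ) ≡⟨ cong₂ vcat ᵀ-𝟘 ᵀ-𝟘 ⟩
    vcat 𝟘 𝟘        ∎

  𝟘-blk : ∀ a b c d → 𝟘 {a + b} {c + d} ≡ blk {a} {b} {c} {d} 𝟘 𝟘 𝟘 𝟘
  𝟘-blk a b c d = trans (𝟘-vcat a b) (cong₂ vcat (𝟘-hcat c d) (𝟘-hcat c d))

  blk-injective : ∀ {a b c d} {X X′ : Mx a c} {Y Y′ : Mx a d} {Z Z′ : Mx b c} {W W′ : Mx b d} →
    blk X Y Z W ≡ blk X′ Y′ Z′ W′ → X ≡ X′ × Y ≡ Y′ × Z ≡ Z′ × W ≡ W′
  blk-injective e with vcat-injective e
  ... | e₁ , e₂ with hcat-injective e₁ | hcat-injective e₂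
  ... | x , y | z , w = x , y , z , w

  blk-cong : ∀ {a b c d} {X X′ : Mx a c} {Y Y′ : Mx a d} {Z Z′ : Mx b c} {W W′ : Mx b d} →
    X ≡ X′ → Y ≡ Y′ → Z ≡ Z′ → W ≡ W′ → blk X Y Z W ≡ blk X′ Y′ Z′ W′
  blk-cong refl refl refl refl = refl

  blk-∙ : ∀ {a b c d e f} (X : Mx a c) (Y : Mx a d) (Z : Mx b c) (W : Mx b d)
    (X′ : Mx c e) (Y′ : Mx c f) (Z′ : Mx d e) (W′ : Mx d f) →
    blk X Y Z W ∙ blk X′ Y′ Z′ W′ ≡
    blk (X ∙ X′ ⊞ Y ∙ Z′) (X ∙ Y′ ⊞ Y ∙ W′) (Z ∙ X′ ⊞ W ∙ Z′) (Z ∙ Y′ ⊞ W ∙ W′)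
  blk-∙ X Y Z W X′ Y′ Z′ W′ = trans (vcat-∙ _ _ _) (cong₂ vcat (row X Y) (row Z W))
    where
    row : ∀ {m} (A : Mx m _) (B : Mx m _) → hcat A B ∙ blk X′ Y′ Z′ W′ ≡
      hcat (A ∙ X′ ⊞ B ∙ Z′) (A ∙ Y′ ⊞ B ∙ W′)
    row A B = trans (hcat-∙-vcat A B _ _)
      (trans (cong₂ _⊞_ (∙-hcat A X′ Y′) (∙-hcat B Z′ W′)) (hcat-⊞ _ _ _ _))

  blk-ᵀ : ∀ {a b c d} (X : Mx a c) (Y : Mx a d) (Z : Mx b c) (W : Mx b d) →
    blk X Y Z W ᵀ ≡ blk (X ᵀ) (Z ᵀ) (Y ᵀ) (W ᵀ)
  blk-ᵀ X Y Z W = begin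
    vcat (hcat X Y) (hcat Z W) ᵀ               ≡⟨ ᵀ-vcat _ _ ⟩
    hcat (hcat X Y ᵀ) (hcat Z W ᵀ)             ≡⟨ cong₂ hcat (ᵀ-hcat X Y) (ᵀ-hcat Z W) ⟩
    hcat (vcat (X ᵀ) (Y ᵀ)) (vcat (Z ᵀ) (W ᵀ)) ≡⟨ hcat-vcat _ _ _ _ ⟩
    blk (X ᵀ) (Z ᵀ) (Y ᵀ) (W ᵀ)                ∎
    where
    hcat-vcat : ∀ {a b c d} (X : Mx a c) (Y : Mx b c) (Z : Mx a d) (W : Mx b d) →
      hcat (vcat X Y) (vcat Z W) ≡ blk X Z Y W
    hcat-vcat {a} {b} {c} {d} X Y Z W = ext λ i j →
      ↑-cover a {P = λ i → at (hcat (vcat X Y) (vcat Z W)) i j ≡ at (blk X Z Y W) i j}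
      (λ i → trans (↑-cover c {P = λ j → at (hcat (vcat X Y) (vcat Z W)) (i ↑ˡ b) j ≡ at (hcat X Z) i j}
        (λ j → trans (at-hcatˡ _ _ (i ↑ˡ b) j) (trans (at-vcatˡ X Y i j) (sym (at-hcatˡ _ _ i j))))
        (λ j → trans (at-hcatʳ _ _ (i ↑ˡ b) j) (trans (at-vcatˡ Z W i j) (sym (at-hcatʳ _ _ i j)))) j)
        (sym (at-vcatˡ _ _ i j)))
      (λ i → trans (↑-cover c {P = λ j → at (hcat (vcat X Y) (vcat Z W)) (a ↑ʳ i) j ≡ at (hcat Y W) i j}
        (λ j → trans (at-hcatˡ _ _ (a ↑ʳ i) j) (trans (at-vcatʳ X Y i j) (sym (at-hcatˡ _ _ i j))))
        (λ j → trans (at-hcatʳ _ _ (a ↑ʳ i) j) (trans (at-vcatʳ Z W i j) (sym (at-hcatʳ _ _ i j)))) j)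
        (sym (at-vcatʳ _ _ i j))) i

  blk-⊞ : ∀ {a b c d} (X X′ : Mx a c) (Y Y′ : Mx a d) (Z Z′ : Mx b c) (W W′ : Mx b d) →
    blk X Y Z W ⊞ blk X′ Y′ Z′ W′ ≡ blk (X ⊞ X′) (Y ⊞ Y′) (Z ⊞ Z′) (W ⊞ W′)
  blk-⊞ X X′ Y Y′ Z Z′ W W′ = trans (vcat-⊞ _ _ _ _) (cong₂ vcat (hcat-⊞ _ _ _ _) (hcat-⊞ _ _ _ _))

  tr-blk : ∀ {a b} (X : Mx a a) (Y : Mx a b) (Z : Mx b a) (W : Mx b b) →
    tr (blk X Y Z W) ≡ tr X +ᶠ tr W
  tr-blk {a} {b} X Y Z W = trans (tr-at _) (trans (∑ᶠ-++ a _) (cong₂ _+ᶠ_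
    (trans (∑ᶠ-cong (λ i → trans (at-vcatˡ _ _ i (i ↑ˡ b)) (at-hcatˡ X Y i i))) (sym (tr-at X)))
    (trans (∑ᶠ-cong (λ i → trans (at-vcatʳ _ _ i (a ↑ʳ i)) (at-hcatʳ Z W i i))) (sym (tr-at W)))))

  module _ (a b c d : ℕ) (M : Mx (a + b) (c + d)) where
    b₁₁ : Mx a c
    b₁₁ = left c d (top a b M)

    b₁₂ : Mx a d
    b₁₂ = right c d (top a b M)

    b₂₁ : Mx b c
    b₂₁ = left c d (bot a b M)

    b₂₂ : Mx b d
    b₂₂ = right c d (bot a b M)

    blk-η : blk b₁₁ b₁₂ b₂₁ b₂₂ ≡ M
    blk-η = trans (cong₂ vcat (hcat-η c d _) (hcat-η c d _)) (vcat-η a b M)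

  module _ {a b c d} (X : Mx a c) (Y : Mx a d) (Z : Mx b c) (W : Mx b d) where
    b₁₁-blk : b₁₁ a b c d (blk X Y Z W) ≡ X
    b₁₁-blk = trans (cong (left c d) (top-vcat _ _)) (left-hcat X Y)

    b₁₂-blk : b₁₂ a b c d (blk X Y Z W) ≡ Y
    b₁₂-blk = trans (cong (right c d) (top-vcat _ _)) (right-hcat X Y)

    b₂₁-blk : b₂₁ a b c d (blk X Y Z W) ≡ Z
    b₂₁-blk = trans (cong (left c d) (bot-vcat _ _)) (left-hcat Z W)

    b₂₂-blk : b₂₂ a b c d (blk X Y Z W) ≡ W
    b₂₂-blk = trans (cong (right c d) (bot-vcat _ _)) (right-hcat Z W)

  -- X ↦ B X is injective, hence surjective, so B has a right inverse, which can only be A.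
  rightInverse⇒leftInverse : ∀ {n} {A B : Mx n n} → A ∙ B ≡ I → B ∙ A ≡ I
  rightInverse⇒leftInverse {n} {A} {B} AB = subst (λ X → B ∙ X ≡ I) X≡A BX
    where
    cancel : ∀ X → A ∙ (B ∙ X) ≡ X
    cancel X = trans (sym (∙-assoc A B X)) (trans (cong (_∙ X) AB) (∙-identityˡ X))
    surj : ∃ (λ X → B ∙ X ≡ I)
    surj = injective⇒surjective (B ∙_)
      (λ X Y e → trans (sym (cancel X)) (trans (cong (A ∙_) e) (cancel Y))) I
    X : Mx n n
    X = proj₁ surj
    BX : B ∙ X ≡ I
    BX = proj₂ surj
    X≡A : X ≡ A
    X≡A = trans (sym (cancel X)) (trans (cong (A ∙_) BX) (∙-identityʳ A))

  inverse-unique : ∀ {n} {A B C : Mx n n} → A ∙ B ≡ I → A ∙ C ≡ I → B ≡ C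
  inverse-unique {A = A} {B} {C} AB AC = begin
    B           ≡⟨ ∙-identityʳ B ⟨
    B ∙ I       ≡⟨ cong (B ∙_) AC ⟨
    B ∙ (A ∙ C) ≡⟨ ∙-assoc B A C ⟨
    B ∙ A ∙ C   ≡⟨ cong (_∙ C) (rightInverse⇒leftInverse AB) ⟩
    I ∙ C       ≡⟨ ∙-identityˡ C ⟩
    C           ∎

  ∙-cancel-inverseˡ : ∀ {m n} {A B : Mx n n} → A ∙ B ≡ I → (X : Mx n m) → A ∙ (B ∙ X) ≡ X
  ∙-cancel-inverseˡ {A = A} {B} AB X =
    trans (sym (∙-assoc A B X)) (trans (cong (_∙ X) AB) (∙-identityˡ X))

  ∙-cancel-inverseʳ : ∀ {m n} {A B : Mx n n} → A ∙ B ≡ I → (X : Mx m n) → X ∙ A ∙ B ≡ X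
  ∙-cancel-inverseʳ {A = A} {B} AB X =
    trans (∙-assoc X A B) (trans (cong (X ∙_) AB) (∙-identityʳ X))

  ∙-inverse : ∀ {n} {A B C D : Mx n n} → A ∙ B ≡ I → C ∙ D ≡ I → (A ∙ C) ∙ (D ∙ B) ≡ I
  ∙-inverse {A = A} {B} {C} {D} AB CD = begin
    A ∙ C ∙ (D ∙ B)   ≡⟨ ∙-assoc A C (D ∙ B) ⟩
    A ∙ (C ∙ (D ∙ B)) ≡⟨ cong (A ∙_) (∙-cancel-inverseˡ CD B) ⟩
    A ∙ B             ≡⟨ AB ⟩
    I                 ∎

  ᵀ-inverse : ∀ {n} {A B : Mx n n} → A ∙ B ≡ I → B ᵀ ∙ A ᵀ ≡ I
  ᵀ-inverse {A = A} {B} AB = trans (sym (ᵀ-∙ A B)) (trans (cong _ᵀ AB) ᵀ-I)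

-- Counting a double coset by pairs

module DoubleCosets {r} (𝔽 : FiniteField r) where

  open import Data.Integer using (_+_; _*_; _-_)
  open FiniteSums
  open Matrices 𝔽

  -- The count uses only closure of P under products and inverses, and that σ₀ is an involution.
  -- `inv` is a function on all matrices that has to invert only on P.
  module DoubleCosetSum {N : ℕ} {P : Mx N N → Set} (P? : ∀ w → Dec (P w))
    (P-∙ : ∀ {v w} → P v → P w → P (v ∙ w))
    (inv : Mx N N → Mx N N)
    (P-inv : ∀ {w} → P w → P (inv w))
    (∙-inv : ∀ {w} → P w → w ∙ inv w ≡ I)
    (σ₀ : Mx N N) (σσ : σ₀ ∙ σ₀ ≡ I)
    where

    DC : Mx N N → Set
    DC w = ∃ λ ((p₁ , p₂) : Mx N N × Mx N N) → (P p₁ × P p₂) × p₁ ∙ σ₀ ∙ p₂ ≡ w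

    private
      PP? : ∀ ((p₁ , p₂) : Mx N N × Mx N N) → Dec (P p₁ × P p₂)
      PP? (p₁ , p₂) = P? p₁ ×-dec P? p₂

      product : Mx N N × Mx N N → Mx N N
      product (p₁ , p₂) = p₁ ∙ σ₀ ∙ p₂

      fibre? : ∀ w p → Dec ((P (proj₁ p) × P (proj₂ p)) × product p ≡ w)
      fibre? w p = PP? p ×-dec (product p ≟ w)

      inv-∙ : ∀ {w} → P w → inv w ∙ w ≡ I
      inv-∙ pw = rightInverse⇒leftInverse (∙-inv pw)

    DC? : ∀ w → Dec (DC w)
    DC? w = ∃? (fibre? w)

    H? : ∀ p → Dec (P p × P (σ₀ ∙ p ∙ σ₀))
    H? p = P? p ×-dec P? (σ₀ ∙ p ∙ σ₀)

    private
      -- In p₁ σ₀ p₂ = σ₀ the second factor is the inverse of σ₀ p₁ σ₀, so p₁ determines the pair,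
      -- and it occurs precisely when σ₀ p₁ σ₀ lies in P.
      fibre-σ : ∑⟨ fibre? σ₀ ⟩ (λ _ → 1ℤ) ≡ ∑⟨ H? ⟩ (λ _ → 1ℤ)
      fibre-σ = ∑⟨⟩-bij (fibre? σ₀) H? proj₁ (λ p → p , inv (σ₀ ∙ p ∙ σ₀))
        (λ { (p₁ , p₂) ((h₁ , h₂) , e) → h₁ ,
             conj∈P e h₂ })
        (λ p (h , h′) → (h , P-inv h′) , product-γ h′)
        (λ { (p₁ , p₂) ((h₁ , h₂) , e) → cong (p₁ ,_)
             (inverse-unique (∙-inv (conj∈P e h₂)) (swallow e)) })
        (λ _ _ → refl) (λ _ _ → refl)
        where
        swallow : ∀ {p₁ p₂} → p₁ ∙ σ₀ ∙ p₂ ≡ σ₀ → σ₀ ∙ p₁ ∙ σ₀ ∙ p₂ ≡ I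
        swallow {p₁} {p₂} e = begin
          σ₀ ∙ p₁ ∙ σ₀ ∙ p₂   ≡⟨ cong (_∙ p₂) (∙-assoc σ₀ p₁ σ₀) ⟩
          σ₀ ∙ (p₁ ∙ σ₀) ∙ p₂ ≡⟨ ∙-assoc σ₀ (p₁ ∙ σ₀) p₂ ⟩
          σ₀ ∙ (p₁ ∙ σ₀ ∙ p₂) ≡⟨ cong (σ₀ ∙_) e ⟩
          σ₀ ∙ σ₀             ≡⟨ σσ ⟩
          I                   ∎
        conj∈P : ∀ {p₁ p₂} → p₁ ∙ σ₀ ∙ p₂ ≡ σ₀ → P p₂ → P (σ₀ ∙ p₁ ∙ σ₀)
        conj∈P e h₂ = subst P
          (inverse-unique (∙-inv h₂) (rightInverse⇒leftInverse (swallow e))) (P-inv h₂)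
        product-γ : ∀ {p} → P (σ₀ ∙ p ∙ σ₀) → p ∙ σ₀ ∙ inv (σ₀ ∙ p ∙ σ₀) ≡ σ₀
        product-γ {p} h = begin
          p ∙ σ₀ ∙ inv c                    ≡⟨ ∙-cancel-inverseˡ σσ _ ⟨
          σ₀ ∙ (σ₀ ∙ (p ∙ σ₀ ∙ inv c))      ≡⟨ cong (σ₀ ∙_) (∙-assoc σ₀ (p ∙ σ₀) _) ⟨
          σ₀ ∙ (σ₀ ∙ (p ∙ σ₀) ∙ inv c)      ≡⟨ cong (λ x → σ₀ ∙ (x ∙ inv c)) (∙-assoc σ₀ p σ₀) ⟨
          σ₀ ∙ (c ∙ inv c)                  ≡⟨ cong (σ₀ ∙_) (∙-inv h) ⟩
          σ₀ ∙ I                            ≡⟨ ∙-identityʳ σ₀ ⟩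
          σ₀                                ∎
          where
          c : Mx N N
          c = σ₀ ∙ p ∙ σ₀

      -- If w = a σ₀ b, the map (p₁ , p₂) ↦ (a⁻¹ p₁ , p₂ b⁻¹) carries the pairs over w to the pairs
      -- over σ₀.
      fibre-DC : ∀ {w} → DC w → ∑⟨ fibre? w ⟩ (λ _ → 1ℤ) ≡ ∑⟨ fibre? σ₀ ⟩ (λ _ → 1ℤ)
      fibre-DC {w} ((a , b) , (ha , hb) , e) = ∑⟨⟩-bij (fibre? w) (fibre? σ₀)
        (λ (p₁ , p₂) → inv a ∙ p₁ , p₂ ∙ inv b)
        (λ (p₁ , p₂) → a ∙ p₁ , p₂ ∙ b)
        (λ { (p₁ , p₂) ((h₁ , h₂) , e′) → (P-∙ (P-inv ha) h₁ , P-∙ h₂ (P-inv hb)) ,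
             (begin
               inv a ∙ p₁ ∙ σ₀ ∙ (p₂ ∙ inv b)     ≡⟨ regroup (inv a) p₁ p₂ (inv b) ⟩
               inv a ∙ (p₁ ∙ σ₀ ∙ p₂ ∙ inv b)
                 ≡⟨ cong (λ x → inv a ∙ (x ∙ inv b)) (trans e′ (sym e)) ⟩
               inv a ∙ (a ∙ σ₀ ∙ b ∙ inv b)       ≡⟨ cong (inv a ∙_) (∙-cancel-inverseʳ (∙-inv hb) _) ⟩
               inv a ∙ (a ∙ σ₀)                   ≡⟨ ∙-cancel-inverseˡ (inv-∙ ha) σ₀ ⟩
               σ₀                                 ∎) })
        (λ { (p₁ , p₂) ((h₁ , h₂) , e′) → (P-∙ ha h₁ , P-∙ h₂ hb) ,
             (begin
               a ∙ p₁ ∙ σ₀ ∙ (p₂ ∙ b)   ≡⟨ regroup a p₁ p₂ b ⟩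
               a ∙ (p₁ ∙ σ₀ ∙ p₂ ∙ b)   ≡⟨ cong (λ x → a ∙ (x ∙ b)) e′ ⟩
               a ∙ (σ₀ ∙ b)             ≡⟨ ∙-assoc a σ₀ b ⟨
               a ∙ σ₀ ∙ b               ≡⟨ e ⟩
               w                        ∎) })
        (λ _ _ → cong₂ _,_ (∙-cancel-inverseˡ (∙-inv ha) _) (∙-cancel-inverseʳ (inv-∙ hb) _))
        (λ _ _ → cong₂ _,_ (∙-cancel-inverseˡ (inv-∙ ha) _) (∙-cancel-inverseʳ (∙-inv hb) _))
        (λ _ _ → refl)
        where
        regroup : ∀ x p₁ p₂ y → x ∙ p₁ ∙ σ₀ ∙ (p₂ ∙ y) ≡ x ∙ (p₁ ∙ σ₀ ∙ p₂ ∙ y)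
        regroup x p₁ p₂ y = begin
          x ∙ p₁ ∙ σ₀ ∙ (p₂ ∙ y)   ≡⟨ cong (_∙ (p₂ ∙ y)) (∙-assoc x p₁ σ₀) ⟩
          x ∙ (p₁ ∙ σ₀) ∙ (p₂ ∙ y) ≡⟨ ∙-assoc x (p₁ ∙ σ₀) (p₂ ∙ y) ⟩
          x ∙ (p₁ ∙ σ₀ ∙ (p₂ ∙ y)) ≡⟨ cong (x ∙_) (∙-assoc (p₁ ∙ σ₀) p₂ y) ⟨
          x ∙ (p₁ ∙ σ₀ ∙ p₂ ∙ y)   ∎

      fibre-size : ∀ w (d : Dec (DC w)) →
        ∑⟨ fibre? w ⟩ (λ _ → 1ℤ) ≡ 𝟙 d * ∑⟨ H? ⟩ (λ _ → 1ℤ)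
      fibre-size w (yes d) = trans (fibre-DC d) (trans fibre-σ (sym (ℤP.*-identityˡ _)))
      fibre-size w (no ¬d) =
        trans (∑⟨⟩-empty (fibre? w) (λ p h → ¬d (p , h)) _) (sym (ℤP.*-zeroˡ (∑⟨ H? ⟩ (λ _ → 1ℤ))))

    module _ (f : Mx N N → ℤ) (f-comm : ∀ v w → f (v ∙ w) ≡ f (w ∙ v)) where

      private
        -- By `f-comm` the factor p₂ moves to the front, where p₂ p₁ runs through P together with
        -- p₁.
        translate : ∀ p₂ → P p₂ →
          ∑⟨ P? ⟩ (λ p₁ → f (p₁ ∙ σ₀ ∙ p₂)) ≡ ∑⟨ P? ⟩ (λ p → f (p ∙ σ₀))
        translate p₂ h₂ = ∑⟨⟩-bij P? P? (p₂ ∙_) (inv p₂ ∙_)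
          (λ _ → P-∙ h₂) (λ _ → P-∙ (P-inv h₂))
          (λ _ _ → ∙-cancel-inverseˡ (inv-∙ h₂) _) (λ _ _ → ∙-cancel-inverseˡ (∙-inv h₂) _)
          (λ p _ → begin
            f (inv p₂ ∙ p ∙ σ₀ ∙ p₂)     ≡⟨ f-comm _ p₂ ⟩
            f (p₂ ∙ (inv p₂ ∙ p ∙ σ₀))   ≡⟨ cong (λ x → f (p₂ ∙ x)) (∙-assoc (inv p₂) p σ₀) ⟩
            f (p₂ ∙ (inv p₂ ∙ (p ∙ σ₀))) ≡⟨ cong f (∙-cancel-inverseˡ (∙-inv h₂) _) ⟩
            f (p ∙ σ₀)                   ∎)

      -- Both sides are the sum of f (p₁ σ₀ p₂) over all p₁, p₂ in P.
      doubleCosetSum :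
        ∑⟨ H? ⟩ (λ _ → 1ℤ) * ∑⟨ DC? ⟩ f ≡ ∑⟨ P? ⟩ (λ _ → 1ℤ) * ∑⟨ P? ⟩ (λ p → f (p ∙ σ₀))
      doubleCosetSum = begin
        h * ∑⟨ DC? ⟩ f
          ≡⟨ ℤP.*-comm h _ ⟩
        ∑⟨ DC? ⟩ f * h
          ≡⟨ ∑⟨⟩-*ʳ DC? h f ⟨
        ∑⟨ DC? ⟩ (λ w → f w * h)
          ≡⟨ ∑-cong (λ w → trans (cong (𝟙 (DC? w) *_) (ℤP.*-comm (f w) h))
               (trans (sym (ℤP.*-assoc (𝟙 (DC? w)) h (f w)))
                      (cong (_* f w) (sym (fibre-size w (DC? w)))))) ⟩
        ∑ (λ w → ∑⟨ fibre? w ⟩ (λ _ → 1ℤ) * f w)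
          ≡⟨ ∑-cong (λ w → trans (sym (∑⟨⟩-const (fibre? w) (f w)))
               (∑⟨⟩-cong (fibre? w) (λ p (_ , e) → cong f (sym e)))) ⟩
        ∑ (λ w → ∑⟨ fibre? w ⟩ (λ p → f (product p)))
          ≡⟨ ∑⟨⟩-fibres PP? product (λ p → f (product p)) ⟨
        ∑⟨ PP? ⟩ (λ p → f (product p))
          ≡⟨ ∑⟨⟩-× PP? P? (λ _ → P?) (λ _ _ h → h) (λ _ _ → _,_) _ ⟩
        ∑⟨ P? ⟩ (λ p₁ → ∑⟨ P? ⟩ (λ p₂ → f (p₁ ∙ σ₀ ∙ p₂)))
          ≡⟨ ∑⟨⟩-swap P? P? _ ⟩
        ∑⟨ P? ⟩ (λ p₂ → ∑⟨ P? ⟩ (λ p₁ → f (p₁ ∙ σ₀ ∙ p₂)))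
          ≡⟨ ∑⟨⟩-cong P? translate ⟩
        ∑⟨ P? ⟩ (λ _ → ∑⟨ P? ⟩ (λ p → f (p ∙ σ₀)))
          ≡⟨ ∑⟨⟩-const P? _ ⟩
        ∑⟨ P? ⟩ (λ _ → 1ℤ) * ∑⟨ P? ⟩ (λ p → f (p ∙ σ₀)) ∎
        where
        h : ℤ
        h = ∑⟨ H? ⟩ (λ _ → 1ℤ)

-- The Siegel parabolic subgroup and its coordinates

module SiegelParabolic {r} (𝔽 : FiniteField r) where

  open import Data.Nat using (_+_)
  open FiniteSums
  open Matrices 𝔽

  ⊞-dropˡ : ∀ {m n} {A B : Mx m n} → A ≡ 𝟘 → A ⊞ B ≡ B
  ⊞-dropˡ refl = ⊞-identityˡ _

  ⊞-dropʳ : ∀ {m n} {A B : Mx m n} → B ≡ 𝟘 → A ⊞ B ≡ A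
  ⊞-dropʳ refl = ⊞-identityʳ _

  -- An element of GL(n) is carried together with its inverse. The second component is determined by
  -- the first, so a sum over such pairs visits each invertible matrix once.
  GL? : ∀ {n} (p : Mx n n × Mx n n) → Dec (proj₁ p ∙ proj₂ p ≡ I)
  GL? (A , A′) = A ∙ A′ ≟ I

  Sym? : ∀ {n} (B : Mx n n) → Dec (B ᵀ ≡ B)
  Sym? B = B ᵀ ≟ B

  -- A′ stands for A⁻¹.
  siegel : ∀ {n} → Mx n n → Mx n n → Mx n n → Mx (n + n) (n + n)
  siegel A A′ B = blk A (A ∙ B) 𝟘 (A′ ᵀ)

  siegel≡ : ∀ {n} (A A′ B : Mat n) →
    siegel A A′ B ≡ block A zeroM zeroM (transpose A′) ⊗ block idM B zeroM idM
  siegel≡ A A′ B = begin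
    blk A (A ∙ B) 𝟘 (A′ ᵀ)
      ≡⟨ blk-cong (trans (⊞-dropʳ (∙-zeroˡ _)) (∙-identityʳ A)) (⊞-dropʳ (∙-zeroˡ _))
           (trans (⊞-dropˡ (∙-zeroˡ _)) (∙-zeroʳ _)) (trans (⊞-dropˡ (∙-zeroˡ _)) (∙-identityʳ _)) ⟨
    blk (A ∙ I ⊞ 𝟘 ∙ 𝟘) (A ∙ B ⊞ 𝟘 ∙ I) (𝟘 ∙ I ⊞ A′ ᵀ ∙ 𝟘) (𝟘 ∙ B ⊞ A′ ᵀ ∙ I)
      ≡⟨ blk-∙ A 𝟘 𝟘 (A′ ᵀ) I B 𝟘 I ⟨
    blk A 𝟘 𝟘 (A′ ᵀ) ∙ blk I B 𝟘 I
      ≡⟨ cong₂ _∙_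
           (trans (vcat-hcat≡block _ _ _ _)
             (trans (cong₂ (λ X Y → block A X Y (A′ ᵀ)) 𝟘≡zeroM 𝟘≡zeroM)
                    (cong (block A zeroM zeroM) (ᵀ≡transpose A′))))
           (trans (vcat-hcat≡block _ _ _ _)
             (trans (cong₂ (λ X Y → block X B Y X) I≡idM 𝟘≡zeroM) refl)) ⟩
    block A zeroM zeroM (transpose A′) ∙ block idM B zeroM idM
      ≡⟨ ∙≡⊗ _ _ ⟩
    block A zeroM zeroM (transpose A′) ⊗ block idM B zeroM idM ∎

  J : ∀ {n} → Mx (n + n) (n + n)
  J {n} = blk {n} {n} {n} {n} 𝟘 I I 𝟘

  Symplectic : ∀ {n} → Mx (n + n) (n + n) → Set
  Symplectic {n} w = w ᵀ ∙ (J {n} ∙ w) ≡ J {n}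

  -- Coordinate-free form of P: both conditions are visibly stable under products and inverses. The
  -- equivalence with the form in the statement is `InP⇔Parabolic`.
  Parabolic : ∀ {n} → Mx (n + n) (n + n) → Set
  Parabolic {n} w = Symplectic {n} w × b₂₁ n n n n w ≡ 𝟘

  Parabolic? : ∀ {n} (w : Mx (n + n) (n + n)) → Dec (Parabolic {n} w)
  Parabolic? {n} w = (w ᵀ ∙ (J {n} ∙ w) ≟ J {n}) ×-dec (b₂₁ n n n n w ≟ 𝟘)

  module _ {n : ℕ} where

    J-∙ : (X Y Z W : Mx n n) → J {n} ∙ blk X Y Z W ≡ blk Z W X Y
    J-∙ X Y Z W = trans (blk-∙ 𝟘 I I 𝟘 X Y Z W) (blk-cong
      (trans (⊞-dropˡ (∙-zeroˡ _)) (∙-identityˡ _)) (trans (⊞-dropˡ (∙-zeroˡ _)) (∙-identityˡ _))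
      (trans (⊞-dropʳ (∙-zeroˡ _)) (∙-identityˡ _)) (trans (⊞-dropʳ (∙-zeroˡ _)) (∙-identityˡ _)))

    ∙-J : (X Y Z W : Mx n n) → blk X Y Z W ∙ J {n} ≡ blk Y X W Z
    ∙-J X Y Z W = trans (blk-∙ X Y Z W 𝟘 I I 𝟘) (blk-cong
      (trans (⊞-dropˡ (∙-zeroʳ _)) (∙-identityʳ _)) (trans (⊞-dropʳ (∙-zeroʳ _)) (∙-identityʳ _))
      (trans (⊞-dropˡ (∙-zeroʳ _)) (∙-identityʳ _)) (trans (⊞-dropʳ (∙-zeroʳ _)) (∙-identityʳ _)))

    J-involutive : J {n} ∙ J {n} ≡ I
    J-involutive = trans (J-∙ 𝟘 I I 𝟘) (sym (I-blk n n))

    J-symmetric : J {n} ᵀ ≡ J {n}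
    J-symmetric = trans (blk-ᵀ 𝟘 I I 𝟘) (blk-cong ᵀ-𝟘 ᵀ-I ᵀ-I ᵀ-𝟘)

    Symplectic-∙ : ∀ {v w} → Symplectic {n} v → Symplectic {n} w → Symplectic {n} (v ∙ w)
    Symplectic-∙ {v} {w} sv sw = begin
      (v ∙ w) ᵀ ∙ (J {n} ∙ (v ∙ w))       ≡⟨ cong₂ _∙_ (ᵀ-∙ v w) (sym (∙-assoc _ v w)) ⟩
      w ᵀ ∙ v ᵀ ∙ (J {n} ∙ v ∙ w)         ≡⟨ ∙-assoc (w ᵀ) (v ᵀ) _ ⟩
      w ᵀ ∙ (v ᵀ ∙ (J {n} ∙ v ∙ w))       ≡⟨ cong (w ᵀ ∙_) (∙-assoc (v ᵀ) _ w) ⟨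
      w ᵀ ∙ (v ᵀ ∙ (J {n} ∙ v) ∙ w)       ≡⟨ cong (λ x → w ᵀ ∙ (x ∙ w)) sv ⟩
      w ᵀ ∙ (J {n} ∙ w)                   ≡⟨ sw ⟩
      J {n}                               ∎

    -- Since J² = 1, the relation ᵗw J w = J reads (J ᵗw J) w = 1.
    symplecticInverse : Mx (n + n) (n + n) → Mx (n + n) (n + n)
    symplecticInverse w = J {n} ∙ (w ᵀ ∙ J {n})

    ∙-symplecticInverse : ∀ {w} → Symplectic {n} w → w ∙ symplecticInverse w ≡ I
    ∙-symplecticInverse {w} sw = rightInverse⇒leftInverse (begin
      J {n} ∙ (w ᵀ ∙ J {n}) ∙ w   ≡⟨ ∙-assoc (J {n}) _ w ⟩
      J {n} ∙ (w ᵀ ∙ J {n} ∙ w)   ≡⟨ cong (J {n} ∙_) (trans (∙-assoc (w ᵀ) _ w) sw) ⟩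
      J {n} ∙ J {n}               ≡⟨ J-involutive ⟩
      I                           ∎)

    Symplectic-inverse : ∀ {w} → Symplectic {n} w → Symplectic {n} (symplecticInverse w)
    Symplectic-inverse {w} sw = begin
      v ᵀ ∙ (J {n} ∙ v)                       ≡⟨ cong₂ _∙_ vᵀ (∙-cancel-inverseˡ J-involutive _) ⟩
      J {n} ∙ w ∙ J {n} ∙ (w ᵀ ∙ J {n})       ≡⟨ ∙-assoc _ (J {n}) _ ⟩
      J {n} ∙ w ∙ (J {n} ∙ (w ᵀ ∙ J {n}))     ≡⟨ ∙-assoc (J {n}) w _ ⟩
      J {n} ∙ (w ∙ v)                         ≡⟨ cong (J {n} ∙_) (∙-symplecticInverse sw) ⟩
      J {n} ∙ I                               ≡⟨ ∙-identityʳ _ ⟩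
      J {n}                                   ∎
      where
      v : Mx (n + n) (n + n)
      v = symplecticInverse w
      vᵀ : v ᵀ ≡ J {n} ∙ w ∙ J {n}
      vᵀ = trans (ᵀ-∙ _ _) (cong₂ _∙_ (trans (ᵀ-∙ _ _) (cong₂ _∙_ J-symmetric (ᵀ-involutive w))) J-symmetric)

    upper : ∀ w → b₂₁ n n n n w ≡ 𝟘 → w ≡ blk (b₁₁ n n n n w) (b₁₂ n n n n w) 𝟘 (b₂₂ n n n n w)
    upper w z = trans (sym (blk-η n n n n w)) (blk-cong refl refl z refl)

    Parabolic-∙ : ∀ {v w} → Parabolic {n} v → Parabolic {n} w → Parabolic {n} (v ∙ w)
    Parabolic-∙ {v} {w} (sv , zv) (sw , zw) = Symplectic-∙ sv sw ,
      trans (cong (b₂₁ n n n n) (trans (cong₂ _∙_ (upper v zv) (upper w zw))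
        (blk-∙ (b₁₁ n n n n v) (b₁₂ n n n n v) 𝟘 (b₂₂ n n n n v)
               (b₁₁ n n n n w) (b₁₂ n n n n w) 𝟘 (b₂₂ n n n n w))))
      (trans (b₂₁-blk {n} {n} {n} {n} _ _ _ _) (trans (⊞-dropˡ (∙-zeroˡ _)) (∙-zeroʳ _)))

    Parabolic-inverse : ∀ {w} → Parabolic {n} w → Parabolic {n} (symplecticInverse w)
    Parabolic-inverse {w} (sw , zw) = Symplectic-inverse sw ,
      trans (cong (b₂₁ n n n n)
        (trans (cong (λ x → J {n} ∙ (x ∙ J {n})) (trans (cong _ᵀ (upper w zw)) (blk-ᵀ X Y 𝟘 W)))
        (trans (cong (J {n} ∙_) (∙-J (X ᵀ) (𝟘 ᵀ) (Y ᵀ) (W ᵀ)))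
               (J-∙ (𝟘 ᵀ) (X ᵀ) (W ᵀ) (Y ᵀ)))))
      (trans (b₂₁-blk {n} {n} {n} {n} _ _ _ _) ᵀ-𝟘)
      where
      X Y W : Mx n n
      X = b₁₁ n n n n w
      Y = b₁₂ n n n n w
      W = b₂₂ n n n n w

    -- Comparison with J turns "symplectic" into ᵗX W = 1 together with ᵗY W + ᵗW Y = 0.
    form-upper : (X Y W : Mx n n) → let w = blk X Y 𝟘 W in
      w ᵀ ∙ (J {n} ∙ w) ≡ blk 𝟘 (X ᵀ ∙ W) (W ᵀ ∙ X) (Y ᵀ ∙ W ⊞ W ᵀ ∙ Y)
    form-upper X Y W = trans (cong₂ _∙_ (blk-ᵀ X Y 𝟘 W) (J-∙ X Y 𝟘 W))
      (trans (blk-∙ _ _ _ _ _ _ _ _) (blk-cong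
        (trans (⊞-dropˡ (∙-zeroʳ _)) (trans (cong (_∙ X) ᵀ-𝟘) (∙-zeroˡ X)))
        (⊞-dropʳ (trans (cong (_∙ Y) ᵀ-𝟘) (∙-zeroˡ Y)))
        (⊞-dropˡ (∙-zeroʳ _))
        refl))

  module _ (char2 : ∀ x → x +ᶠ x ≡ 0#) where

    ⊞-self : ∀ {m n} (A : Mx m n) → A ⊞ A ≡ 𝟘
    ⊞-self A = ext λ i j → trans (at-⊞ A A i j) (trans (char2 _) (sym (at-𝟘 i j)))

    ⊞-zero⇒≡ : ∀ {m n} {A B : Mx m n} → A ⊞ B ≡ 𝟘 → A ≡ B
    ⊞-zero⇒≡ {A = A} {B} e = begin
      A             ≡⟨ ⊞-identityʳ A ⟨
      A ⊞ 𝟘         ≡⟨ cong (A ⊞_) (⊞-self B) ⟨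
      A ⊞ (B ⊞ B)   ≡⟨ ⊞-assoc A B B ⟨
      A ⊞ B ⊞ B     ≡⟨ ⊞-dropˡ e ⟩
      B             ∎

    -- The lower right block of ᵗw J w comes out as B + B, which vanishes in characteristic 2.
    siegel-Parabolic : ∀ {n} {A A′ B : Mx n n} → A ∙ A′ ≡ I → B ᵀ ≡ B → Parabolic {n} (siegel A A′ B)
    siegel-Parabolic {n} {A} {A′} {B} inv symB =
      trans (form-upper A (A ∙ B) (A′ ᵀ)) (blk-cong refl (ᵀ-inverse A′A)
        (trans (cong (_∙ A) (ᵀ-involutive A′)) A′A)
        (trans (cong₂ _⊞_
          (trans (sym (ᵀ-∙ A′ (A ∙ B))) (trans (cong _ᵀ (∙-cancel-inverseˡ A′A B)) symB))
          (trans (cong (_∙ (A ∙ B)) (ᵀ-involutive A′)) (∙-cancel-inverseˡ A′A B))) (⊞-self B))) ,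
      b₂₁-blk _ _ _ _
      where
      A′A : A′ ∙ A ≡ I
      A′A = rightInverse⇒leftInverse inv

    module _ {n} (w : Mx (n + n) (n + n)) where

      private
        X Y W : Mx n n
        X = b₁₁ n n n n w
        Y = b₁₂ n n n n w
        W = b₂₂ n n n n w

      -- Read off by comparing w with (A, AB; 0, ᵗA⁻¹): A is X, its inverse is ᵗW, and B is A⁻¹ Y.
      coords : (Mx n n × Mx n n) × Mx n n
      coords = (X , W ᵀ) , W ᵀ ∙ Y

      -- In characteristic 2, the vanishing of ᵗY W + ᵗW Y says that ᵗW Y equals its own transpose.
      coords-valid : Parabolic {n} w → X ∙ W ᵀ ≡ I × (W ᵀ ∙ Y) ᵀ ≡ W ᵀ ∙ Y
      coords-valid (sw , zw)
        with blk-injective (trans (sym (form-upper X Y W))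
               (trans (cong (λ x → x ᵀ ∙ (J {n} ∙ x)) (sym (upper w zw))) sw))
      ... | _ , _ , WX , YW = rightInverse⇒leftInverse WX ,
        trans (ᵀ-∙ _ _) (trans (cong (Y ᵀ ∙_) (ᵀ-involutive W)) (⊞-zero⇒≡ YW))

      siegel-coords : Parabolic {n} w → siegel X (W ᵀ) (W ᵀ ∙ Y) ≡ w
      siegel-coords pw@(_ , zw) = trans
        (blk-cong refl (∙-cancel-inverseˡ (proj₁ (coords-valid pw)) Y) refl (ᵀ-involutive W))
        (sym (upper w zw))

    InP⇔Parabolic : ∀ {n} w → InP n w ⇔ Parabolic {n} w
    InP⇔Parabolic {n} w = mk⇔
      (λ (A , A′ , B , inv , _ , symB , e) → subst (Parabolic {n}) (trans (siegel≡ A A′ B) (sym e))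
        (siegel-Parabolic (trans (∙≡⊗ A A′) (trans inv (sym I≡idM))) (trans (ᵀ≡transpose B) symB)))
      (λ p → let ((A , A′) , B) = coords w
                 inv , symB = coords-valid w p in
        A , A′ , B , trans (sym (∙≡⊗ A A′)) (trans inv I≡idM) ,
        trans (sym (∙≡⊗ A′ A)) (trans (rightInverse⇒leftInverse inv) I≡idM) ,
        trans (sym (ᵀ≡transpose B)) symB ,
        trans (sym (siegel-coords w p)) (siegel≡ A A′ B))

    ∑-Parabolic : ∀ {n} (f : Mx (n + n) (n + n) → ℤ) →
      ∑⟨ Parabolic? {n} ⟩ f ≡ ∑⟨ GL? ⟩ (λ (A , A′) → ∑⟨ Sym? ⟩ (λ B → f (siegel {n} A A′ B)))
    ∑-Parabolic {n} f = trans
      (∑⟨⟩-bij (Parabolic? {n}) GS? coords (λ ((A , A′) , B) → siegel A A′ B)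
        coords-valid (λ { ((A , A′) , B) (inv , symB) → siegel-Parabolic inv symB })
        siegel-coords
        (λ { ((A , A′) , B) (inv , symB) → cong₂ _,_
          (cong₂ _,_ (b₁₁-blk _ _ _ _) (trans (cong _ᵀ (b₂₂-blk _ _ _ _)) (ᵀ-involutive A′)))
          (trans (cong₂ (λ x y → x ᵀ ∙ y) (b₂₂-blk _ _ _ _) (b₁₂-blk _ _ _ _))
            (trans (cong (_∙ (A ∙ B)) (ᵀ-involutive A′))
              (∙-cancel-inverseˡ (rightInverse⇒leftInverse inv) B))) })
        (λ _ _ → refl))
      (∑⟨⟩-× GS? GL? (λ _ → Sym?) (λ _ _ h → h) (λ _ _ → _,_) _)
      where
      GS? : (x : (Mx n n × Mx n n) × Mx n n) →
        Dec (proj₁ (proj₁ x) ∙ proj₂ (proj₁ x) ≡ I × proj₂ x ᵀ ≡ proj₂ x)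
      GS? (p , B) = GL? p ×-dec Sym? B

-- The element σ in block form

module WeylElement {r} (𝔽 : FiniteField r) where

  open import Data.Nat using (_+_)
  open Matrices 𝔽
  open SiegelParabolic 𝔽

  module _ (s t : ℕ) where

    private
      n : ℕ
      n = s + t

    -- Complementary coordinate projections, onto the first s and the last t coordinates. From R + Q
    -- = 1 and RQ = QR = 0 it follows that `σᵇ` is an involution.
    Rˢ Qˢ : Mx n n
    Rˢ = blk {s} {t} {s} {t} I 𝟘 𝟘 𝟘
    Qˢ = blk {s} {t} {s} {t} 𝟘 𝟘 𝟘 I

    σᵇ : Mx (n + n) (n + n)
    σᵇ = blk Qˢ Rˢ Rˢ Qˢ

    module _ (X : Mx s s) (Y : Mx s t) (Z : Mx t s) (W : Mx t t) where

      R-∙ : Rˢ ∙ blk X Y Z W ≡ blk X Y 𝟘 𝟘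
      R-∙ = trans (blk-∙ I 𝟘 𝟘 𝟘 X Y Z W) (blk-cong
        (trans (⊞-dropʳ (∙-zeroˡ _)) (∙-identityˡ X)) (trans (⊞-dropʳ (∙-zeroˡ _)) (∙-identityˡ Y))
        (trans (⊞-dropʳ (∙-zeroˡ _)) (∙-zeroˡ _)) (trans (⊞-dropʳ (∙-zeroˡ _)) (∙-zeroˡ _)))

      Q-∙ : Qˢ ∙ blk X Y Z W ≡ blk 𝟘 𝟘 Z W
      Q-∙ = trans (blk-∙ 𝟘 𝟘 𝟘 I X Y Z W) (blk-cong
        (trans (⊞-dropʳ (∙-zeroˡ _)) (∙-zeroˡ _)) (trans (⊞-dropʳ (∙-zeroˡ _)) (∙-zeroˡ _))
        (trans (⊞-dropˡ (∙-zeroˡ _)) (∙-identityˡ Z)) (trans (⊞-dropˡ (∙-zeroˡ _)) (∙-identityˡ W)))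

      ∙-R : blk X Y Z W ∙ Rˢ ≡ blk X 𝟘 Z 𝟘
      ∙-R = trans (blk-∙ X Y Z W I 𝟘 𝟘 𝟘) (blk-cong
        (trans (⊞-dropʳ (∙-zeroʳ _)) (∙-identityʳ X)) (trans (⊞-dropʳ (∙-zeroʳ _)) (∙-zeroʳ _))
        (trans (⊞-dropʳ (∙-zeroʳ _)) (∙-identityʳ Z)) (trans (⊞-dropʳ (∙-zeroʳ _)) (∙-zeroʳ _)))

      ∙-Q : blk X Y Z W ∙ Qˢ ≡ blk 𝟘 Y 𝟘 W
      ∙-Q = trans (blk-∙ X Y Z W 𝟘 𝟘 𝟘 I) (blk-cong
        (trans (⊞-dropʳ (∙-zeroʳ _)) (∙-zeroʳ _)) (trans (⊞-dropˡ (∙-zeroʳ _)) (∙-identityʳ Y))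
        (trans (⊞-dropʳ (∙-zeroʳ _)) (∙-zeroʳ _)) (trans (⊞-dropˡ (∙-zeroʳ _)) (∙-identityʳ W)))

    σᵇ-involutive : σᵇ ∙ σᵇ ≡ I
    σᵇ-involutive = trans (blk-∙ Qˢ Rˢ Rˢ Qˢ Qˢ Rˢ Rˢ Qˢ)
      (trans (blk-cong diagonal off (trans (⊞-comm _ _) off) (trans (⊞-comm _ _) diagonal))
             (sym (I-blk n n)))
      where
      diagonal : Qˢ ∙ Qˢ ⊞ Rˢ ∙ Rˢ ≡ I
      diagonal = trans (cong₂ _⊞_ (Q-∙ 𝟘 𝟘 𝟘 I) (R-∙ I 𝟘 𝟘 𝟘))
        (trans (blk-⊞ 𝟘 I 𝟘 𝟘 𝟘 𝟘 I 𝟘)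
        (trans (blk-cong (⊞-identityˡ I) (⊞-identityˡ 𝟘) (⊞-identityˡ 𝟘) (⊞-identityʳ I))
               (sym (I-blk s t))))
      off : Qˢ ∙ Rˢ ⊞ Rˢ ∙ Qˢ ≡ 𝟘
      off = trans (cong₂ _⊞_ (Q-∙ I 𝟘 𝟘 𝟘) (R-∙ 𝟘 𝟘 𝟘 I))
        (trans (blk-⊞ 𝟘 𝟘 𝟘 𝟘 𝟘 𝟘 𝟘 𝟘)
        (trans (blk-cong (⊞-identityˡ 𝟘) (⊞-identityˡ 𝟘) (⊞-identityˡ 𝟘) (⊞-identityˡ 𝟘))
               (sym (𝟘-blk s t s t))))

    σᵇ-symmetric : σᵇ ᵀ ≡ σᵇ
    σᵇ-symmetric = trans (blk-ᵀ Qˢ Rˢ Rˢ Qˢ) (blk-cong Q-sym R-sym R-sym Q-sym)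
      where
      R-sym : Rˢ ᵀ ≡ Rˢ
      R-sym = trans (blk-ᵀ I 𝟘 𝟘 𝟘) (blk-cong ᵀ-I ᵀ-𝟘 ᵀ-𝟘 ᵀ-𝟘)
      Q-sym : Qˢ ᵀ ≡ Qˢ
      Q-sym = trans (blk-ᵀ 𝟘 𝟘 𝟘 I) (blk-cong ᵀ-𝟘 ᵀ-𝟘 ᵀ-𝟘 ᵀ-I)

    -- J commutes with `σᵇ`: exchanging block rows and exchanging block columns of (Q, R; R, Q) have
    -- the same effect. The rest is symmetry and involutivity.
    σᵇ-Symplectic : Symplectic {n} σᵇ
    σᵇ-Symplectic = begin
      σᵇ ᵀ ∙ (J {n} ∙ σᵇ)   ≡⟨ cong₂ _∙_ σᵇ-symmetric (trans (J-∙ Qˢ Rˢ Rˢ Qˢ) (sym (∙-J Qˢ Rˢ Rˢ Qˢ))) ⟩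
      σᵇ ∙ (σᵇ ∙ J {n})     ≡⟨ ∙-cancel-inverseˡ σᵇ-involutive _ ⟩
      J {n}                 ∎

    ∙-σᵇ : (X Y Z W : Mx n n) → blk X Y Z W ∙ σᵇ ≡
      blk (X ∙ Qˢ ⊞ Y ∙ Rˢ) (X ∙ Rˢ ⊞ Y ∙ Qˢ) (Z ∙ Qˢ ⊞ W ∙ Rˢ) (Z ∙ Rˢ ⊞ W ∙ Qˢ)
    ∙-σᵇ X Y Z W = blk-∙ X Y Z W Qˢ Rˢ Rˢ Qˢ

    module _ {a : Mx s s} {b : Mx s t} {c : Mx t s} {d : Mx t t}
             {a′ : Mx s s} {b′ : Mx s t} {c′ : Mx t s} {d′ : Mx t t}
             {e : Mx s s} {f : Mx s t} {g : Mx t s} {h : Mx t t} where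

      private
        A A′ B : Mx n n
        A  = blk a b c d
        A′ = blk a′ b′ c′ d′
        B  = blk e f g h

      -- The trace separates: a part in the t × t corners of A and A⁻¹, which leads to K_{GL(t)},
      -- and a part linear in B. The corner h of B drops out, and a, b act as the coefficients of e,
      -- g.
      tr-siegel-σᵇ : tr (siegel A A′ B ∙ σᵇ) ≡ tr d +ᶠ tr d′ +ᶠ (tr (a ∙ e) +ᶠ tr (b ∙ g))
      tr-siegel-σᵇ = begin
        tr (siegel A A′ B ∙ σᵇ)
          ≡⟨ cong tr (∙-σᵇ _ _ _ _) ⟩
        tr (blk (A ∙ Qˢ ⊞ A ∙ B ∙ Rˢ) (A ∙ Rˢ ⊞ A ∙ B ∙ Qˢ) (𝟘 ∙ Qˢ ⊞ A′ ᵀ ∙ Rˢ) (𝟘 ∙ Rˢ ⊞ A′ ᵀ ∙ Qˢ))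
          ≡⟨ tr-blk _ _ _ _ ⟩
        tr (A ∙ Qˢ ⊞ A ∙ B ∙ Rˢ) +ᶠ tr (𝟘 ∙ Rˢ ⊞ A′ ᵀ ∙ Qˢ)
          ≡⟨ cong₂ _+ᶠ_ (tr-⊞ _ _) (cong tr (⊞-dropˡ (∙-zeroˡ _))) ⟩
        tr (A ∙ Qˢ) +ᶠ tr (A ∙ B ∙ Rˢ) +ᶠ tr (A′ ᵀ ∙ Qˢ)
          ≡⟨ cong₂ _+ᶠ_ (cong₂ _+ᶠ_ tr₁ tr₂) tr₃ ⟩
        tr d +ᶠ tr (a ∙ e ⊞ b ∙ g) +ᶠ tr d′
          ≡⟨ F+.xy∙z≈xz∙y (tr d) _ (tr d′) ⟩
        tr d +ᶠ tr d′ +ᶠ tr (a ∙ e ⊞ b ∙ g)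
          ≡⟨ cong (tr d +ᶠ tr d′ +ᶠ_) (tr-⊞ _ _) ⟩
        tr d +ᶠ tr d′ +ᶠ (tr (a ∙ e) +ᶠ tr (b ∙ g)) ∎
        where
        tr₁ : tr (A ∙ Qˢ) ≡ tr d
        tr₁ = trans (cong tr (∙-Q a b c d)) (trans (tr-blk _ _ _ _)
          (trans (cong (_+ᶠ tr d) (tr-𝟘 s)) (Fᴿ.+-identityˡ _)))
        tr₂ : tr (A ∙ B ∙ Rˢ) ≡ tr (a ∙ e ⊞ b ∙ g)
        tr₂ = trans (cong tr (trans (cong (_∙ Rˢ) (blk-∙ a b c d e f g h)) (∙-R _ _ _ _)))
          (trans (tr-blk _ _ _ _)
            (trans (cong (tr (a ∙ e ⊞ b ∙ g) +ᶠ_) (tr-𝟘 t)) (Fᴿ.+-identityʳ _)))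
        tr₃ : tr (A′ ᵀ ∙ Qˢ) ≡ tr d′
        tr₃ = trans (cong (λ x → tr (x ∙ Qˢ)) (blk-ᵀ a′ b′ c′ d′))
          (trans (cong tr (∙-Q _ _ _ _)) (trans (tr-blk _ _ _ _)
          (trans (cong (_+ᶠ tr (d′ ᵀ)) (tr-𝟘 s)) (trans (Fᴿ.+-identityˡ _) (tr-ᵀ d′)))))

      -- This block alone decides whether σpσ lies in P, because the conjugate is symplectic in any
      -- case.
      b₂₁-conjugate : b₂₁ n n n n (σᵇ ∙ siegel A A′ B ∙ σᵇ) ≡
        blk (a ∙ e ⊞ b ∙ g) b (b′ ᵀ) 𝟘
      b₂₁-conjugate = begin
        b₂₁ n n n n (σᵇ ∙ siegel A A′ B ∙ σᵇ)
          ≡⟨ cong (λ x → b₂₁ n n n n (x ∙ σᵇ)) (blk-∙ Qˢ Rˢ Rˢ Qˢ A (A ∙ B) 𝟘 (A′ ᵀ)) ⟩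
        b₂₁ n n n n (blk X₁ X₂ X₃ X₄ ∙ σᵇ)
          ≡⟨ cong (b₂₁ n n n n) (∙-σᵇ X₁ X₂ X₃ X₄) ⟩
        b₂₁ n n n n (blk (X₁ ∙ Qˢ ⊞ X₂ ∙ Rˢ) (X₁ ∙ Rˢ ⊞ X₂ ∙ Qˢ) (X₃ ∙ Qˢ ⊞ X₄ ∙ Rˢ) (X₃ ∙ Rˢ ⊞ X₄ ∙ Qˢ))
          ≡⟨ b₂₁-blk _ _ _ _ ⟩
        (Rˢ ∙ A ⊞ Qˢ ∙ 𝟘) ∙ Qˢ ⊞ (Rˢ ∙ (A ∙ B) ⊞ Qˢ ∙ A′ ᵀ) ∙ Rˢ
          ≡⟨ cong₂ _⊞_ RAQ (∙-distribʳ-⊞ _ _ _) ⟩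
        blk 𝟘 b 𝟘 𝟘 ⊞ (Rˢ ∙ (A ∙ B) ∙ Rˢ ⊞ Qˢ ∙ A′ ᵀ ∙ Rˢ)
          ≡⟨ cong (blk 𝟘 b 𝟘 𝟘 ⊞_) (cong₂ _⊞_ RABR QAR) ⟩
        blk 𝟘 b 𝟘 𝟘 ⊞ (blk (a ∙ e ⊞ b ∙ g) 𝟘 𝟘 𝟘 ⊞ blk 𝟘 𝟘 (b′ ᵀ) 𝟘)
          ≡⟨ cong (blk 𝟘 b 𝟘 𝟘 ⊞_) (blk-⊞ _ _ _ _ _ _ _ _) ⟩
        blk 𝟘 b 𝟘 𝟘 ⊞ blk (a ∙ e ⊞ b ∙ g ⊞ 𝟘) (𝟘 ⊞ 𝟘) (𝟘 ⊞ b′ ᵀ) (𝟘 ⊞ 𝟘)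
          ≡⟨ blk-⊞ _ _ _ _ _ _ _ _ ⟩
        blk (𝟘 ⊞ (a ∙ e ⊞ b ∙ g ⊞ 𝟘)) (b ⊞ (𝟘 ⊞ 𝟘)) (𝟘 ⊞ (𝟘 ⊞ b′ ᵀ)) (𝟘 ⊞ (𝟘 ⊞ 𝟘))
          ≡⟨ blk-cong (trans (⊞-identityˡ _) (⊞-identityʳ _))
               (⊞-dropʳ (⊞-identityˡ 𝟘))
               (trans (⊞-identityˡ _) (⊞-identityˡ _)) (trans (⊞-identityˡ _) (⊞-identityˡ 𝟘)) ⟩
        blk (a ∙ e ⊞ b ∙ g) b (b′ ᵀ) 𝟘 ∎
        where
        X₁ X₂ X₃ X₄ : Mx n n
        X₁ = Qˢ ∙ A ⊞ Rˢ ∙ 𝟘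
        X₂ = Qˢ ∙ (A ∙ B) ⊞ Rˢ ∙ A′ ᵀ
        X₃ = Rˢ ∙ A ⊞ Qˢ ∙ 𝟘
        X₄ = Rˢ ∙ (A ∙ B) ⊞ Qˢ ∙ A′ ᵀ
        RAQ : (Rˢ ∙ A ⊞ Qˢ ∙ 𝟘) ∙ Qˢ ≡ blk 𝟘 b 𝟘 𝟘
        RAQ = trans (cong (_∙ Qˢ) (trans (⊞-dropʳ (∙-zeroʳ _)) (R-∙ a b c d))) (∙-Q a b 𝟘 𝟘)
        RABR : Rˢ ∙ (A ∙ B) ∙ Rˢ ≡ blk (a ∙ e ⊞ b ∙ g) 𝟘 𝟘 𝟘
        RABR = trans (cong (_∙ Rˢ) (trans (cong (Rˢ ∙_) (blk-∙ a b c d e f g h)) (R-∙ _ _ _ _)))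
          (∙-R _ _ _ _)
        QAR : Qˢ ∙ A′ ᵀ ∙ Rˢ ≡ blk 𝟘 𝟘 (b′ ᵀ) 𝟘
        QAR = trans (cong (_∙ Rˢ) (trans (cong (Qˢ ∙_) (blk-ᵀ a′ b′ c′ d′)) (Q-∙ _ _ _ _)))
          (∙-R _ _ _ _)

  private
    <ᵇ-+ : ∀ k a b → (k + a <ᵇ k + b) ≡ (a <ᵇ b)
    <ᵇ-+ zero    a b = refl
    <ᵇ-+ (suc k) a b = <ᵇ-+ k a b

    ≡ᵇ-+ : ∀ k a b → (k + a ≡ᵇ k + b) ≡ (a ≡ᵇ b)
    ≡ᵇ-+ zero    a b = refl
    ≡ᵇ-+ (suc k) a b = ≡ᵇ-+ k a b

    toℕ<ᵇ : ∀ {n} (i : Fin n) → (toℕ i <ᵇ n) ≡ true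
    toℕ<ᵇ zero    = refl
    toℕ<ᵇ (suc i) = toℕ<ᵇ i

    +≮ᵇ : ∀ n i → (n + i <ᵇ n) ≡ false
    +≮ᵇ zero    i = refl
    +≮ᵇ (suc n) i = +≮ᵇ n i

    -- The disjunction is the spelling of s ≤ i in the definition of `σ`.
    ≤ᵇ-< : ∀ {s} (i : Fin s) → ((s <ᵇ toℕ i) ∨ (s ≡ᵇ toℕ i)) ≡ false
    ≤ᵇ-< zero    = refl
    ≤ᵇ-< (suc i) = ≤ᵇ-< i

    ≤ᵇ-+ : ∀ s i → ((s <ᵇ s + i) ∨ (s ≡ᵇ s + i)) ≡ true
    ≤ᵇ-+ zero    zero    = refl
    ≤ᵇ-+ zero    (suc i) = refl
    ≤ᵇ-+ (suc s) i       = ≤ᵇ-+ s i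

    ≡ᵇ-sym : ∀ a b → (a ≡ᵇ b) ≡ (b ≡ᵇ a)
    ≡ᵇ-sym zero    zero    = refl
    ≡ᵇ-sym zero    (suc b) = refl
    ≡ᵇ-sym (suc a) zero    = refl
    ≡ᵇ-sym (suc a) (suc b) = ≡ᵇ-sym a b

    ⟦_⟧ : Bool → F
    ⟦ x ⟧ = if x then 1# else 0#

  module _ (s t : ℕ) where

    private
      n : ℕ
      n = s + t

      at-Q : ∀ (i j : Fin n) → at (Qˢ s t) i j ≡
        ⟦ (toℕ i ≡ᵇ toℕ j) ∧ ((s <ᵇ toℕ i) ∨ (s ≡ᵇ toℕ i)) ⟧
      at-Q = ↑-cover s
        (λ i j → trans (trans (at-vcatˡ _ _ i j) (↑-cover s {P = λ j → at (hcat 𝟘 𝟘) i j ≡ 0#}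
            (λ j → trans (at-hcatˡ _ _ i j) (at-𝟘 i j)) (λ j → trans (at-hcatʳ _ _ i j) (at-𝟘 i j)) j))
          (sym (cong ⟦_⟧ (trans (cong ((toℕ (i ↑ˡ t) ≡ᵇ toℕ j) ∧_)
              (trans (cong (λ x → (s <ᵇ x) ∨ (s ≡ᵇ x)) (FinP.toℕ-↑ˡ i t)) (≤ᵇ-< i)))
            (BoolP.∧-zeroʳ _)))))
        (λ i j → trans (trans (at-vcatʳ _ _ i j)
          (↑-cover s {P = λ j → at (hcat 𝟘 I) i j ≡ δ (toℕ (s ↑ʳ i)) (toℕ j)}
            (λ j → trans (at-hcatˡ _ _ i j) (trans (at-𝟘 i j)
              (sym (trans (δ-sym (toℕ (s ↑ʳ i)) _) (δ-↑ˡ↑ʳ t j i)))))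
            (λ j → trans (at-hcatʳ _ _ i j) (trans (at-I i j) (sym (trans
              (cong₂ δ (FinP.toℕ-↑ʳ s i) (FinP.toℕ-↑ʳ s j)) (δ-↑ʳ s (toℕ i) (toℕ j)))))) j))
          (cong ⟦_⟧ (sym (trans (cong ((toℕ (s ↑ʳ i) ≡ᵇ toℕ j) ∧_)
              (trans (cong (λ x → (s <ᵇ x) ∨ (s ≡ᵇ x)) (FinP.toℕ-↑ʳ s i)) (≤ᵇ-+ s (toℕ i))))
            (BoolP.∧-identityʳ _)))))

      at-R : ∀ (i j : Fin n) → at (Rˢ s t) i j ≡ ⟦ (toℕ i ≡ᵇ toℕ j) ∧ (toℕ i <ᵇ s) ⟧
      at-R = ↑-cover s
        (λ i j → trans (trans (at-vcatˡ _ _ i j)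
          (↑-cover s {P = λ j → at (hcat I 𝟘) i j ≡ δ (toℕ (i ↑ˡ t)) (toℕ j)}
            (λ j → trans (at-hcatˡ _ _ i j) (trans (at-I i j) (sym
              (cong₂ δ (FinP.toℕ-↑ˡ i t) (FinP.toℕ-↑ˡ j t)))))
            (λ j → trans (at-hcatʳ _ _ i j) (trans (at-𝟘 i j) (sym (δ-↑ˡ↑ʳ t i j)))) j))
          (cong ⟦_⟧ (sym (trans (cong ((toℕ (i ↑ˡ t) ≡ᵇ toℕ j) ∧_)
              (trans (cong (_<ᵇ s) (FinP.toℕ-↑ˡ i t)) (toℕ<ᵇ i)))
            (BoolP.∧-identityʳ _)))))
        (λ i j → trans (trans (at-vcatʳ _ _ i j) (↑-cover s {P = λ j → at (hcat 𝟘 𝟘) i j ≡ 0#}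
            (λ j → trans (at-hcatˡ _ _ i j) (at-𝟘 i j)) (λ j → trans (at-hcatʳ _ _ i j) (at-𝟘 i j)) j))
          (sym (cong ⟦_⟧ (trans (cong ((toℕ (s ↑ʳ i) ≡ᵇ toℕ j) ∧_)
              (trans (cong (_<ᵇ s) (FinP.toℕ-↑ʳ s i)) (+≮ᵇ s (toℕ i))))
            (BoolP.∧-zeroʳ _)))))

      -- The case function inside `σ` is local to its definition, so the value of an entry is taken
      -- as the first component here and then evaluated in the four quadrants.
      σ-value : ∀ i j → Σ F (λ x → entry (σ n s) i j ≡ x)
      σ-value i j = _ , trans (cong (λ v → lookup v j) (VP.lookup∘tabulate _ i)) (VP.lookup∘tabulate _ j)

      σ-entry : ∀ i j → at (σ n s) i j ≡ proj₁ (σ-value i j)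
      σ-entry i j = trans (at≡entry (σ n s) i j) (proj₂ (σ-value i j))

      e₁₁ : ∀ (i j : Fin n) → proj₁ (σ-value (i ↑ˡ n) (j ↑ˡ n)) ≡
        ⟦ (toℕ i ≡ᵇ toℕ j) ∧ ((s <ᵇ toℕ i) ∨ (s ≡ᵇ toℕ i)) ⟧
      e₁₁ i j rewrite FinP.toℕ-↑ˡ i n | FinP.toℕ-↑ˡ j n | toℕ<ᵇ i | toℕ<ᵇ j = refl

      e₁₂ : ∀ (i j : Fin n) → proj₁ (σ-value (i ↑ˡ n) (n ↑ʳ j)) ≡ ⟦ (toℕ i ≡ᵇ toℕ j) ∧ (toℕ i <ᵇ s) ⟧
      e₁₂ i j rewrite FinP.toℕ-↑ˡ i n | FinP.toℕ-↑ʳ n j | toℕ<ᵇ i | +≮ᵇ n (toℕ j)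
        | ℕP.+-comm (toℕ i) n | ≡ᵇ-+ n (toℕ j) (toℕ i) | ≡ᵇ-sym (toℕ j) (toℕ i) = refl

      e₂₁ : ∀ (i j : Fin n) → proj₁ (σ-value (n ↑ʳ i) (j ↑ˡ n)) ≡ ⟦ (toℕ j ≡ᵇ toℕ i) ∧ (toℕ j <ᵇ s) ⟧
      e₂₁ i j rewrite FinP.toℕ-↑ˡ j n | FinP.toℕ-↑ʳ n i | toℕ<ᵇ j | +≮ᵇ n (toℕ i)
        | ℕP.+-comm (toℕ j) n | ≡ᵇ-+ n (toℕ i) (toℕ j) | ≡ᵇ-sym (toℕ i) (toℕ j) = refl

      e₂₂ : ∀ (i j : Fin n) → proj₁ (σ-value (n ↑ʳ i) (n ↑ʳ j)) ≡
        ⟦ (toℕ i ≡ᵇ toℕ j) ∧ ((s <ᵇ toℕ i) ∨ (s ≡ᵇ toℕ i)) ⟧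
      e₂₂ i j rewrite FinP.toℕ-↑ʳ n i | FinP.toℕ-↑ʳ n j | +≮ᵇ n (toℕ i) | +≮ᵇ n (toℕ j)
        | ≡ᵇ-+ n (toℕ i) (toℕ j) | <ᵇ-+ n s (toℕ i) | ≡ᵇ-+ n s (toℕ i) = refl

      R-symmetric : ∀ i j → at (Rˢ s t) j i ≡ at (Rˢ s t) i j
      R-symmetric i j = trans (sym (at-ᵀ (Rˢ s t) i j))
        (cong (λ M → at M i j) (trans (blk-ᵀ I 𝟘 𝟘 𝟘) (blk-cong ᵀ-I ᵀ-𝟘 ᵀ-𝟘 ᵀ-𝟘)))

    σ≡σᵇ : σ (s + t) s ≡ σᵇ s t
    σ≡σᵇ = ext (↑-cover n
      (λ i → ↑-cover n
        (λ j → trans (σ-entry _ _) (trans (trans (e₁₁ i j) (sym (at-Q i j)))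
          (sym (trans (at-vcatˡ _ _ i (j ↑ˡ n)) (at-hcatˡ _ _ i j)))))
        (λ j → trans (σ-entry _ _) (trans (trans (e₁₂ i j) (sym (at-R i j)))
          (sym (trans (at-vcatˡ _ _ i (n ↑ʳ j)) (at-hcatʳ _ _ i j))))))
      (λ i → ↑-cover n
        (λ j → trans (σ-entry _ _) (trans (trans (e₂₁ i j) (trans (sym (at-R j i)) (R-symmetric i j)))
          (sym (trans (at-vcatʳ _ _ i (j ↑ˡ n)) (at-hcatˡ _ _ i j)))))
        (λ j → trans (σ-entry _ _) (trans (trans (e₂₂ i j) (sym (at-Q i j)))
          (sym (trans (at-vcatʳ _ _ i (n ↑ʳ j)) (at-hcatʳ _ _ i j)))))))

-- Sums over block triangular and symmetric matrices; alternating matrices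

module BlockSums {r} (𝔽 : FiniteField r)
  (char2 : ∀ x → FiniteField._+_ 𝔽 x x ≡ FiniteField.0# 𝔽) where

  open FiniteSums
  open Matrices 𝔽
  open SiegelParabolic 𝔽

  ⊞-double : ∀ {m n} {A B : Mx m n} → A ≡ B → A ⊞ B ≡ 𝟘
  ⊞-double refl = ⊞-self char2 _

  GL-low? : ∀ s t (p : Mx (s ℕ.+ t) (s ℕ.+ t) × Mx (s ℕ.+ t) (s ℕ.+ t)) →
    Dec (proj₁ p ∙ proj₂ p ≡ I × b₁₂ s t s t (proj₁ p) ≡ 𝟘)
  GL-low? s t p = GL? p ×-dec (b₁₂ s t s t (proj₁ p) ≟ 𝟘)

  module _ {s t : ℕ} where

    private
      n : ℕ
      n = s ℕ.+ t

      product : ∀ {a a′ : Mx s s} {b′ : Mx s t} {c c′ : Mx t s} {d d′ : Mx t t} →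
        blk a 𝟘 c d ∙ blk a′ b′ c′ d′ ≡ blk (a ∙ a′) (a ∙ b′) (c ∙ a′ ⊞ d ∙ c′) (c ∙ b′ ⊞ d ∙ d′)
      product = trans (blk-∙ _ _ _ _ _ _ _ _)
        (blk-cong (⊞-dropʳ (∙-zeroˡ _)) (⊞-dropʳ (∙-zeroˡ _)) refl refl)

    -- The upper blocks give a a′ = 1 and a b′ = 0, so b′ = 0 because a is invertible; then c b′
    -- disappears from the lower right block.
    low-blocks : ∀ {a a′ : Mx s s} {b′ : Mx s t} {c c′ : Mx t s} {d d′ : Mx t t} →
      blk a 𝟘 c d ∙ blk a′ b′ c′ d′ ≡ I → a ∙ a′ ≡ I × b′ ≡ 𝟘 × d ∙ d′ ≡ I
    low-blocks {a} {a′} {b′} {c} {c′} {d} {d′} e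
      with blk-injective (trans (sym product) (trans e (I-blk s t)))
    ... | aa′ , ab′ , _ , dd′ = aa′ , b′≡𝟘 ,
      trans (sym (⊞-dropˡ (trans (cong (c ∙_) b′≡𝟘) (∙-zeroʳ c)))) dd′
      where
      b′≡𝟘 : b′ ≡ 𝟘
      b′≡𝟘 = trans (sym (∙-cancel-inverseˡ (rightInverse⇒leftInverse aa′) b′))
        (trans (cong (a′ ∙_) ab′) (∙-zeroʳ a′))

    -- The lower left entry solves c a′ + d c′ = 0; the minus sign is lost in characteristic 2.
    low-inverse : ∀ {a a′ : Mx s s} {d d′ : Mx t t} (c : Mx t s) → a ∙ a′ ≡ I → d ∙ d′ ≡ I →
      blk a 𝟘 c d ∙ blk a′ 𝟘 (d′ ∙ (c ∙ a′)) d′ ≡ I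
    low-inverse {a} {a′} {d} {d′} c aa′ dd′ = trans product
      (trans (blk-cong aa′ (∙-zeroʳ a) (⊞-double (sym (∙-cancel-inverseˡ dd′ _)))
        (trans (⊞-dropˡ (∙-zeroʳ c)) dd′)) (sym (I-blk s t)))

    -- A block lower triangular matrix is invertible exactly when its diagonal blocks are, so c runs
    -- freely.
    ∑-GL-low : (f : Mx n n × Mx n n → ℤ) → ∑⟨ GL-low? s t ⟩ f ≡
      ∑⟨ GL? ⟩ (λ (a , a′) → ∑⟨ GL? ⟩ (λ (d , d′) →
        ∑ (λ c → f (blk a 𝟘 c d , blk a′ 𝟘 (d′ ∙ (c ∙ a′)) d′))))
    ∑-GL-low f = trans
      (∑⟨⟩-bij (GL-low? s t) Q?
        (λ (A , A′) → (b₁₁ s t s t A , b₁₁ s t s t A′) ,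
                      (b₂₂ s t s t A , b₂₂ s t s t A′) , b₂₁ s t s t A)
        γ
        (λ { (A , A′) (AA′ , A₁₂) → let aa′ , _ , dd′ = low-blocks (split A A′ A₁₂ AA′) in aa′ , dd′ })
        (λ { ((a , a′) , (d , d′) , c) (aa′ , dd′) → low-inverse c aa′ dd′ , b₁₂-blk _ _ _ _ })
        (λ { (A , A′) (AA′ , A₁₂) → let aa′ , _ , dd′ = low-blocks (split A A′ A₁₂ AA′) in
               cong₂ _,_ (recover A A₁₂) (inverse-unique (low-inverse _ aa′ dd′)
                 (trans (cong (_∙ A′) (recover A A₁₂)) AA′)) })
        (λ { ((a , a′) , (d , d′) , c) _ → cong₂ _,_ (cong₂ _,_ (b₁₁-blk _ _ _ _) (b₁₁-blk _ _ _ _))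
               (cong₂ _,_ (cong₂ _,_ (b₂₂-blk _ _ _ _) (b₂₂-blk _ _ _ _)) (b₂₁-blk _ _ _ _)) })
        (λ _ _ → refl))
      (trans (∑⟨⟩-× Q? GL? (λ _ (d , _) → GL? d) (λ _ _ → id) (λ _ _ → _,_) (f ∘ γ))
        (∑-cong λ p → cong (𝟙 (GL? p) ℤ.*_) (trans
          (∑⟨⟩-× (λ (d , _) → GL? d) GL? (λ _ _ → yes tt) (λ _ _ h → h , tt) (λ _ _ h _ → h)
            (λ y → f (γ (p , y))))
          (∑-cong λ d → cong (𝟙 (GL? d) ℤ.*_) (∑-cong λ c → ℤP.*-identityˡ _)))))
      where
      γ : (Mx s s × Mx s s) × (Mx t t × Mx t t) × Mx t s → Mx n n × Mx n n
      γ ((a , a′) , (d , d′) , c) = blk a 𝟘 c d , blk a′ 𝟘 (d′ ∙ (c ∙ a′)) d′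
      Q? : (x : (Mx s s × Mx s s) × (Mx t t × Mx t t) × Mx t s) →
        Dec (proj₁ (proj₁ x) ∙ proj₂ (proj₁ x) ≡ I ×
             proj₁ (proj₁ (proj₂ x)) ∙ proj₂ (proj₁ (proj₂ x)) ≡ I)
      Q? (a , d , _) = GL? a ×-dec GL? d
      recover : ∀ A → b₁₂ s t s t A ≡ 𝟘 →
        blk (b₁₁ s t s t A) 𝟘 (b₂₁ s t s t A) (b₂₂ s t s t A) ≡ A
      recover A A₁₂ = trans (blk-cong refl (sym A₁₂) refl refl) (blk-η s t s t A)
      split : ∀ A A′ → b₁₂ s t s t A ≡ 𝟘 → A ∙ A′ ≡ I →
        blk (b₁₁ s t s t A) 𝟘 (b₂₁ s t s t A) (b₂₂ s t s t A) ∙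
        blk (b₁₁ s t s t A′) (b₁₂ s t s t A′) (b₂₁ s t s t A′) (b₂₂ s t s t A′) ≡ I
      split A A′ A₁₂ AA′ = trans (cong₂ _∙_ (recover A A₁₂) (blk-η s t s t A′)) AA′

    blk-Sym : ∀ {e : Mx s s} {f : Mx s t} {g : Mx t s} {h : Mx t t} →
      blk e f g h ᵀ ≡ blk e f g h → e ᵀ ≡ e × g ᵀ ≡ f × h ᵀ ≡ h
    blk-Sym B with blk-injective (trans (sym (blk-ᵀ _ _ _ _)) B)
    ... | e , f , _ , h = e , f , h

    Sym-blk : ∀ {e : Mx s s} (g : Mx t s) {h : Mx t t} → e ᵀ ≡ e → h ᵀ ≡ h →
      blk e (g ᵀ) g h ᵀ ≡ blk e (g ᵀ) g h
    Sym-blk g e h = trans (blk-ᵀ _ _ _ _) (blk-cong e refl (ᵀ-involutive g) h)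

    ∑-Sym : (f : Mx n n → ℤ) → ∑⟨ Sym? ⟩ f ≡
      ∑⟨ Sym? ⟩ (λ e → ∑ (λ (g : Mx t s) → ∑⟨ Sym? ⟩ (λ h → f (blk e (g ᵀ) g h))))
    ∑-Sym f = trans
      (∑⟨⟩-bij Sym? Q? (λ B → b₁₁ s t s t B , b₂₁ s t s t B , b₂₂ s t s t B)
        (λ (e , g , h) → blk e (g ᵀ) g h)
        (λ B symB → let e , _ , h = blk-Sym (split B symB) in e , h)
        (λ (e , g , h) (symE , symH) → Sym-blk g symE symH)
        (λ B symB → let _ , g , _ = blk-Sym (split B symB) in
          trans (blk-cong refl g refl refl) (blk-η s t s t B))
        (λ _ _ → cong₂ _,_ (b₁₁-blk _ _ _ _) (cong₂ _,_ (b₂₁-blk _ _ _ _) (b₂₂-blk _ _ _ _)))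
        (λ _ _ → refl))
      (trans (∑⟨⟩-× Q? Sym? (λ _ (_ , h) → Sym? h) (λ _ _ → id) (λ _ _ → _,_) _)
        (∑-cong λ e → cong (𝟙 (Sym? e) ℤ.*_) (∑-× _)))
      where
      Q? : (x : Mx s s × Mx t s × Mx t t) →
        Dec (proj₁ x ᵀ ≡ proj₁ x × proj₂ (proj₂ x) ᵀ ≡ proj₂ (proj₂ x))
      Q? (e , _ , h) = Sym? e ×-dec Sym? h
      split : ∀ B → B ᵀ ≡ B → let b = blk (b₁₁ s t s t B) (b₁₂ s t s t B) (b₂₁ s t s t B) (b₂₂ s t s t B) in
        b ᵀ ≡ b
      split B symB = trans (cong _ᵀ (blk-η s t s t B)) (trans symB (sym (blk-η s t s t B)))

  -- Taking for g the matrix unit at the transposed position (j , i) picks out the entry (i , j) of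
  -- b.
  tr-nondegenerate : ∀ {m n} (b : Mx m n) → (∀ g → tr (b ∙ g) ≡ 0#) → b ≡ 𝟘
  tr-nondegenerate b h = ext λ i j → trans (sym (pick i j)) (trans (h _) (sym (at-𝟘 i j)))
    where
    unit : ∀ i j → Mx _ _
    unit i j = mk (λ k l → δ (toℕ i) (toℕ l) *ᶠ δ (toℕ j) (toℕ k))
    pick : ∀ i j → tr (b ∙ unit i j) ≡ at b i j
    pick i j = begin
      tr (b ∙ unit i j)
        ≡⟨ trans (tr-at _) (∑ᶠ-cong (λ l → at-∙ b (unit i j) l l)) ⟩
      ∑ᶠ (λ l → ∑ᶠ (λ k → at b l k *ᶠ at (unit i j) k l))
        ≡⟨ ∑ᶠ-cong (λ l → trans (∑ᶠ-cong (λ k → trans (cong (at b l k *ᶠ_) (at-mk _ k l))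
             (trans (Fᴿ.*-comm _ _) (Fᴿ.*-assoc _ _ _)))) (∑ᶠ-*ˡ (δ (toℕ i) (toℕ l)) _)) ⟩
      ∑ᶠ (λ l → δ (toℕ i) (toℕ l) *ᶠ ∑ᶠ (λ k → δ (toℕ j) (toℕ k) *ᶠ at b l k))
        ≡⟨ trans (∑ᶠ-δ i _) (∑ᶠ-δ j (at b i)) ⟩
      at b i j ∎

  -- Equivalent to Xᵀ = X with zero diagonal; in this form the invariance under congruence and
  -- the link with the sums over symmetric B are immediate.
  Alternating : ∀ {n} → Mx n n → Set
  Alternating {n} X = ∀ (B : Mx n n) → B ᵀ ≡ B → tr (X ∙ B) ≡ 0#

  Alternating? : ∀ {n} (X : Mx n n) → Dec (Alternating X)
  Alternating? X = ∀? (λ B → Sym? B →-dec (tr (X ∙ B) ≟ 0#))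

  -- The trace moves N over to B: tr(ᵗN X N B) = tr(X (N B ᵗN)), and N B ᵗN is again symmetric.
  Alternating-congruence : ∀ {n} {X : Mx n n} (N : Mx n n) →
    Alternating X → Alternating (N ᵀ ∙ X ∙ N)
  Alternating-congruence {X = X} N alt B symB = begin
    tr (N ᵀ ∙ X ∙ N ∙ B)     ≡⟨ cong tr (trans (∙-assoc _ N B) (∙-assoc (N ᵀ) X _)) ⟩
    tr (N ᵀ ∙ (X ∙ (N ∙ B))) ≡⟨ tr-∙-comm (N ᵀ) _ ⟩
    tr (X ∙ (N ∙ B) ∙ N ᵀ)   ≡⟨ cong tr (∙-assoc X _ _) ⟩
    tr (X ∙ (N ∙ B ∙ N ᵀ))   ≡⟨ alt (N ∙ B ∙ N ᵀ) NBN-sym ⟩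
    0#                       ∎
    where
    NBN-sym : (N ∙ B ∙ N ᵀ) ᵀ ≡ N ∙ B ∙ N ᵀ
    NBN-sym = begin
      (N ∙ B ∙ N ᵀ) ᵀ         ≡⟨ ᵀ-∙ _ _ ⟩
      N ᵀ ᵀ ∙ (N ∙ B) ᵀ       ≡⟨ cong₂ _∙_ (ᵀ-involutive N) (trans (ᵀ-∙ N B) (cong (_∙ N ᵀ) symB)) ⟩
      N ∙ (B ∙ N ᵀ)           ≡⟨ ∙-assoc N B _ ⟨
      N ∙ B ∙ N ᵀ             ∎

  module _ {s t : ℕ} {x : Mx s s} {y : Mx s t} {z : Mx t s} {w : Mx t t} where

    private
      -- The two off-diagonal blocks of a symmetric matrix are not independent, so y and z enter
      -- only through y + ᵗz.
      tr-sym : ∀ (e : Mx s s) (g : Mx t s) (h : Mx t t) →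
        tr (blk x y z w ∙ blk e (g ᵀ) g h) ≡ tr (x ∙ e) +ᶠ tr ((y ⊞ z ᵀ) ∙ g) +ᶠ tr (w ∙ h)
      tr-sym e g h = begin
        tr (blk x y z w ∙ blk e (g ᵀ) g h)
          ≡⟨ trans (cong tr (blk-∙ _ _ _ _ _ _ _ _)) (tr-blk _ _ _ _) ⟩
        tr (x ∙ e ⊞ y ∙ g) +ᶠ tr (z ∙ g ᵀ ⊞ w ∙ h)
          ≡⟨ cong₂ _+ᶠ_ (tr-⊞ _ _) (tr-⊞ _ _) ⟩
        tr (x ∙ e) +ᶠ tr (y ∙ g) +ᶠ (tr (z ∙ g ᵀ) +ᶠ tr (w ∙ h))
          ≡⟨ Fᴿ.+-assoc _ _ _ ⟨
        tr (x ∙ e) +ᶠ tr (y ∙ g) +ᶠ tr (z ∙ g ᵀ) +ᶠ tr (w ∙ h)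
          ≡⟨ cong (_+ᶠ tr (w ∙ h)) (Fᴿ.+-assoc _ _ _) ⟩
        tr (x ∙ e) +ᶠ (tr (y ∙ g) +ᶠ tr (z ∙ g ᵀ)) +ᶠ tr (w ∙ h)
          ≡⟨ cong (λ u → tr (x ∙ e) +ᶠ (tr (y ∙ g) +ᶠ u) +ᶠ tr (w ∙ h)) flip ⟩
        tr (x ∙ e) +ᶠ (tr (y ∙ g) +ᶠ tr (z ᵀ ∙ g)) +ᶠ tr (w ∙ h)
          ≡⟨ cong (λ u → tr (x ∙ e) +ᶠ u +ᶠ tr (w ∙ h))
               (trans (cong tr (∙-distribʳ-⊞ g y (z ᵀ))) (tr-⊞ _ _)) ⟨
        tr (x ∙ e) +ᶠ tr ((y ⊞ z ᵀ) ∙ g) +ᶠ tr (w ∙ h) ∎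
        where
        flip : tr (z ∙ g ᵀ) ≡ tr (z ᵀ ∙ g)
        flip = trans (sym (tr-ᵀ _)) (trans (cong tr (trans (ᵀ-∙ z (g ᵀ))
          (cong (_∙ z ᵀ) (ᵀ-involutive g)))) (tr-∙-comm g (z ᵀ)))

      tr-∙𝟘 : ∀ {m n} (X : Mx m n) → tr (X ∙ 𝟘) ≡ 0#
      tr-∙𝟘 {m} X = trans (cong tr (∙-zeroʳ X)) (tr-𝟘 m)

      +0+0 : ∀ {a b c : F} → b ≡ 0# → c ≡ 0# → a +ᶠ b +ᶠ c ≡ a
      +0+0 refl refl = trans (Fᴿ.+-identityʳ _) (Fᴿ.+-identityʳ _)

      0+0+ : ∀ {a b c : F} → a ≡ 0# → b ≡ 0# → a +ᶠ b +ᶠ c ≡ c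
      0+0+ refl refl = trans (cong (_+ᶠ _) (Fᴿ.+-identityˡ _)) (Fᴿ.+-identityˡ _)

    -- Each conclusion comes from testing against symmetric B supported on e alone, on g with its
    -- transpose, or on h alone; the middle one uses nondegeneracy of the trace.
    blk-Alternating : Alternating (blk x y z w) → Alternating x × z ≡ y ᵀ × Alternating w
    blk-Alternating alt =
      (λ e symE → trans (sym (+0+0 (tr-∙𝟘 _) (tr-∙𝟘 w)))
        (trans (sym (tr-sym e 𝟘 𝟘)) (alt _ (Sym-blk 𝟘 symE ᵀ-𝟘)))) ,
      trans (sym (ᵀ-involutive z)) (cong _ᵀ (sym (⊞-zero⇒≡ char2 (tr-nondegenerate (y ⊞ z ᵀ) λ g →
        trans (sym (trans (+0+ʳ (tr-∙𝟘 x) (tr-∙𝟘 w)) refl))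
          (trans (sym (tr-sym 𝟘 g 𝟘)) (alt _ (Sym-blk g ᵀ-𝟘 ᵀ-𝟘))))))) ,
      (λ h symH → trans (sym (0+0+ (tr-∙𝟘 x) (tr-∙𝟘 _)))
        (trans (sym (tr-sym 𝟘 𝟘 h)) (alt _ (Sym-blk 𝟘 ᵀ-𝟘 symH))))
      where
      +0+ʳ : ∀ {a b c : F} → a ≡ 0# → c ≡ 0# → a +ᶠ b +ᶠ c ≡ b
      +0+ʳ refl refl = trans (Fᴿ.+-identityʳ _) (Fᴿ.+-identityˡ _)

    Alternating-blk : Alternating x → z ≡ y ᵀ → Alternating w → Alternating (blk x y z w)
    Alternating-blk altX refl altW B symB = begin
      tr (blk x y z w ∙ B)
        ≡⟨ cong (λ b → tr (blk x y z w ∙ b)) (sym B≡) ⟩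
      tr (blk x y z w ∙ blk e (g ᵀ) g h)
        ≡⟨ tr-sym e g h ⟩
      tr (x ∙ e) +ᶠ tr ((y ⊞ z ᵀ) ∙ g) +ᶠ tr (w ∙ h)
        ≡⟨ 0+0+ (altX e symE) (trans (cong (λ u → tr (u ∙ g)) (⊞-double (sym (ᵀ-involutive y))))
             (trans (cong tr (∙-zeroˡ g)) (tr-𝟘 s))) ⟩
      tr (w ∙ h)
        ≡⟨ altW h symH ⟩
      0# ∎
      where
      e : Mx s s
      e = b₁₁ s t s t B
      g : Mx t s
      g = b₂₁ s t s t B
      h : Mx t t
      h = b₂₂ s t s t B
      parts = blk-Sym {s} {t} (trans (cong _ᵀ (blk-η s t s t B)) (trans symB (sym (blk-η s t s t B))))
      symE = proj₁ parts
      symH = proj₂ (proj₂ parts)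
      B≡ : blk e (g ᵀ) g h ≡ B
      B≡ = trans (blk-cong refl (proj₁ (proj₂ parts)) refl refl) (blk-η s t s t B)

  1×1-ext : {A B : Mx 1 1} → tr A ≡ tr B → A ≡ B
  1×1-ext {A} {B} e = ext λ { zero zero → trans (sym (tr-1 A)) (trans e (tr-1 B)) }
    where
    opaque
      unfolding tr ∑ᶠ
      tr-1 : ∀ (A : Mx 1 1) → tr A ≡ at A zero zero
      tr-1 A = Fᴿ.+-identityʳ _

  Alternating-1×1 : {x : Mx 1 1} → Alternating x → x ≡ 𝟘
  Alternating-1×1 {x} alt = 1×1-ext (trans (cong tr (sym (∙-identityʳ x)))
    (trans (alt I ᵀ-I) (sym (tr-𝟘 1))))

  Alternating-𝟘 : ∀ {n} → Alternating (𝟘 {n} {n})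
  Alternating-𝟘 {n} B _ = trans (cong tr (∙-zeroˡ B)) (tr-𝟘 n)

-- Recursions for |GL(n)| and the number of nonsingular alternating matrices

module Orders {r} (𝔽 : FiniteField r)
  (char2 : ∀ x → FiniteField._+_ 𝔽 x x ≡ FiniteField.0# 𝔽) where

  open import Data.Integer using (_+_; _*_; _-_)
  open FiniteSums
  open Matrices 𝔽
  open SiegelParabolic 𝔽
  open BlockSums 𝔽 char2

  opaque
    unfolding tr I ∑ᶠ

    tr-I₁ : tr (I {1}) ≡ 1#
    tr-I₁ = Fᴿ.+-identityʳ 1#

  I₁≢𝟘 : ¬ (I {1} ≡ 𝟘)
  I₁≢𝟘 e = 0≢1 (trans (sym (tr-𝟘 1)) (trans (cong tr (sym e)) tr-I₁))

  1×1-inverse : (a : Mx 1 1) → ¬ (a ≡ 𝟘) → ∃ λ a′ → a ∙ a′ ≡ I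
  1×1-inverse a a≢𝟘 = tr a ⁻¹ᶠ · I , 1×1-ext (begin
    tr (a ∙ (tr a ⁻¹ᶠ · I)) ≡⟨ cong tr (trans (∙-·ʳ _ a I) (cong (tr a ⁻¹ᶠ ·_) (∙-identityʳ a))) ⟩
    tr (tr a ⁻¹ᶠ · a)       ≡⟨ tr-· _ a ⟩
    tr a ⁻¹ᶠ *ᶠ tr a        ≡⟨ Fᴿ.*-comm _ _ ⟩
    tr a *ᶠ tr a ⁻¹ᶠ        ≡⟨ ⁻¹-inverse _ (λ e → a≢𝟘 (1×1-ext (trans e (sym (tr-𝟘 1))))) ⟩
    1#                      ≡⟨ tr-I₁ ⟨
    tr I                    ∎)

  -- Nondegeneracy of the trace provides a column u with w u nonzero; the 1 × 1 inverse of w u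
  -- rescales it.
  row-dual : ∀ {n} (w : Mx 1 n) → ¬ (w ≡ 𝟘) → ∃ λ u → w ∙ u ≡ I
  row-dual {n} w w≢𝟘 with ∃? {X = Mx n 1} (λ u → ¬? (w ∙ u ≟ 𝟘))
  ... | yes (u , wu≢𝟘) = let a′ , e = 1×1-inverse (w ∙ u) wu≢𝟘 in
    u ∙ a′ , trans (sym (∙-assoc w u a′)) e
  ... | no ¬∃ = contradiction (tr-nondegenerate w (λ u → trans
      (cong tr (decidable-stable (w ∙ u ≟ 𝟘) (λ h → ¬∃ (u , h)))) (tr-𝟘 1))) w≢𝟘

  e₁ : ∀ {n} → Mx 1 (suc n)
  e₁ {n} = hcat {a = 1} {n} I 𝟘

  top-I : ∀ {n} → top 1 n I ≡ e₁
  top-I {n} = trans (cong (top 1 n) (I-blk 1 n)) (top-vcat _ _)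

  -- When the first entry of v vanishes, (1 w; 0 1) (1 0; u 1) with w u = 1 has first row (0 w).
  completeRow : ∀ {n} (v : Mx 1 (suc n)) → ¬ (v ≡ 𝟘) →
    ∃₂ λ M M′ → M ∙ M′ ≡ I × top 1 n M ≡ v
  completeRow {n} v v≢𝟘 with left 1 n v ≟ 𝟘
  ... | no a≢𝟘 =
    let a′ , aa′ = 1×1-inverse (left 1 n v) a≢𝟘
        w = right 1 n v in
    blk (left 1 n v) w 𝟘 I , blk a′ (a′ ∙ w) 𝟘 I ,
    trans (blk-∙ _ _ _ _ _ _ _ _) (trans (blk-cong
      (trans (⊞-dropʳ (∙-zeroʳ w)) aa′)
      (⊞-double (trans (∙-cancel-inverseˡ aa′ w) (sym (∙-identityʳ w))))
      (trans (⊞-dropˡ (∙-zeroˡ a′)) (∙-identityˡ 𝟘))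
      (trans (⊞-dropˡ (∙-zeroˡ _)) (∙-identityˡ I))) (sym (I-blk 1 n))) ,
    trans (top-vcat _ _) (hcat-η 1 n v)
  ... | yes a≡𝟘 =
    let u , wu = row-dual w w≢𝟘 in
    blk I w 𝟘 I ∙ blk I 𝟘 u I , blk I 𝟘 u I ∙ blk I w 𝟘 I ,
    ∙-inverse (unipotentʳ w) (unipotentˡ u) ,
    trans (cong (top 1 n) (blk-∙ _ _ _ _ _ _ _ _)) (trans (top-vcat _ _)
      (trans (cong₂ hcat
          (trans (⊞-double (trans (∙-identityˡ I) (sym wu))) (sym a≡𝟘))
          (trans (⊞-dropˡ (∙-zeroʳ I)) (∙-identityʳ w)))
        (hcat-η 1 n v)))
    where
    w : Mx 1 n
    w = right 1 n v
    w≢𝟘 : ¬ (w ≡ 𝟘)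
    w≢𝟘 e = v≢𝟘 (trans (sym (hcat-η 1 n v)) (trans (cong₂ hcat a≡𝟘 e) (sym (𝟘-hcat 1 n))))
    unipotentʳ : ∀ (w : Mx 1 n) → blk {1} {n} {1} {n} I w 𝟘 I ∙ blk I w 𝟘 I ≡ I
    unipotentʳ w = trans (blk-∙ _ _ _ _ _ _ _ _) (trans (blk-cong
      (trans (⊞-dropʳ (∙-zeroʳ w)) (∙-identityˡ I))
      (⊞-double (trans (∙-identityˡ w) (sym (∙-identityʳ w))))
      (trans (⊞-dropˡ (∙-zeroˡ I)) (∙-identityˡ 𝟘))
      (trans (⊞-dropˡ (∙-zeroˡ w)) (∙-identityˡ I))) (sym (I-blk 1 n)))
    unipotentˡ : ∀ (u : Mx n 1) → blk {1} {n} {1} {n} I 𝟘 u I ∙ blk I 𝟘 u I ≡ I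
    unipotentˡ u = trans (blk-∙ _ _ _ _ _ _ _ _) (trans (blk-cong
      (trans (⊞-dropʳ (∙-zeroˡ u)) (∙-identityˡ I))
      (trans (⊞-dropˡ (∙-zeroʳ I)) (∙-zeroˡ I))
      (⊞-double (trans (∙-identityʳ u) (sym (∙-identityˡ u))))
      (trans (⊞-dropˡ (∙-zeroʳ u)) (∙-identityˡ I))) (sym (I-blk 1 n)))

  top-∙ : ∀ a b {m n} (A : Mx (a ℕ.+ b) m) (B : Mx m n) → top a b (A ∙ B) ≡ top a b A ∙ B
  top-∙ a b A B = trans (cong (λ x → top a b (x ∙ B)) (sym (vcat-η a b A)))
    (trans (cong (top a b) (vcat-∙ _ _ B)) (top-vcat _ _))

  firstRow≢𝟘 : ∀ {n} {A A′ : Mx (suc n) (suc n)} → A ∙ A′ ≡ I → ¬ (top 1 n A ≡ 𝟘)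
  firstRow≢𝟘 {n} {A} {A′} AA′ z = I₁≢𝟘 (proj₁ (hcat-injective (begin
    hcat I 𝟘            ≡⟨ top-I ⟨
    top 1 n I           ≡⟨ cong (top 1 n) AA′ ⟨
    top 1 n (A ∙ A′)    ≡⟨ top-∙ 1 n A A′ ⟩
    top 1 n A ∙ A′      ≡⟨ cong (_∙ A′) z ⟩
    𝟘 ∙ A′              ≡⟨ ∙-zeroˡ A′ ⟩
    𝟘                   ≡⟨ 𝟘-hcat 1 n ⟩
    hcat 𝟘 𝟘            ∎)))

  ∑-≢𝟘 : ∀ {m n} (N : ℤ) (f : Mx m n → ℤ) → (∀ v (d : Dec (v ≡ 𝟘)) → f v ≡ 𝟙 (¬? d) * N) →
    ∑ f ≡ (∣ Mx m n ∣ - 1ℤ) * N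
  ∑-≢𝟘 N f e = trans (∑-cong (λ v → e v (v ≟ 𝟘))) (trans (∑-*ʳ N _) (cong (_* N) (count-≢ 𝟘)))

  gl : ℕ → ℤ
  gl n = ∑⟨ GL? {n} ⟩ (λ _ → 1ℤ)

  sy : ℕ → ℤ
  sy n = ∑⟨ Sym? {n} ⟩ (λ _ → 1ℤ)

  NAlt? : ∀ {n} (p : Mx n n × Mx n n) → Dec (proj₁ p ∙ proj₂ p ≡ I × Alternating (proj₁ p))
  NAlt? (X , X′) = GL? (X , X′) ×-dec Alternating? X

  al : ℕ → ℤ
  al n = ∑⟨ NAlt? {n} ⟩ (λ _ → 1ℤ)

  module _ (n : ℕ) where

    private
      row? : ∀ v (p : Mx (suc n) (suc n) × Mx (suc n) (suc n)) →
        Dec (proj₁ p ∙ proj₂ p ≡ I × top 1 n (proj₁ p) ≡ v)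
      row? v p = GL? p ×-dec (top 1 n (proj₁ p) ≟ v)

      -- With M invertible of first row v, right multiplication by M⁻¹ carries the invertible
      -- matrices of first row v to those of first row `e₁`.
      row-size : ∀ v (d : Dec (v ≡ 𝟘)) →
        ∑⟨ row? v ⟩ (λ _ → 1ℤ) ≡ 𝟙 (¬? d) * ∑⟨ row? e₁ ⟩ (λ _ → 1ℤ)
      row-size v (yes refl) =
        ∑⟨⟩-empty (row? v) (λ { (A , A′) (AA′ , z) → firstRow≢𝟘 AA′ z }) _
      row-size v (no v≢𝟘) with completeRow v v≢𝟘
      ... | M , M′ , MM′ , refl = trans
        (∑⟨⟩-bij (row? v) (row? e₁)
          (λ (A , A′) → A ∙ M′ , M ∙ A′) (λ (A , A′) → A ∙ M , M′ ∙ A′)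
          (λ { (A , A′) (AA′ , rowA) → ∙-inverse AA′ M′M ,
               trans (top-∙ 1 n A M′) (trans (cong (_∙ M′) rowA) e₁-row) })
          (λ { (A , A′) (AA′ , rowA) → ∙-inverse AA′ MM′ ,
               trans (top-∙ 1 n A M) (trans (cong (_∙ M) (trans rowA (sym top-I)))
                 (trans (sym (top-∙ 1 n I M)) (cong (top 1 n) (∙-identityˡ M)))) })
          (λ _ _ → cong₂ _,_ (∙-cancel-inverseʳ M′M _) (∙-cancel-inverseˡ M′M _))
          (λ _ _ → cong₂ _,_ (∙-cancel-inverseʳ MM′ _) (∙-cancel-inverseˡ MM′ _))
          (λ _ _ → refl))
        (sym (ℤP.*-identityˡ _))
        where
        M′M : M′ ∙ M ≡ I
        M′M = rightInverse⇒leftInverse MM′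
        e₁-row : v ∙ M′ ≡ e₁
        e₁-row = trans (sym (top-∙ 1 n M M′)) (trans (cong (top 1 n) MM′) top-I)

      -- First row `e₁` means A₁₂ = 0 and A₁₁ = 1, which leaves a free column below the corner and
      -- an arbitrary element of GL(n).
      e₁-size : ∑⟨ row? e₁ ⟩ (λ _ → 1ℤ) ≡ ∣ Mx n 1 ∣ * gl n
      e₁-size = begin
        ∑⟨ row? e₁ ⟩ (λ _ → 1ℤ)
          ≡⟨ ∑⟨⟩-iff (row? e₁) (λ p → GL-low? 1 n p ×-dec unit? p)
               (λ { _ (AA′ , e) → (AA′ , trans (cong (right 1 n) e) (right-hcat I 𝟘)) ,
                    trans (cong (left 1 n) e) (left-hcat I 𝟘) })
               (λ { _ ((AA′ , z) , e) → AA′ , trans (sym (hcat-η 1 n _)) (cong₂ hcat e z) }) ⟩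
        ∑⟨ (λ p → GL-low? 1 n p ×-dec unit? p) ⟩ (λ _ → 1ℤ)
          ≡⟨ ∑⟨⟩-refine (GL-low? 1 n) unit? (λ _ → 1ℤ) ⟨
        ∑⟨ GL-low? 1 n ⟩ (λ p → 𝟙 (unit? p) * 1ℤ)
          ≡⟨ ∑-GL-low {1} {n} _ ⟩
        ∑⟨ GL? ⟩ (λ (a , a′) → ∑⟨ GL? ⟩ (λ (d , d′) → ∑ (λ c →
          𝟙 (b₁₁ 1 n 1 n (blk a 𝟘 c d) ≟ I) * 1ℤ)))
          ≡⟨ ∑⟨⟩-cong GL? (λ (a , a′) _ → trans
               (∑⟨⟩-cong GL? (λ (d , d′) _ → trans
                 (∑-cong (λ c → cong (λ x → 𝟙 (x ≟ I) * 1ℤ) (b₁₁-blk a 𝟘 c d)))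
                 (trans (∑-const {X = Mx n 1} (𝟙 (a ≟ I) * 1ℤ))
                   (shuffle ∣ Mx n 1 ∣ (𝟙 (a ≟ I))))))
               (trans (∑⟨⟩-*ˡ GL? (𝟙 (a ≟ I)) (λ _ → ∣ Mx n 1 ∣))
                 (cong (𝟙 (a ≟ I) *_) (trans (∑⟨⟩-const GL? ∣ Mx n 1 ∣) (ℤP.*-comm (gl n) _))))) ⟩
        ∑⟨ GL? ⟩ (λ (a , a′) → 𝟙 (a ≟ I) * (∣ Mx n 1 ∣ * gl n))
          ≡⟨ ∑⟨⟩-refine GL? (λ (a , _) → a ≟ I) (λ _ → ∣ Mx n 1 ∣ * gl n) ⟩
        ∑⟨ (λ (a , a′) → GL? (a , a′) ×-dec (a ≟ I)) ⟩ (λ _ → ∣ Mx n 1 ∣ * gl n)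
          ≡⟨ ∑⟨⟩-iff (λ (a , a′) → GL? (a , a′) ×-dec (a ≟ I)) (_≟ (I {1} , I))
               (λ { (a , a′) (aa′ , refl) → cong (I ,_) (trans (sym (∙-identityˡ a′)) aa′) })
               (λ { _ refl → ∙-identityˡ I , refl }) ⟩
        ∑⟨ (_≟ (I {1} , I)) ⟩ (λ _ → ∣ Mx n 1 ∣ * gl n)
          ≡⟨ sift _ _ ⟩
        ∣ Mx n 1 ∣ * gl n ∎
        where
        unit? : (p : Mx (suc n) (suc n) × Mx (suc n) (suc n)) → Dec (b₁₁ 1 n 1 n (proj₁ p) ≡ I)
        unit? (A , _) = b₁₁ 1 n 1 n A ≟ I
        shuffle : ∀ a b → a * (b * 1ℤ) ≡ b * a
        shuffle = solve-∀

    gl-suc : gl (suc n) ≡ (∣ Mx 1 (suc n) ∣ - 1ℤ) * (∣ Mx n 1 ∣ * gl n)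
    gl-suc = trans (∑⟨⟩-fibres GL? (λ (A , _) → top 1 n A) _)
      (trans (∑-≢𝟘 _ _ row-size) (cong ((∣ Mx 1 (suc n) ∣ - 1ℤ) *_) e₁-size))

  module _ (s : ℕ) where

    private
      n : ℕ
      n = suc s

      row? : ∀ v (p : Mx (suc n) (suc n) × Mx (suc n) (suc n)) →
        Dec ((proj₁ p ∙ proj₂ p ≡ I × Alternating (proj₁ p)) × b₁₂ 1 n 1 n (proj₁ p) ≡ v)
      row? v p = NAlt? p ×-dec (b₁₂ 1 n 1 n (proj₁ p) ≟ v)

      congruent : ∀ {N N′ X X′ : Mx (suc n) (suc n)} → N ∙ N′ ≡ I →
        X ∙ X′ ≡ I × Alternating X →
        (N ᵀ ∙ X ∙ N) ∙ (N′ ∙ (X′ ∙ N′ ᵀ)) ≡ I × Alternating (N ᵀ ∙ X ∙ N)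
      congruent {N} {N′} {X} {X′} NN′ (XX′ , alt) =
        trans (cong₂ _∙_ (∙-assoc (N ᵀ) X N) (sym (∙-assoc N′ X′ _)))
          (∙-inverse (ᵀ-inverse (rightInverse⇒leftInverse NN′)) (∙-inverse XX′ NN′)) ,
        Alternating-congruence N alt

      cancel : ∀ {N N′ : Mx (suc n) (suc n)} → N ∙ N′ ≡ I → (X : Mx (suc n) (suc n)) →
        N ᵀ ∙ (N′ ᵀ ∙ X ∙ N′) ∙ N ≡ X
      cancel {N} {N′} NN′ X = begin
        N ᵀ ∙ (N′ ᵀ ∙ X ∙ N′) ∙ N   ≡⟨ cong (_∙ N) (∙-assoc (N ᵀ) _ N′) ⟨
        N ᵀ ∙ (N′ ᵀ ∙ X) ∙ N′ ∙ N   ≡⟨ ∙-cancel-inverseʳ (rightInverse⇒leftInverse NN′) _ ⟩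
        N ᵀ ∙ (N′ ᵀ ∙ X)
          ≡⟨ ∙-cancel-inverseˡ (ᵀ-inverse (rightInverse⇒leftInverse NN′)) X ⟩
        X                           ∎

      cancel′ : ∀ {N N′ : Mx (suc n) (suc n)} → N′ ∙ N ≡ I → (X : Mx (suc n) (suc n)) →
        N′ ∙ ((N ∙ (X ∙ N ᵀ)) ∙ N′ ᵀ) ≡ X
      cancel′ {N} {N′} N′N X = begin
        N′ ∙ (N ∙ (X ∙ N ᵀ) ∙ N′ ᵀ)   ≡⟨ cong (N′ ∙_) (∙-assoc N _ _) ⟩
        N′ ∙ (N ∙ (X ∙ N ᵀ ∙ N′ ᵀ))   ≡⟨ ∙-cancel-inverseˡ N′N _ ⟩
        X ∙ N ᵀ ∙ N′ ᵀ                ≡⟨ ∙-cancel-inverseʳ (ᵀ-inverse N′N) X ⟩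
        X                             ∎

      border : Mx n n → Mx (suc n) (suc n)
      border M = blk {1} {n} {1} {n} I 𝟘 𝟘 M

      -- Congruence by diag(1, M) acts on the first row beyond its diagonal entry as right
      -- multiplication by M, hence transitively on the nonzero values of that row.
      b₁₂-congruence : ∀ M X → b₁₂ 1 n 1 n (border M ᵀ ∙ X ∙ border M) ≡ b₁₂ 1 n 1 n X ∙ M
      b₁₂-congruence M X = trans (cong (b₁₂ 1 n 1 n)
          (trans (cong₂ (λ x y → x ∙ y ∙ border M) (blk-ᵀ {1} {n} {1} {n} I 𝟘 𝟘 M) (sym (blk-η 1 n 1 n X)))
          (trans (cong (_∙ border M) (blk-∙ {1} {n} {1} {n} {1} {n} (I ᵀ) (𝟘 ᵀ) (𝟘 ᵀ) (M ᵀ)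
                   (b₁₁ 1 n 1 n X) (b₁₂ 1 n 1 n X) (b₂₁ 1 n 1 n X) (b₂₂ 1 n 1 n X)))
                 (blk-∙ {1} {n} {1} {n} {1} {n} _ _ _ _ I 𝟘 𝟘 M))))
        (trans (b₁₂-blk _ _ _ _) (trans (⊞-dropˡ (∙-zeroʳ _)) (cong (_∙ M)
          (trans (⊞-dropʳ (trans (cong (_∙ b₂₂ 1 n 1 n X) ᵀ-𝟘) (∙-zeroˡ _)))
            (trans (cong (_∙ b₁₂ 1 n 1 n X) ᵀ-I) (∙-identityˡ _))))))

      -- The diagonal entry of an alternating matrix is zero, so v = 0 would make the whole first
      -- row vanish. For v nonzero, congruence by diag(1, M⁻¹), with M of first row v, moves v to
      -- `e₁` and preserves both alternation and invertibility.
      row-size : ∀ v (d : Dec (v ≡ 𝟘)) →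
        ∑⟨ row? v ⟩ (λ _ → 1ℤ) ≡ 𝟙 (¬? d) * ∑⟨ row? e₁ ⟩ (λ _ → 1ℤ)
      row-size v (yes refl) = ∑⟨⟩-empty (row? v) (λ { (X , X′) ((XX′ , alt) , z) →
        firstRow≢𝟘 XX′ (trans (sym (hcat-η 1 n _)) (trans
          (cong₂ hcat (Alternating-1×1 (proj₁ (blk-Alternating {1} {n}
            (subst Alternating (sym (blk-η 1 n 1 n X)) alt)))) z)
          (sym (𝟘-hcat 1 n)))) }) _
      row-size v (no v≢𝟘) with completeRow v v≢𝟘
      ... | M , M′ , MM′ , refl = trans
        (∑⟨⟩-bij (row? v) (row? e₁)
          (λ (X , X′) → N′ ᵀ ∙ X ∙ N′ , N ∙ (X′ ∙ N ᵀ))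
          (λ (X , X′) → N ᵀ ∙ X ∙ N , N′ ∙ (X′ ∙ N′ ᵀ))
          (λ { (X , X′) (nalt , row) → congruent N′N nalt ,
               trans (b₁₂-congruence M′ X) (trans (cong (_∙ M′) row) e₁-row) })
          (λ { (X , X′) (nalt , row) → congruent NN′ nalt ,
               trans (b₁₂-congruence M X) (trans (cong (_∙ M) (trans row (sym top-I)))
                 (trans (sym (top-∙ 1 s I M)) (cong (top 1 s) (∙-identityˡ M)))) })
          (λ { (X , X′) _ → cong₂ _,_ (cancel NN′ X) (cancel′ N′N X′) })
          (λ { (X , X′) _ → cong₂ _,_ (cancel N′N X) (cancel′ NN′ X′) })
          (λ _ _ → refl))
        (sym (ℤP.*-identityˡ _))
        where
        N N′ : Mx (suc n) (suc n)
        N = border M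
        N′ = border M′
        diag-∙ : ∀ {A B : Mx n n} → A ∙ B ≡ I → border A ∙ border B ≡ I
        diag-∙ {A} {B} AB = trans (blk-∙ I 𝟘 𝟘 A I 𝟘 𝟘 B) (trans (blk-cong
          (trans (⊞-dropʳ (∙-zeroˡ _)) (∙-identityˡ I))
          (trans (⊞-dropʳ (∙-zeroˡ _)) (∙-zeroʳ I))
          (trans (⊞-dropʳ (∙-zeroʳ A)) (∙-zeroˡ I))
          (trans (⊞-dropˡ (∙-zeroˡ _)) AB)) (sym (I-blk 1 n)))
        NN′ : N ∙ N′ ≡ I
        NN′ = diag-∙ MM′
        N′N : N′ ∙ N ≡ I
        N′N = diag-∙ (rightInverse⇒leftInverse MM′)
        e₁-row : v ∙ M′ ≡ e₁
        e₁-row = trans (sym (top-∙ 1 s M M′)) (trans (cong (top 1 s) MM′) top-I)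

      -- The rows of X are (0 | 1 0), (1 | 0 y), (0 | yᵀ Z); the inverse is found by solving
      -- X (p , q , w) = (α , β , γ) from the first row down.
      hook : Mx 1 s → Mx s s → Mx (suc n) (suc n)
      hook y Z = blk {1} {n} {1} {n} 𝟘 e₁ (e₁ ᵀ) (blk {1} {s} {1} {s} 𝟘 y (y ᵀ) Z)

      hook⁻¹ : Mx 1 s → Mx s s → Mx (suc n) (suc n)
      hook⁻¹ y Z′ = blk {1} {n} {1} {n} (y ∙ (Z′ ∙ y ᵀ)) (hcat {a = 1} {s} I (y ∙ Z′))
        (vcat {1} {s} I (Z′ ∙ y ᵀ)) (blk {1} {s} {1} {s} 𝟘 𝟘 𝟘 Z′)

      e₁ᵀ : e₁ {s} ᵀ ≡ vcat I 𝟘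
      e₁ᵀ = trans (ᵀ-hcat I 𝟘) (cong₂ vcat ᵀ-I ᵀ-𝟘)

      outer : ∀ {m k} (A : Mx m 1) (B : Mx k 1) (C : Mx 1 m) (D : Mx 1 k) →
        vcat A B ∙ hcat C D ≡ blk (A ∙ C) (A ∙ D) (B ∙ C) (B ∙ D)
      outer A B C D = trans (vcat-∙ A B _) (cong₂ vcat (∙-hcat A C D) (∙-hcat B C D))

      hook-inverse : ∀ y {Z Z′} → Z ∙ Z′ ≡ I → hook y Z ∙ hook⁻¹ y Z′ ≡ I
      hook-inverse y {Z} {Z′} ZZ′ = trans (blk-∙ {1} {n} {1} {n} {1} {n} _ _ _ _ _ _ _ _)
        (trans (blk-cong h₁₁ h₁₂ h₂₁ h₂₂) (sym (I-blk 1 n)))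
        where
        T = blk {1} {s} {1} {s} 𝟘 y (y ᵀ) Z
        h₁₁ : 𝟘 ∙ (y ∙ (Z′ ∙ y ᵀ)) ⊞ e₁ ∙ vcat I (Z′ ∙ y ᵀ) ≡ I
        h₁₁ = trans (⊞-dropˡ (∙-zeroˡ _)) (trans (hcat-∙-vcat I 𝟘 I _)
          (trans (⊞-dropʳ (∙-zeroˡ _)) (∙-identityˡ I)))
        h₁₂ : 𝟘 ∙ hcat {a = 1} {s} I (y ∙ Z′) ⊞ e₁ ∙ blk {1} {s} {1} {s} 𝟘 𝟘 𝟘 Z′ ≡ 𝟘
        h₁₂ = trans (⊞-dropˡ (∙-zeroˡ _)) (trans (hcat-∙-vcat I 𝟘 _ _)
          (trans (⊞-dropʳ (∙-zeroˡ _)) (trans (∙-identityˡ _) (sym (𝟘-hcat 1 s)))))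
        h₂₁ : e₁ ᵀ ∙ (y ∙ (Z′ ∙ y ᵀ)) ⊞ T ∙ vcat I (Z′ ∙ y ᵀ) ≡ 𝟘
        h₂₁ = ⊞-double (trans (cong (_∙ (y ∙ (Z′ ∙ y ᵀ))) e₁ᵀ) (trans (vcat-∙ I 𝟘 _) (sym
          (trans (vcat-∙ (hcat 𝟘 y) (hcat (y ᵀ) Z) _) (cong₂ vcat
            (trans (hcat-∙-vcat 𝟘 y I _) (trans (⊞-dropˡ (∙-zeroˡ I)) (sym (∙-identityˡ _))))
            (trans (hcat-∙-vcat (y ᵀ) Z I _)
              (trans (⊞-double (trans (∙-identityʳ (y ᵀ)) (sym (∙-cancel-inverseˡ ZZ′ (y ᵀ)))))
                     (sym (∙-zeroˡ _)))))))))
        h₂₂ : e₁ ᵀ ∙ hcat {a = 1} {s} I (y ∙ Z′) ⊞ T ∙ blk {1} {s} {1} {s} 𝟘 𝟘 𝟘 Z′ ≡ I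
        h₂₂ = trans (cong₂ _⊞_
            (trans (cong (_∙ hcat {a = 1} {s} I (y ∙ Z′)) e₁ᵀ) (trans (outer I 𝟘 I (y ∙ Z′))
              (blk-cong (∙-identityˡ I) (∙-identityˡ _) (∙-zeroˡ I) (∙-zeroˡ _))))
            (trans (blk-∙ 𝟘 y (y ᵀ) Z 𝟘 𝟘 𝟘 Z′) (blk-cong
              (trans (⊞-dropˡ (∙-zeroˡ _)) (∙-zeroʳ y)) (⊞-dropˡ (∙-zeroˡ _))
              (trans (⊞-dropˡ (∙-zeroʳ _)) (∙-zeroʳ Z)) (trans (⊞-dropˡ (∙-zeroʳ _)) ZZ′))))
          (trans (blk-⊞ _ _ _ _ _ _ _ _) (trans (blk-cong
            (⊞-identityʳ I) (⊞-double refl) (⊞-identityˡ 𝟘) (⊞-identityˡ I)) (sym (I-blk 1 s))))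

      -- The upper right block of the product forces the row (d u) to vanish. With u = 0 the lower
      -- right corner reduces to Z w = 1, so Z inherits invertibility from the whole matrix.
      hook-blocks : ∀ {y Z a b c d u v w} →
        hook y Z ∙ blk {1} {n} {1} {n} a b c (blk {1} {s} {1} {s} d u v w) ≡ I → Z ∙ w ≡ I
      hook-blocks {y} {Z} {a} {b} {c} {d} {u} {v} {w} e
        with blk-injective {1} {n} {1} {n}
               (trans (sym (blk-∙ {1} {n} {1} {n} {1} {n} _ _ _ _ a b c _)) (trans e (I-blk 1 n)))
      ... | _ , e₁₂ , _ , e₂₂ = trans (sym (⊞-dropˡ (trans (cong (y ᵀ ∙_) u≡𝟘) (∙-zeroʳ _)))) yu+Zw
        where
        u≡𝟘 : u ≡ 𝟘
        u≡𝟘 = proj₂ (hcat-injective {a = 1} (begin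
          hcat d u                                   ≡⟨ ∙-identityˡ _ ⟨
          I ∙ hcat d u                               ≡⟨ ⊞-dropʳ (∙-zeroˡ _) ⟨
          I ∙ hcat d u ⊞ 𝟘 ∙ hcat v w                ≡⟨ hcat-∙-vcat I 𝟘 _ _ ⟨
          e₁ ∙ blk d u v w                           ≡⟨ ⊞-dropˡ (∙-zeroˡ b) ⟨
          𝟘 ∙ b ⊞ e₁ ∙ blk d u v w                   ≡⟨ e₁₂ ⟩
          𝟘                                          ≡⟨ 𝟘-hcat 1 s ⟩
          hcat 𝟘 𝟘                                   ∎))
        b≡ : hcat {a = 1} {s} (left 1 s b) (right 1 s b) ≡ b
        b≡ = hcat-η 1 s b
        yu+Zw : y ᵀ ∙ u ⊞ Z ∙ w ≡ I
        yu+Zw = trans (sym (⊞-dropˡ (∙-zeroˡ (right 1 s b)))) (proj₂ (proj₂ (proj₂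
          (blk-injective {1} {s} {1} {s} (begin
            blk _ _ _ (𝟘 ∙ right 1 s b ⊞ (y ᵀ ∙ u ⊞ Z ∙ w))
              ≡⟨ blk-⊞ _ _ _ _ _ _ _ _ ⟨
            _ ≡⟨ cong₂ _⊞_ (trans (cong₂ _∙_ e₁ᵀ (sym b≡)) (outer I 𝟘 _ _)) (blk-∙ 𝟘 y (y ᵀ) Z d u v w) ⟨
            e₁ ᵀ ∙ b ⊞ blk 𝟘 y (y ᵀ) Z ∙ blk d u v w
              ≡⟨ e₂₂ ⟩
            I ≡⟨ I-blk 1 s ⟩
            blk I 𝟘 𝟘 I ∎)))))

      -- Once the first row is (0 | 1 0), alternation prescribes the first column and the next
      -- diagonal entry: what remains is a free row y and a nonsingular alternating Z.
      e₁-size : ∑⟨ row? e₁ ⟩ (λ _ → 1ℤ) ≡ ∣ Mx 1 s ∣ * al s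
      e₁-size = trans
        (∑⟨⟩-bij (row? e₁) Q?
          (λ (X , X′) → right 1 s (top 1 s (b₂₂ 1 n 1 n X)) ,
                        b₂₂ 1 s 1 s (b₂₂ 1 n 1 n X) , b₂₂ 1 s 1 s (b₂₂ 1 n 1 n X′))
          (λ (y , Z , Z′) → hook y Z , hook⁻¹ y Z′)
          (λ { (X , X′) ((XX′ , alt) , row) → invertible X X′ XX′ alt row , proj₂ (normal X alt row) })
          (λ { (y , Z , Z′) (ZZ′ , alt) → (hook-inverse y ZZ′ , Alternating-blk {1} {n} Alternating-𝟘 refl
               (Alternating-blk {1} {s} Alternating-𝟘 refl alt)) , b₁₂-blk {1} {n} {1} {n} _ _ _ _ })
          (λ { (X , X′) ((XX′ , alt) , row) → cong₂ _,_ (sym (proj₁ (normal X alt row)))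
               (inverse-unique (hook-inverse _ (invertible X X′ XX′ alt row))
                 (trans (cong (_∙ X′) (sym (proj₁ (normal X alt row)))) XX′)) })
          (λ { (y , Z , Z′) _ → cong₂ _,_
               (trans (cong (b₁₂ 1 s 1 s) (b₂₂-blk {1} {n} {1} {n} _ _ _ _)) (b₁₂-blk _ _ _ _))
               (cong₂ _,_
                 (trans (cong (b₂₂ 1 s 1 s) (b₂₂-blk {1} {n} {1} {n} _ _ _ _)) (b₂₂-blk _ _ _ _))
                 (trans (cong (b₂₂ 1 s 1 s) (b₂₂-blk {1} {n} {1} {n} _ _ _ _)) (b₂₂-blk _ _ _ _))) })
          (λ _ _ → refl))
        (trans (∑⟨⟩-× Q? (λ _ → yes tt) (λ _ → NAlt?) (λ _ _ h → tt , h) (λ _ _ _ h → h) _)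
          (trans (∑-cong (λ _ → ℤP.*-identityˡ _)) (∑-const {X = Mx 1 s} (al s))))
        where
        Q? : (x : Mx 1 s × Mx s s × Mx s s) →
          Dec (proj₁ (proj₂ x) ∙ proj₂ (proj₂ x) ≡ I × Alternating (proj₁ (proj₂ x)))
        Q? (_ , p) = NAlt? p
        normal : ∀ X → Alternating X → b₁₂ 1 n 1 n X ≡ e₁ →
          X ≡ hook (right 1 s (top 1 s (b₂₂ 1 n 1 n X))) (b₂₂ 1 s 1 s (b₂₂ 1 n 1 n X)) ×
          Alternating (b₂₂ 1 s 1 s (b₂₂ 1 n 1 n X))
        normal X alt row
          with blk-Alternating {1} {n} (subst Alternating (sym (blk-η 1 n 1 n X)) alt)
        ... | x , z , w with blk-Alternating {1} {s} (subst Alternating (sym (blk-η 1 s 1 s _)) w)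
        ...   | x′ , z′ , w′ =
          trans (sym (blk-η 1 n 1 n X)) (blk-cong (Alternating-1×1 x) row (trans z (cong _ᵀ row))
            (trans (sym (blk-η 1 s 1 s _)) (blk-cong (Alternating-1×1 x′) refl z′ refl))) , w′
        invertible : ∀ X X′ → X ∙ X′ ≡ I → Alternating X → b₁₂ 1 n 1 n X ≡ e₁ →
          b₂₂ 1 s 1 s (b₂₂ 1 n 1 n X) ∙ b₂₂ 1 s 1 s (b₂₂ 1 n 1 n X′) ≡ I
        invertible X X′ XX′ alt row = hook-blocks (trans
          (cong₂ _∙_ (sym (proj₁ (normal X alt row)))
            (trans (blk-cong refl refl refl (blk-η 1 s 1 s _)) (blk-η 1 n 1 n X′))) XX′)

    al-suc : al (suc (suc s)) ≡ (∣ Mx 1 (suc s) ∣ - 1ℤ) * (∣ Mx 1 s ∣ * al s)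
    al-suc = trans (∑⟨⟩-fibres NAlt? (λ (X , _) → b₁₂ 1 n 1 n X) _)
      (trans (∑-≢𝟘 _ _ row-size) (cong ((∣ Mx 1 n ∣ - 1ℤ) *_) e₁-size))

-- Characteristic 2 and orthogonality of characters

module CharacterSums {r} (𝔽 : FiniteField r) (χ : FiniteField.AddChar 𝔽)
  (nontrivial : FiniteField.Nontrivial 𝔽 χ) where

  open import Data.Integer using (_+_; _*_; _-_)
  open FiniteSums
  open Matrices 𝔽
  open SiegelParabolic 𝔽

  open AddChar χ public

  private
    abs≡1⇒square : ∀ i → ℤ.∣ i ∣ ≡ 1 → i * i ≡ 1ℤ
    abs≡1⇒square (+ .1)          refl = refl
    abs≡1⇒square (ℤ.-[1+ .zero ]) refl = refl

    -- Since ψ x ψ(-x) = ψ 0 = 1, the value ψ x is a unit of ℤ, hence 1 or -1.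
    ψ-square : ∀ x → ψ x * ψ x ≡ 1ℤ
    ψ-square x = abs≡1⇒square (ψ x) (ℕP.m*n≡1⇒m≡1 _ ℤ.∣ ψ (-ᶠ x) ∣
      (trans (sym (ℤP.abs-* (ψ x) (ψ (-ᶠ x)))) (cong ℤ.∣_∣ (begin
        ψ x * ψ (-ᶠ x) ≡⟨ ψ-hom x (-ᶠ x) ⟨
        ψ (x +ᶠ -ᶠ x)    ≡⟨ cong ψ (Fᴿ.-‿inverseʳ x) ⟩
        ψ 0#             ≡⟨ ψ-0 ⟩
        1ℤ               ∎))))

  -- If 2 were invertible, ψ x would be the square of ψ (x/2) = ±1 for every x.
  char2 : ∀ x → x +ᶠ x ≡ 0#
  char2 x with 1# +ᶠ 1# ≟ 0#
  ... | yes 2≡0 = begin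
    x +ᶠ x              ≡⟨ cong₂ _+ᶠ_ (Fᴿ.*-identityˡ x) (Fᴿ.*-identityˡ x) ⟨
    1# *ᶠ x +ᶠ 1# *ᶠ x  ≡⟨ Fᴿ.distribʳ x 1# 1# ⟨
    (1# +ᶠ 1#) *ᶠ x     ≡⟨ cong (_*ᶠ x) 2≡0 ⟩
    0# *ᶠ x             ≡⟨ Fᴿ.zeroˡ x ⟩
    0#                  ∎
  ... | no 2≢0 = contradiction trivial (proj₂ nontrivial)
    where
    y half : F
    y = proj₁ nontrivial
    half = (1# +ᶠ 1#) ⁻¹ᶠ *ᶠ y
    double : half +ᶠ half ≡ y
    double = begin
      half +ᶠ half                               ≡⟨ cong₂ _+ᶠ_ (Fᴿ.*-identityˡ half) (Fᴿ.*-identityˡ half) ⟨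
      1# *ᶠ half +ᶠ 1# *ᶠ half                   ≡⟨ Fᴿ.distribʳ half 1# 1# ⟨
      (1# +ᶠ 1#) *ᶠ ((1# +ᶠ 1#) ⁻¹ᶠ *ᶠ y)        ≡⟨ Fᴿ.*-assoc _ _ y ⟨
      (1# +ᶠ 1#) *ᶠ (1# +ᶠ 1#) ⁻¹ᶠ *ᶠ y          ≡⟨ cong (_*ᶠ y) (⁻¹-inverse _ 2≢0) ⟩
      1# *ᶠ y                                    ≡⟨ Fᴿ.*-identityˡ y ⟩
      y                                          ∎
    trivial : ψ y ≡ 1ℤ
    trivial = trans (cong ψ (sym double)) (trans (ψ-hom half half) (ψ-square half))

  open BlockSums 𝔽 char2
  open Orders 𝔽 char2

  -- If L v₁ = c with ψ c ≠ 1, translation by v₁ multiplies the sum by ψ c, so the sum vanishes.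
  module Orthogonality {X : Set} {{_ : Finite X}} {V : X → Set} (V? : ∀ v → Dec (V v))
    (_⊕_ : X → X → X) (_⊙_ : F → X → X)
    (V-⊕ : ∀ {v w} → V v → V w → V (v ⊕ w)) (V-⊙ : ∀ c {v} → V v → V (c ⊙ v))
    (⊕-involutive : ∀ v w → v ⊕ (v ⊕ w) ≡ w)
    (L : X → F) (L-⊕ : ∀ v w → L (v ⊕ w) ≡ L v +ᶠ L w) (L-⊙ : ∀ c v → L (c ⊙ v) ≡ c *ᶠ L v)
    where

    private
      S : ℤ
      S = ∑⟨ V? ⟩ (λ v → ψ (L v))

      vanishes : ∀ v → V v → ¬ (L v ≡ 0#) → S ≡ 0ℤ
      vanishes v v∈V Lv≢0 with S ≟ᶻ 0ℤ where open ℤP renaming (_≟_ to _≟ᶻ_)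
      ... | yes S≡0 = S≡0
      ... | no S≢0 = contradiction ψc≡1 (proj₂ nontrivial)
        where
        c : F
        c = proj₁ nontrivial
        v₁ : X
        v₁ = (c *ᶠ L v ⁻¹ᶠ) ⊙ v
        Lv₁ : L v₁ ≡ c
        Lv₁ = begin
          L v₁                       ≡⟨ L-⊙ _ v ⟩
          c *ᶠ L v ⁻¹ᶠ *ᶠ L v        ≡⟨ Fᴿ.*-assoc c _ _ ⟩
          c *ᶠ (L v ⁻¹ᶠ *ᶠ L v)
            ≡⟨ cong (c *ᶠ_) (trans (Fᴿ.*-comm _ _) (⁻¹-inverse _ Lv≢0)) ⟩
          c *ᶠ 1#                    ≡⟨ Fᴿ.*-identityʳ c ⟩
          c                          ∎
        scaled : S ≡ ψ c * S
        scaled = trans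
          (∑⟨⟩-bij V? V? (v₁ ⊕_) (v₁ ⊕_) (λ _ → V-⊕ (V-⊙ _ v∈V)) (λ _ → V-⊕ (V-⊙ _ v∈V))
            (λ w _ → ⊕-involutive v₁ w) (λ w _ → ⊕-involutive v₁ w)
            (λ w _ → trans (cong ψ (trans (L-⊕ v₁ w) (cong (_+ᶠ L w) Lv₁))) (ψ-hom c (L w))))
          (∑⟨⟩-*ˡ V? (ψ c) (λ v → ψ (L v)))
        ψc≡1 : ψ c ≡ 1ℤ
        ψc≡1 = ℤP.*-cancelʳ-≡ (ψ c) 1ℤ S {{ℤ.≢-nonZero S≢0}}
          (trans (sym scaled) (sym (ℤP.*-identityˡ S)))

    orthogonality : (d : Dec (∀ v → V v → L v ≡ 0#)) →
      ∑⟨ V? ⟩ (λ v → ψ (L v)) ≡ 𝟙 d * ∑⟨ V? ⟩ (λ _ → 1ℤ)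
    orthogonality (yes h) = trans (∑⟨⟩-cong V? (λ v v∈V → trans (cong ψ (h v v∈V)) ψ-0))
      (sym (ℤP.*-identityˡ _))
    orthogonality (no ¬h) with ∃? (λ v → V? v ×-dec ¬? (L v ≟ 0#))
    ... | yes (v , v∈V , Lv≢0) = trans (vanishes v v∈V Lv≢0) (sym (ℤP.*-zeroˡ (∑⟨ V? ⟩ (λ _ → 1ℤ))))
    ... | no ¬∃ = contradiction
      (λ v v∈V → decidable-stable (L v ≟ 0#) (λ Lv≢0 → ¬∃ (v , v∈V , Lv≢0))) ¬h

  everything? : {X : Set} → X → Dec ⊤
  everything? _ = yes tt

  ∑⟨everything⟩ : {X : Set} {{_ : Finite X}} (f : X → ℤ) → ∑⟨ everything? ⟩ f ≡ ∑ f
  ∑⟨everything⟩ f = ∑-cong (λ x → ℤP.*-identityˡ (f x))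

  ⊞-involutive : ∀ {m n} (A B : Mx m n) → A ⊞ (A ⊞ B) ≡ B
  ⊞-involutive A B = trans (sym (⊞-assoc A A B)) (⊞-dropˡ (⊞-self char2 A))

  ∑-ψ-tr : ∀ {m n} (b : Mx m n) → ∑ (λ g → ψ (tr (b ∙ g))) ≡ 𝟙 (b ≟ 𝟘) * ∣ Mx n m ∣
  ∑-ψ-tr {m} {n} b = begin
    ∑ (λ g → ψ (tr (b ∙ g)))
      ≡⟨ ∑⟨everything⟩ _ ⟨
    ∑⟨ everything? ⟩ (λ g → ψ (tr (b ∙ g)))
      ≡⟨ orthogonality zero? ⟩
    𝟙 zero? * ∑⟨ everything? {Mx n m} ⟩ (λ _ → 1ℤ)
      ≡⟨ cong₂ _*_ (𝟙-cong zero? (b ≟ 𝟘) (λ h → tr-nondegenerate b (λ g → h g tt))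
           (λ { refl g _ → trans (cong tr (∙-zeroˡ g)) (tr-𝟘 m) })) (∑⟨everything⟩ {Mx n m} _) ⟩
    𝟙 (b ≟ 𝟘) * ∣ Mx n m ∣ ∎
    where
    open Orthogonality {Mx n m} everything? _⊞_ _·_ (λ _ _ → tt) (λ _ _ → tt) ⊞-involutive
      (λ g → tr (b ∙ g)) (λ v w → trans (cong tr (∙-distribˡ-⊞ b v w)) (tr-⊞ _ _))
      (λ c v → trans (cong tr (∙-·ʳ c b v)) (tr-· c _))
    zero? : Dec (∀ g → ⊤ → tr (b ∙ g) ≡ 0#)
    zero? = ∀? (λ g → everything? g →-dec (tr (b ∙ g) ≟ 0#))

  ∑-ψ-tr-Sym : ∀ {n} (a : Mx n n) →
    ∑⟨ Sym? ⟩ (λ e → ψ (tr (a ∙ e))) ≡ 𝟙 (Alternating? a) * sy n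
  ∑-ψ-tr-Sym {n} a = orthogonality (Alternating? a)
    where
    open Orthogonality {Mx n n} Sym? _⊞_ _·_
      (λ {v} {w} hv hw → trans (ᵀ-⊞ v w) (cong₂ _⊞_ hv hw))
      (λ c {v} h → trans (ᵀ-· c v) (cong (c ·_) h)) ⊞-involutive
      (λ g → tr (a ∙ g)) (λ v w → trans (cong tr (∙-distribˡ-⊞ a v w)) (tr-⊞ _ _))
      (λ c v → trans (cong tr (∙-·ʳ c a v)) (tr-· c _))

  ∑-ψ-* : ∀ e → ∑ (λ x → ψ (x *ᶠ e)) ≡ 𝟙 (e ≟ 0#) * ∣ F ∣
  ∑-ψ-* e = begin
    ∑ (λ x → ψ (x *ᶠ e))
      ≡⟨ ∑⟨everything⟩ _ ⟨
    ∑⟨ everything? ⟩ (λ x → ψ (x *ᶠ e))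
      ≡⟨ orthogonality zero? ⟩
    𝟙 zero? * ∑⟨ everything? {F} ⟩ (λ _ → 1ℤ)
      ≡⟨ cong₂ _*_ (𝟙-cong zero? (e ≟ 0#) (λ h → trans (sym (Fᴿ.*-identityˡ e)) (h 1# tt))
           (λ { refl x _ → Fᴿ.zeroʳ x })) (∑⟨everything⟩ {F} _) ⟩
    𝟙 (e ≟ 0#) * ∣ F ∣ ∎
    where
    open Orthogonality {F} everything? _+ᶠ_ _*ᶠ_ (λ _ _ → tt) (λ _ _ → tt)
      (λ v w → trans (sym (Fᴿ.+-assoc v v w)) (trans (cong (_+ᶠ w) (char2 v)) (Fᴿ.+-identityˡ w)))
      (λ x → x *ᶠ e) (λ v w → Fᴿ.distribʳ e v w) (λ c v → Fᴿ.*-assoc c v e)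
    zero? : Dec (∀ x → ⊤ → x *ᶠ e ≡ 0#)
    zero? = ∀? (λ x → everything? x →-dec (x *ᶠ e ≟ 0#))

-- The character sum over PσP in terms of group orders and K_{GL(t)}

module DoubleCosetSums {r} (𝔽 : FiniteField r) (χ : FiniteField.AddChar 𝔽)
  (nontrivial : FiniteField.Nontrivial 𝔽 χ) where

  open import Data.Integer using (_+_; _*_; _-_)
  open FiniteSums
  open Matrices 𝔽
  open DoubleCosets 𝔽
  open SiegelParabolic 𝔽
  open WeylElement 𝔽
  open CharacterSums 𝔽 χ nontrivial
  open BlockSums 𝔽 char2
  open Orders 𝔽 char2

  ∑-const³ : ∀ {X Y Z : Set} {{_ : Finite X}} {{_ : Finite Y}} {{_ : Finite Z}}
    {P : X → Set} (P? : ∀ x → Dec (P x)) {Q : Z → Set} (Q? : ∀ z → Dec (Q z)) (f : X → ℤ) →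
    ∑⟨ P? ⟩ (λ x → ∑ {Y} (λ _ → ∑⟨ Q? ⟩ (λ _ → f x))) ≡ ∑⟨ P? ⟩ f * (∣ Y ∣ * ∑⟨ Q? ⟩ (λ _ → 1ℤ))
  ∑-const³ {Y = Y} P? Q? f = trans
    (∑⟨⟩-cong P? (λ x _ → trans (∑-const {Y} _)
      (trans (cong (∣ Y ∣ *_) (∑⟨⟩-const Q? (f x)))
        (shuffle (∣ Y ∣) (∑⟨ Q? ⟩ (λ _ → 1ℤ)) (f x)))))
    (∑⟨⟩-*ʳ P? _ f)
    where
    shuffle : ∀ a b c → a * (b * c) ≡ c * (a * b)
    shuffle = solve-∀

  sy-+ : ∀ s t → sy (s ℕ.+ t) ≡ sy s * (∣ Mx t s ∣ * sy t)
  sy-+ s t = trans (∑-Sym {s} {t} (λ _ → 1ℤ)) (∑-const³ {Y = Mx t s} Sym? Sym? (λ _ → 1ℤ))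

  -- K_{GL(t)}(ψ;1), summed over pairs of a matrix and its inverse.
  KG : ℕ → ℤ
  KG t = ∑⟨ GL? {t} ⟩ (λ (d , d′) → ψ (tr d +ᶠ tr d′))

  module _ (s t : ℕ) where

    private
      n : ℕ
      n = s ℕ.+ t

      m : ℤ
      m = ∣ Mx t s ∣

    open DoubleCosetSum (Parabolic? {n}) (Parabolic-∙ {n}) (symplecticInverse {n})
      (Parabolic-inverse {n}) (∙-symplecticInverse {n} ∘ proj₁) (σᵇ s t) (σᵇ-involutive s t)

    private
      -- Only the lower left block (ae + bg, b; ᵗb′, 0) of the conjugate has to be examined. Once b
      -- = 0, the block a is invertible and b′ = 0, so the condition left is ae = 0, that is, e = 0.
      conjugate-Parabolic⇔ : ∀ {A A′ B : Mx n n} → A ∙ A′ ≡ I → B ᵀ ≡ B →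
        Parabolic {n} (σᵇ s t ∙ siegel A A′ B ∙ σᵇ s t) ⇔ (b₁₂ s t s t A ≡ 𝟘 × b₁₁ s t s t B ≡ 𝟘)
      conjugate-Parabolic⇔ {A} {A′} {B} AA′ symB = mk⇔ to from
        where
        a = b₁₁ s t s t A
        b = b₁₂ s t s t A
        c = b₂₁ s t s t A
        d = b₂₂ s t s t A
        a′ = b₁₁ s t s t A′
        b′ = b₁₂ s t s t A′
        e = b₁₁ s t s t B
        g = b₂₁ s t s t B
        lower-left : b₂₁ n n n n (σᵇ s t ∙ siegel A A′ B ∙ σᵇ s t) ≡ blk (a ∙ e ⊞ b ∙ g) b (b′ ᵀ) 𝟘
        lower-left = trans
          (cong (b₂₁ n n n n) (cong (λ p → σᵇ s t ∙ p ∙ σᵇ s t) (sym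
            (trans (cong (λ x → siegel x _ _) (blk-η s t s t A))
            (trans (cong (λ x → siegel A x _) (blk-η s t s t A′)) (cong (siegel A A′) (blk-η s t s t B)))))))
          (b₂₁-conjugate s t)
        low : b ≡ 𝟘 → a ∙ a′ ≡ I × b′ ≡ 𝟘 × _
        low z = low-blocks {c = c} {d = d} (trans (cong₂ _∙_
          (trans (blk-cong refl (sym z) refl refl) (blk-η s t s t A)) (blk-η s t s t A′)) AA′)
        ae+bg : b ≡ 𝟘 → a ∙ e ⊞ b ∙ g ≡ a ∙ e
        ae+bg z = ⊞-dropʳ (trans (cong (_∙ g) z) (∙-zeroˡ g))
        to : Parabolic {n} (σᵇ s t ∙ siegel A A′ B ∙ σᵇ s t) → b ≡ 𝟘 × e ≡ 𝟘
        to (_ , z) with blk-injective (trans (sym lower-left) (trans z (𝟘-blk s t s t)))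
        ... | ae , b≡𝟘 , _ = b≡𝟘 , trans
          (sym (∙-cancel-inverseˡ (rightInverse⇒leftInverse (proj₁ (low b≡𝟘))) e))
          (trans (cong (a′ ∙_) (trans (sym (ae+bg b≡𝟘)) ae)) (∙-zeroʳ a′))
        from : b ≡ 𝟘 × e ≡ 𝟘 → Parabolic {n} (σᵇ s t ∙ siegel A A′ B ∙ σᵇ s t)
        from (b≡𝟘 , e≡𝟘) =
          Symplectic-∙ (Symplectic-∙ (σᵇ-Symplectic s t) (proj₁ (siegel-Parabolic char2 AA′ symB)))
            (σᵇ-Symplectic s t) ,
          trans lower-left (trans (blk-cong
            (trans (ae+bg b≡𝟘) (trans (cong (a ∙_) e≡𝟘) (∙-zeroʳ a))) b≡𝟘
            (trans (cong _ᵀ (proj₁ (proj₂ (low b≡𝟘)))) ᵀ-𝟘) refl) (sym (𝟘-blk s t s t)))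

      corner-Sym : ∑⟨ Sym? ⟩ (λ B → 𝟙 (b₁₁ s t s t B ≟ 𝟘)) ≡ m * sy t
      corner-Sym = begin
        ∑⟨ Sym? ⟩ (λ B → 𝟙 (b₁₁ s t s t B ≟ 𝟘))
          ≡⟨ ∑-Sym {s} {t} _ ⟩
        ∑⟨ Sym? ⟩ (λ e → ∑ (λ g → ∑⟨ Sym? ⟩ (λ h → 𝟙 (b₁₁ s t s t (blk e (g ᵀ) g h) ≟ 𝟘))))
          ≡⟨ ∑⟨⟩-cong Sym? (λ e _ → ∑-cong (λ g → ∑⟨⟩-cong Sym? (λ h _ →
               cong (λ x → 𝟙 (x ≟ 𝟘)) (b₁₁-blk e (g ᵀ) g h)))) ⟩
        ∑⟨ Sym? ⟩ (λ e → ∑ {Mx t s} (λ _ → ∑⟨ Sym? {t} ⟩ (λ _ → 𝟙 (e ≟ 𝟘))))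
          ≡⟨ ∑-const³ {Y = Mx t s} Sym? Sym? (λ e → 𝟙 (e ≟ 𝟘)) ⟩
        ∑⟨ Sym? ⟩ (λ e → 𝟙 (e ≟ 𝟘)) * (m * sy t)
          ≡⟨ cong (_* (m * sy t)) (trans
               (∑-cong (λ e → ℤP.*-comm (𝟙 (Sym? e)) (𝟙 (e ≟ 𝟘)))) (trans (sift 𝟘 (𝟙 ∘ Sym?))
               (𝟙-yes (Sym? 𝟘) ᵀ-𝟘))) ⟩
        1ℤ * (m * sy t)
          ≡⟨ ℤP.*-identityˡ _ ⟩
        m * sy t ∎

      low-sum : (f : Mx s s → ℤ) (g : Mx t t × Mx t t → ℤ) →
        ∑⟨ GL-low? s t ⟩ (λ (A , A′) → f (b₁₁ s t s t A) * g (b₂₂ s t s t A , b₂₂ s t s t A′)) ≡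
        ∑⟨ GL? ⟩ (λ (a , _) → f a) * (∑⟨ GL? ⟩ g * m)
      low-sum f g = trans (∑-GL-low {s} {t} _) (trans
        (∑⟨⟩-cong GL? (λ (a , a′) _ → trans
          (∑⟨⟩-cong GL? (λ (d , d′) _ → trans
            (∑-cong (λ c → cong₂ (λ x y → f x * g y) (b₁₁-blk a 𝟘 c d)
              (cong₂ _,_ (b₂₂-blk a 𝟘 c d) (b₂₂-blk a′ 𝟘 _ d′))))
            (trans (∑-const {Mx t s} _) (shuffle m (f a) (g (d , d′))))))
          (trans (∑⟨⟩-*ˡ GL? (f a) (λ d → g d * m)) (cong (f a *_) (∑⟨⟩-*ʳ GL? m g)))))
        (∑⟨⟩-*ʳ GL? (∑⟨ GL? ⟩ g * m) (λ (a , _) → f a)))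
        where
        shuffle : ∀ a b c → a * (b * c) ≡ b * (c * a)
        shuffle = solve-∀

      H-size : ∑⟨ H? ⟩ (λ _ → 1ℤ) ≡ gl s * (gl t * m) * (m * sy t)
      H-size = begin
        ∑⟨ H? ⟩ (λ _ → 1ℤ)
          ≡⟨ ∑⟨⟩-refine Parabolic? (λ p → Parabolic? (σᵇ s t ∙ p ∙ σᵇ s t)) (λ _ → 1ℤ) ⟨
        ∑⟨ Parabolic? {n} ⟩ (λ p → 𝟙 (Parabolic? {n} (σᵇ s t ∙ p ∙ σᵇ s t)) * 1ℤ)
          ≡⟨ ∑-Parabolic char2 {n} _ ⟩
        ∑⟨ GL? ⟩ (λ (A , A′) → ∑⟨ Sym? ⟩ (λ B →
          𝟙 (Parabolic? {n} (σᵇ s t ∙ siegel A A′ B ∙ σᵇ s t)) * 1ℤ))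
          ≡⟨ ∑⟨⟩-cong GL? (λ (A , A′) AA′ → trans (∑⟨⟩-cong Sym? (λ B symB →
               trans (ℤP.*-identityʳ (𝟙 (Parabolic? {n} (σᵇ s t ∙ siegel A A′ B ∙ σᵇ s t)))) (trans
                 (𝟙-cong (Parabolic? {n} (σᵇ s t ∙ siegel A A′ B ∙ σᵇ s t))
                   ((b₁₂ s t s t A ≟ 𝟘) ×-dec (b₁₁ s t s t B ≟ 𝟘))
                   (Equivalence.to (conjugate-Parabolic⇔ AA′ symB))
                   (Equivalence.from (conjugate-Parabolic⇔ AA′ symB)))
                 (𝟙-× (b₁₂ s t s t A ≟ 𝟘) (b₁₁ s t s t B ≟ 𝟘)))))
               (trans (∑⟨⟩-*ˡ Sym? (𝟙 (b₁₂ s t s t A ≟ 𝟘)) (λ B → 𝟙 (b₁₁ s t s t B ≟ 𝟘)))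
                      (cong (𝟙 (b₁₂ s t s t A ≟ 𝟘) *_) corner-Sym))) ⟩
        ∑⟨ GL? ⟩ (λ (A , _) → 𝟙 (b₁₂ s t s t A ≟ 𝟘) * (m * sy t))
          ≡⟨ ∑⟨⟩-refine GL? (λ (A , _) → b₁₂ s t s t A ≟ 𝟘) _ ⟩
        ∑⟨ GL-low? s t ⟩ (λ _ → m * sy t)
          ≡⟨ ∑⟨⟩-const (GL-low? s t) _ ⟩
        ∑⟨ GL-low? s t ⟩ (λ _ → 1ℤ * 1ℤ) * (m * sy t)
          ≡⟨ cong (_* (m * sy t)) (low-sum (λ _ → 1ℤ) (λ _ → 1ℤ)) ⟩
        gl s * (gl t * m) * (m * sy t) ∎

      P-size : ∑⟨ Parabolic? {n} ⟩ (λ _ → 1ℤ) ≡ gl n * sy n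
      P-size = trans (∑-Parabolic char2 {n} (λ _ → 1ℤ)) (∑⟨⟩-const GL? (sy n))

      -- The three blocks of B act separately: summing over the unrestricted g forces b = 0, summing
      -- over symmetric e forces a alternating, and h does not occur in the trace and contributes
      -- `sy t`.
      inner-sum : ∀ A A′ → ∑⟨ Sym? ⟩ (λ B → ψ (tr (siegel A A′ B ∙ σᵇ s t))) ≡
        𝟙 (b₁₂ s t s t A ≟ 𝟘) * (𝟙 (Alternating? (b₁₁ s t s t A)) *
          ψ (tr (b₂₂ s t s t A) +ᶠ tr (b₂₂ s t s t A′)) * (sy s * (m * sy t)))
      inner-sum A A′ = begin
        ∑⟨ Sym? ⟩ (λ B → ψ (tr (siegel A A′ B ∙ σᵇ s t)))
          ≡⟨ ∑-Sym {s} {t} _ ⟩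
        ∑⟨ Sym? ⟩ (λ e → ∑ (λ g → ∑⟨ Sym? ⟩ (λ h → ψ (tr (siegel A A′ (blk e (g ᵀ) g h) ∙ σᵇ s t)))))
          ≡⟨ ∑⟨⟩-cong Sym? (λ e _ → trans (∑-cong (λ g → trans
               (∑⟨⟩-cong Sym? (λ h _ → term e g h)) (∑⟨⟩-const Sym? _)))
               (trans (∑-*ˡ (sy t) (λ g → ψ₀ * ψ (tr (a ∙ e)) * ψ (tr (b ∙ g)))) (cong (sy t *_) (trans (∑-*ˡ (ψ₀ * ψ (tr (a ∙ e))) (λ g → ψ (tr (b ∙ g))))
                 (cong (ψ₀ * ψ (tr (a ∙ e)) *_) (∑-ψ-tr b)))))) ⟩
        ∑⟨ Sym? ⟩ (λ e → sy t * (ψ₀ * ψ (tr (a ∙ e)) * (𝟙 (b ≟ 𝟘) * m)))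
          ≡⟨ ∑⟨⟩-cong Sym? (λ e _ → shuffle₁ (sy t) ψ₀ (ψ (tr (a ∙ e))) (𝟙 (b ≟ 𝟘)) m) ⟩
        ∑⟨ Sym? ⟩ (λ e → 𝟙 (b ≟ 𝟘) * ψ₀ * (m * sy t) * ψ (tr (a ∙ e)))
          ≡⟨ trans (∑⟨⟩-*ˡ Sym? (𝟙 (b ≟ 𝟘) * ψ₀ * (m * sy t)) (λ e → ψ (tr (a ∙ e))))
               (cong (𝟙 (b ≟ 𝟘) * ψ₀ * (m * sy t) *_) (∑-ψ-tr-Sym a)) ⟩
        𝟙 (b ≟ 𝟘) * ψ₀ * (m * sy t) * (𝟙 (Alternating? a) * sy s)
          ≡⟨ shuffle₂ (𝟙 (b ≟ 𝟘)) ψ₀ (m * sy t) (𝟙 (Alternating? a)) (sy s) ⟩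
        𝟙 (b ≟ 𝟘) * (𝟙 (Alternating? a) * ψ₀ * (sy s * (m * sy t))) ∎
        where
        a = b₁₁ s t s t A
        b = b₁₂ s t s t A
        ψ₀ : ℤ
        ψ₀ = ψ (tr (b₂₂ s t s t A) +ᶠ tr (b₂₂ s t s t A′))
        term : ∀ e g h → ψ (tr (siegel A A′ (blk e (g ᵀ) g h) ∙ σᵇ s t)) ≡
          ψ₀ * ψ (tr (a ∙ e)) * ψ (tr (b ∙ g))
        term e g h = begin
          ψ (tr (siegel A A′ (blk e (g ᵀ) g h) ∙ σᵇ s t))
            ≡⟨ trans (cong₂ (λ x y → ψ (tr (siegel x y (blk e (g ᵀ) g h) ∙ σᵇ s t)))
                 (sym (blk-η s t s t A)) (sym (blk-η s t s t A′))) (cong ψ (tr-siegel-σᵇ s t)) ⟩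
          ψ (tr (b₂₂ s t s t A) +ᶠ tr (b₂₂ s t s t A′) +ᶠ (tr (a ∙ e) +ᶠ tr (b ∙ g)))
            ≡⟨ trans (ψ-hom _ _) (cong (ψ₀ *_) (ψ-hom _ _)) ⟩
          ψ₀ * (ψ (tr (a ∙ e)) * ψ (tr (b ∙ g)))
            ≡⟨ ℤP.*-assoc ψ₀ _ _ ⟨
          ψ₀ * ψ (tr (a ∙ e)) * ψ (tr (b ∙ g)) ∎
        shuffle₁ : ∀ y p u i k → y * (p * u * (i * k)) ≡ i * p * (k * y) * u
        shuffle₁ = solve-∀
        shuffle₂ : ∀ i p k j y → i * p * k * (j * y) ≡ i * (j * p * (y * k))
        shuffle₂ = solve-∀

      -- For b = 0 the lower right block of A⁻¹ is d⁻¹, so the sum factors: nonsingular alternating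
      -- a, the Kloosterman sum over d, and the free block c.
      T-value : ∑⟨ Parabolic? {n} ⟩ (λ p → ψ (tr (p ∙ σᵇ s t))) ≡
        al s * (KG t * m) * (sy s * (m * sy t))
      T-value = begin
        ∑⟨ Parabolic? {n} ⟩ (λ p → ψ (tr (p ∙ σᵇ s t)))
          ≡⟨ ∑-Parabolic char2 {n} _ ⟩
        ∑⟨ GL? ⟩ (λ (A , A′) → ∑⟨ Sym? ⟩ (λ B → ψ (tr (siegel A A′ B ∙ σᵇ s t))))
          ≡⟨ ∑⟨⟩-cong GL? (λ (A , A′) _ → inner-sum A A′) ⟩
        ∑⟨ GL? ⟩ (λ (A , A′) → 𝟙 (b₁₂ s t s t A ≟ 𝟘) * (𝟙 (Alternating? (b₁₁ s t s t A)) *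
          ψ (tr (b₂₂ s t s t A) +ᶠ tr (b₂₂ s t s t A′)) * (sy s * (m * sy t))))
          ≡⟨ ∑⟨⟩-refine GL? (λ (A , _) → b₁₂ s t s t A ≟ 𝟘) _ ⟩
        ∑⟨ GL-low? s t ⟩ (λ (A , A′) → 𝟙 (Alternating? (b₁₁ s t s t A)) *
          ψ (tr (b₂₂ s t s t A) +ᶠ tr (b₂₂ s t s t A′)) * (sy s * (m * sy t)))
          ≡⟨ ∑⟨⟩-*ʳ (GL-low? s t) (sy s * (m * sy t)) (λ (A , A′) →
               𝟙 (Alternating? (b₁₁ s t s t A)) * ψ (tr (b₂₂ s t s t A) +ᶠ tr (b₂₂ s t s t A′))) ⟩
        ∑⟨ GL-low? s t ⟩ (λ (A , A′) → 𝟙 (Alternating? (b₁₁ s t s t A)) *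
          ψ (tr (b₂₂ s t s t A) +ᶠ tr (b₂₂ s t s t A′))) * (sy s * (m * sy t))
          ≡⟨ cong (_* (sy s * (m * sy t)))
               (low-sum (𝟙 ∘ Alternating?) (λ (d , d′) → ψ (tr d +ᶠ tr d′))) ⟩
        ∑⟨ GL? ⟩ (λ (a , _) → 𝟙 (Alternating? a)) * (KG t * m) * (sy s * (m * sy t))
          ≡⟨ cong (λ x → x * (KG t * m) * (sy s * (m * sy t))) (trans
               (∑⟨⟩-cong GL? (λ (a , _) _ → sym (ℤP.*-identityʳ (𝟙 (Alternating? a)))))
               (∑⟨⟩-refine GL? (λ (a , _) → Alternating? a) (λ _ → 1ℤ))) ⟩
        al s * (KG t * m) * (sy s * (m * sy t)) ∎

      InPσP⇔DC : ∀ w → InPσP n s w ⇔ DC w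
      InPσP⇔DC w = mk⇔
        (λ (p₁ , p₂ , h₁ , h₂ , e) → (p₁ , p₂) ,
          (Equivalence.to (InP⇔Parabolic char2 p₁) h₁ , Equivalence.to (InP⇔Parabolic char2 p₂) h₂) ,
          trans (same p₁ p₂) (sym e))
        (λ ((p₁ , p₂) , (h₁ , h₂) , e) → p₁ , p₂ ,
          Equivalence.from (InP⇔Parabolic char2 p₁) h₁ , Equivalence.from (InP⇔Parabolic char2 p₂) h₂ ,
          trans (sym e) (same p₁ p₂))
        where
        same : ∀ p₁ p₂ → p₁ ∙ σᵇ s t ∙ p₂ ≡ (p₁ ⊗ σ n s) ⊗ p₂
        same p₁ p₂ = trans (∙≡⊗ _ p₂) (cong (_⊗ p₂) (trans (∙≡⊗ p₁ _) (cong (p₁ ⊗_) (sym (σ≡σᵇ s t)))))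

    -- Left uncancelled, with |H| on one side and |P| on the other; `evaluate` removes the common
    -- factors once their nonzero values are known.
    doubleCoset-identity : ∀ ws → Enumerates ws (InPσP n s) →
      gl s * (gl t * m) * (m * sy t) * sumℤ (λ w → ψ (Tr w)) ws ≡
      gl n * sy n * (al s * (KG t * m) * (sy s * (m * sy t)))
    doubleCoset-identity ws (uniq , enum) = begin
      gl s * (gl t * m) * (m * sy t) * sumℤ (λ w → ψ (Tr w)) ws
        ≡⟨ cong₂ _*_ (sym H-size) (trans (sym (∑ˡ-foldr ws _)) (trans
             (∑-enumerated DC? uniq (λ w → mk⇔
               (Equivalence.to (InPσP⇔DC w) ∘ Equivalence.to (enum w))
               (Equivalence.from (enum w) ∘ Equivalence.from (InPσP⇔DC w))) _)
             (∑⟨⟩-cong DC? (λ w _ → cong ψ (sym (tr≡Tr w)))))) ⟩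
      ∑⟨ H? ⟩ (λ _ → 1ℤ) * ∑⟨ DC? ⟩ (ψ ∘ tr)
        ≡⟨ doubleCosetSum (ψ ∘ tr) (λ v w → cong ψ (tr-∙-comm v w)) ⟩
      ∑⟨ Parabolic? {n} ⟩ (λ _ → 1ℤ) * ∑⟨ Parabolic? {n} ⟩ (λ p → ψ (tr (p ∙ σᵇ s t)))
        ≡⟨ cong₂ _*_ P-size T-value ⟩
      gl n * sy n * (al s * (KG t * m) * (sy s * (m * sy t))) ∎

-- The Kloosterman sums for GL(1) and GL(2)

module KloostermanSums {r} (𝔽 : FiniteField r) (χ : FiniteField.AddChar 𝔽)
  (nontrivial : FiniteField.Nontrivial 𝔽 χ) where

  open import Data.Integer using (_+_; _*_; _-_)
  open FiniteSums
  open Matrices 𝔽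
  open SiegelParabolic 𝔽
  open CharacterSums 𝔽 χ nontrivial
  open BlockSums 𝔽 char2
  open Orders 𝔽 char2
  open DoubleCosetSums 𝔽 χ nontrivial

  card-F : ∣ F ∣ ≡ + q
  card-F = trans (∑ˡ-length elems) (cong +_ (trans (ListP.length-map (Inverse.to enum) (allFin q))
    (ListP.length-tabulate id)))

  card-Mx : ∀ m n → ∣ Mx m n ∣ ≡ + ((q ℕ.^ n) ℕ.^ m)
  card-Mx m n = card-Vec-^ {Vec F n} (q ℕ.^ n) (card-Vec-^ {F} q card-F n) m

  scalar : F → Mx 1 1
  scalar x = x · I

  tr-scalar : ∀ x → tr (scalar x) ≡ x
  tr-scalar x = trans (tr-· x I) (trans (cong (x *ᶠ_) tr-I₁) (Fᴿ.*-identityʳ x))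

  scalar-tr : ∀ a → scalar (tr a) ≡ a
  scalar-tr a = 1×1-ext (tr-scalar (tr a))

  scalar-∙ : ∀ x y → scalar x ∙ scalar y ≡ scalar (x *ᶠ y)
  scalar-∙ x y = 1×1-ext (begin
    tr (scalar x ∙ scalar y) ≡⟨ cong tr (trans (∙-·ʳ y (scalar x) I) (cong (y ·_) (∙-identityʳ _))) ⟩
    tr (y · scalar x)        ≡⟨ trans (tr-· y _) (cong (y *ᶠ_) (tr-scalar x)) ⟩
    y *ᶠ x                   ≡⟨ Fᴿ.*-comm y x ⟩
    x *ᶠ y                   ≡⟨ tr-scalar _ ⟨
    tr (scalar (x *ᶠ y))     ∎)

  scalar-⊞ : ∀ x y → scalar x ⊞ scalar y ≡ scalar (x +ᶠ y)
  scalar-⊞ x y = 1×1-ext (trans (tr-⊞ _ _) (trans (cong₂ _+ᶠ_ (tr-scalar x) (tr-scalar y))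
    (sym (tr-scalar _))))

  scalar-1 : scalar 1# ≡ I
  scalar-1 = 1×1-ext (trans (tr-scalar 1#) (sym tr-I₁))

  scalar-0 : scalar 0# ≡ 𝟘
  scalar-0 = 1×1-ext (trans (tr-scalar 0#) (sym (tr-𝟘 1)))

  KG-1 : KG 1 ≡ K χ 1#
  KG-1 = trans
    (∑⟨⟩-bij GL? (λ α → ¬? (α ≟ 0#)) (λ (d , d′) → tr d) (λ α → scalar α , scalar (α ⁻¹ᶠ))
      (λ { (d , d′) dd′ e → I₁≢𝟘 (trans (sym dd′) (trans
        (cong (_∙ d′) (1×1-ext (trans e (sym (tr-𝟘 1))))) (∙-zeroˡ d′))) })
      invertible
      (λ { (d , d′) dd′ → cong₂ _,_ (scalar-tr d) (inverse-unique
        (trans (cong (_∙ scalar (tr d ⁻¹ᶠ)) (sym (scalar-tr d))) (invertible (tr d) (λ e →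
          I₁≢𝟘 (trans (sym dd′) (trans (cong (_∙ d′) (1×1-ext (trans e (sym (tr-𝟘 1))))) (∙-zeroˡ d′))))))
        dd′) })
      (λ α _ → tr-scalar α)
      (λ α _ → cong ψ (cong₂ _+ᶠ_ (tr-scalar α) (tr-scalar (α ⁻¹ᶠ)))))
    (trans (∑-cong (λ α → summand α (α ≟ 0#))) (∑ˡ-foldr elems _))
    where
    invertible : ∀ α → ¬ (α ≡ 0#) → scalar α ∙ scalar (α ⁻¹ᶠ) ≡ I
    invertible α α≢0 = trans (scalar-∙ _ _) (trans (cong scalar (⁻¹-inverse α α≢0)) scalar-1)
    summand : ∀ α (d : Dec (α ≡ 0#)) → 𝟙 (¬? d) * ψ (α +ᶠ α ⁻¹ᶠ) ≡
      (if does d then 0ℤ else ψ (α +ᶠ 1# *ᶠ α ⁻¹ᶠ))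
    summand α (yes _) = ℤP.*-zeroˡ (ψ (α +ᶠ α ⁻¹ᶠ))
    summand α (no _)  = trans (ℤP.*-identityˡ _) (cong (λ x → ψ (α +ᶠ x)) (sym (Fᴿ.*-identityˡ _)))

  K-GL2≡KG : K-GL2 χ 1# ≡ KG 2
  K-GL2≡KG = begin
    sumℤ (λ w → sumℤ (summand w) (allMats 2)) (allMats 2)
      -- At the fixed size 2 the list `allMats 2` computes to `elements` of the finite type
      -- `Mx 2 2`.
      ≡⟨ ∑ˡ-foldr (allMats 2) _ ⟨
    ∑ {Mx 2 2} (λ w → sumℤ (summand w) (allMats 2))
      ≡⟨ ∑-cong (λ w → trans (sym (∑ˡ-foldr (allMats 2) (summand w))) (∑-cong (term w))) ⟩
    ∑ {Mx 2 2} (λ w → ∑ {Mx 2 2} (λ v → 𝟙 (GL? (w , v)) * ψ (tr w +ᶠ tr v)))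
      ≡⟨ ∑-× {Mx 2 2} {Mx 2 2} _ ⟨
    KG 2 ∎
    where
    summand : Mx 2 2 → Mx 2 2 → ℤ
    summand w v = if does ((w ⊗ v) ≟M idM) ∧ does ((v ⊗ w) ≟M idM)
      then ψ (Tr w +ᶠ 1# *ᶠ Tr v) else 0ℤ
    term : ∀ w v → summand w v ≡ 𝟙 (GL? (w , v)) * ψ (tr w +ᶠ tr v)
    term w v = trans (weight (((w ⊗ v) ≟M idM) ×-dec ((v ⊗ w) ≟M idM)))
      (cong₂ _*_
        (𝟙-cong (((w ⊗ v) ≟M idM) ×-dec ((v ⊗ w) ≟M idM)) (GL? (w , v))
          (λ (e , _) → trans (∙≡⊗ w v) (trans e (sym I≡idM)))
          (λ e → trans (sym (∙≡⊗ w v)) (trans e I≡idM) ,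
                 trans (sym (∙≡⊗ v w)) (trans (rightInverse⇒leftInverse e) I≡idM)))
        (cong ψ (cong₂ _+ᶠ_ (sym (tr≡Tr w)) (trans (Fᴿ.*-identityˡ _) (sym (tr≡Tr v))))))
      where
      weight : ∀ {P : Set} (d : Dec P) {x} → (if does d then x else 0ℤ) ≡ 𝟙 d * x
      weight (yes _) {x} = sym (ℤP.*-identityˡ x)
      weight (no _)  {x} = sym (ℤP.*-zeroˡ x)

  mat : F → F → F → F → Mx 2 2
  mat a b c d = blk (scalar a) (scalar b) (scalar c) (scalar d)

  mat-∙ : ∀ a b c d a′ b′ c′ d′ → mat a b c d ∙ mat a′ b′ c′ d′ ≡
    mat (a *ᶠ a′ +ᶠ b *ᶠ c′) (a *ᶠ b′ +ᶠ b *ᶠ d′) (c *ᶠ a′ +ᶠ d *ᶠ c′) (c *ᶠ b′ +ᶠ d *ᶠ d′)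
  mat-∙ a b c d a′ b′ c′ d′ = trans (blk-∙ _ _ _ _ _ _ _ _)
    (blk-cong (entry₂ a a′ b c′) (entry₂ a b′ b d′) (entry₂ c a′ d c′) (entry₂ c b′ d d′))
    where
    entry₂ : ∀ x x′ y y′ → scalar x ∙ scalar x′ ⊞ scalar y ∙ scalar y′ ≡ scalar (x *ᶠ x′ +ᶠ y *ᶠ y′)
    entry₂ x x′ y y′ = trans (cong₂ _⊞_ (scalar-∙ x x′) (scalar-∙ y y′)) (scalar-⊞ _ _)

  tr-mat : ∀ a b c d → tr (mat a b c d) ≡ a +ᶠ d
  tr-mat a b c d = trans (tr-blk {1} {1} _ _ _ _) (cong₂ _+ᶠ_ (tr-scalar a) (tr-scalar d))

  mat-1 : mat 1# 0# 0# 1# ≡ I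
  mat-1 = trans (blk-cong scalar-1 scalar-0 scalar-0 scalar-1) (sym (I-blk 1 1))

  mat-0 : mat 0# 0# 0# 0# ≡ 𝟘
  mat-0 = trans (blk-cong scalar-0 scalar-0 scalar-0 scalar-0) (sym (𝟘-blk 1 1 1 1))

  module _ (A : Mx 2 2) where

    m₁₁ m₁₂ m₂₁ m₂₂ : F
    m₁₁ = tr (b₁₁ 1 1 1 1 A)
    m₁₂ = tr (b₁₂ 1 1 1 1 A)
    m₂₁ = tr (b₂₁ 1 1 1 1 A)
    m₂₂ = tr (b₂₂ 1 1 1 1 A)

    mat-η : mat m₁₁ m₁₂ m₂₁ m₂₂ ≡ A
    mat-η = trans (blk-cong (scalar-tr _) (scalar-tr _) (scalar-tr _) (scalar-tr _)) (blk-η 1 1 1 1 A)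

  module _ {a b c d : F} where

    m₁₁-mat : m₁₁ (mat a b c d) ≡ a
    m₁₁-mat = trans (cong tr (b₁₁-blk {1} {1} {1} {1} _ _ _ _)) (tr-scalar a)

    m₁₂-mat : m₁₂ (mat a b c d) ≡ b
    m₁₂-mat = trans (cong tr (b₁₂-blk {1} {1} {1} {1} _ _ _ _)) (tr-scalar b)

    m₂₁-mat : m₂₁ (mat a b c d) ≡ c
    m₂₁-mat = trans (cong tr (b₂₁-blk {1} {1} {1} {1} _ _ _ _)) (tr-scalar c)

    m₂₂-mat : m₂₂ (mat a b c d) ≡ d
    m₂₂-mat = trans (cong tr (b₂₂-blk {1} {1} {1} {1} _ _ _ _)) (tr-scalar d)

  mat-cong : ∀ {a b c d a′ b′ c′ d′} → a ≡ a′ → b ≡ b′ → c ≡ c′ → d ≡ d′ →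
    mat a b c d ≡ mat a′ b′ c′ d′
  mat-cong refl refl refl refl = refl

  double : ∀ {x y} → x ≡ y → x +ᶠ y ≡ 0#
  double refl = char2 _

  det : F → F → F → F → F
  det a b c d = a *ᶠ d +ᶠ b *ᶠ c

  -- The adjugate, without signs in characteristic 2.
  mat-inverse : ∀ a b c d → ¬ (det a b c d ≡ 0#) →
    let δ⁻¹ = det a b c d ⁻¹ᶠ in
    mat a b c d ∙ mat (d *ᶠ δ⁻¹) (b *ᶠ δ⁻¹) (c *ᶠ δ⁻¹) (a *ᶠ δ⁻¹) ≡ I
  mat-inverse a b c d det≢0 = trans (mat-∙ _ _ _ _ _ _ _ _) (trans (mat-cong
      (trans (pull a d b c) (⁻¹-inverse _ det≢0))
      (trans (pull a b b a) (trans (cong (_*ᶠ det a b c d ⁻¹ᶠ) (double (Fᴿ.*-comm a b))) (Fᴿ.zeroˡ _)))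
      (trans (pull c d d c) (trans (cong (_*ᶠ det a b c d ⁻¹ᶠ) (double (Fᴿ.*-comm c d))) (Fᴿ.zeroˡ _)))
      (trans (pull c b d a) (trans (cong (_*ᶠ det a b c d ⁻¹ᶠ) (trans (Fᴿ.+-comm _ _)
        (cong₂ _+ᶠ_ (Fᴿ.*-comm d a) (Fᴿ.*-comm c b)))) (⁻¹-inverse _ det≢0)))) mat-1)
    where
    pull : ∀ {e} x x′ y y′ → x *ᶠ (x′ *ᶠ e) +ᶠ y *ᶠ (y′ *ᶠ e) ≡ (x *ᶠ x′ +ᶠ y *ᶠ y′) *ᶠ e
    pull {e} x x′ y y′ = trans (cong₂ _+ᶠ_ (sym (Fᴿ.*-assoc x x′ e)) (sym (Fᴿ.*-assoc y y′ e)))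
      (sym (Fᴿ.distribʳ e _ _))

  -- (b , a) spans the kernel of a singular matrix with first row (a , b).
  det≢0 : ∀ {a b c d A′} → mat a b c d ∙ A′ ≡ I → ¬ (b ≡ 0#) → ¬ (det a b c d ≡ 0#)
  det≢0 {a} {b} {c} {d} {A′} AA′ b≢0 e = b≢0 (begin
    b                                                 ≡⟨ m₁₁-mat ⟨
    m₁₁ (mat b 0# a 0#)                               ≡⟨ cong m₁₁ (∙-cancel-inverseˡ A′A _) ⟨
    m₁₁ (A′ ∙ (mat a b c d ∙ mat b 0# a 0#))          ≡⟨ cong (λ x → m₁₁ (A′ ∙ x)) kernel ⟩
    m₁₁ (A′ ∙ 𝟘)                                      ≡⟨ cong m₁₁ (trans (∙-zeroʳ A′) (sym mat-0)) ⟩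
    m₁₁ (mat 0# 0# 0# 0#)                             ≡⟨ m₁₁-mat ⟩
    0#                                                ∎)
    where
    A′A : A′ ∙ mat a b c d ≡ I
    A′A = rightInverse⇒leftInverse AA′
    zero-column : ∀ x y → x *ᶠ 0# +ᶠ y *ᶠ 0# ≡ 0#
    zero-column x y = trans (cong₂ _+ᶠ_ (Fᴿ.zeroʳ x) (Fᴿ.zeroʳ y)) (Fᴿ.+-identityˡ 0#)
    kernel : mat a b c d ∙ mat b 0# a 0# ≡ 𝟘
    kernel = trans (mat-∙ _ _ _ _ _ _ _ _) (trans (mat-cong
      (double (Fᴿ.*-comm a b)) (zero-column a b)
      (trans (Fᴿ.+-comm _ _) (trans (cong₂ _+ᶠ_ (Fᴿ.*-comm d a) (Fᴿ.*-comm c b)) e))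
      (zero-column c d)) mat-0)

  private
    -- Coordinates for invertible (a, b; c, d) with b nonzero: b and the determinant run through the
    -- nonzero elements, a and d freely. The entry c is recovered by `corner`.
    cell? : (x : F × F × F × F) → Dec (¬ (proj₁ x ≡ 0#) × ¬ (proj₁ (proj₂ x) ≡ 0#))
    cell? (b , δ₀ , _) = ¬? (b ≟ 0#) ×-dec ¬? (δ₀ ≟ 0#)

    corner : F → F → F → F → F
    corner b δ₀ a d = (a *ᶠ d +ᶠ δ₀) *ᶠ b ⁻¹ᶠ

    cancel-double : ∀ x y → x +ᶠ (x +ᶠ y) ≡ y
    cancel-double x y = trans (sym (Fᴿ.+-assoc x x y))
      (trans (cong (_+ᶠ y) (char2 x)) (Fᴿ.+-identityˡ y))

    corner-det : ∀ b δ₀ a d → ¬ (b ≡ 0#) → det a b (corner b δ₀ a d) d ≡ δ₀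
    corner-det b δ₀ a d b≢0 = trans (cong (a *ᶠ d +ᶠ_) (begin
        b *ᶠ ((a *ᶠ d +ᶠ δ₀) *ᶠ b ⁻¹ᶠ) ≡⟨ Fᴿ.*-comm b _ ⟩
        (a *ᶠ d +ᶠ δ₀) *ᶠ b ⁻¹ᶠ *ᶠ b   ≡⟨ Fᴿ.*-assoc _ _ b ⟩
        (a *ᶠ d +ᶠ δ₀) *ᶠ (b ⁻¹ᶠ *ᶠ b)
          ≡⟨ cong (_ *ᶠ_) (trans (Fᴿ.*-comm _ b) (⁻¹-inverse b b≢0)) ⟩
        (a *ᶠ d +ᶠ δ₀) *ᶠ 1#           ≡⟨ Fᴿ.*-identityʳ _ ⟩
        a *ᶠ d +ᶠ δ₀                   ∎))
      (cancel-double (a *ᶠ d) δ₀)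

    det-corner : ∀ a b c d → ¬ (b ≡ 0#) → corner b (det a b c d) a d ≡ c
    det-corner a b c d b≢0 = begin
      (a *ᶠ d +ᶠ (a *ᶠ d +ᶠ b *ᶠ c)) *ᶠ b ⁻¹ᶠ ≡⟨ cong (_*ᶠ b ⁻¹ᶠ) (cancel-double _ _) ⟩
      b *ᶠ c *ᶠ b ⁻¹ᶠ                         ≡⟨ cong (_*ᶠ b ⁻¹ᶠ) (Fᴿ.*-comm b c) ⟩
      c *ᶠ b *ᶠ b ⁻¹ᶠ                         ≡⟨ Fᴿ.*-assoc c b _ ⟩
      c *ᶠ (b *ᶠ b ⁻¹ᶠ)                       ≡⟨ cong (c *ᶠ_) (⁻¹-inverse b b≢0) ⟩
      c *ᶠ 1#                                 ≡⟨ Fᴿ.*-identityʳ c ⟩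
      c                                       ∎

    big? : (p : Mx 2 2 × Mx 2 2) → Dec (proj₁ p ∙ proj₂ p ≡ I × ¬ (b₁₂ 1 1 1 1 (proj₁ p) ≡ 𝟘))
    big? p = GL? p ×-dec ¬? (b₁₂ 1 1 1 1 (proj₁ p) ≟ 𝟘)

    fromCell : F × F × F × F → Mx 2 2 × Mx 2 2
    fromCell (b , δ₀ , a , d) = let c = corner b δ₀ a d in
      mat a b c d , mat (d *ᶠ δ₀ ⁻¹ᶠ) (b *ᶠ δ₀ ⁻¹ᶠ) (c *ᶠ δ₀ ⁻¹ᶠ) (a *ᶠ δ₀ ⁻¹ᶠ)

    fromCell-inverse : ∀ b δ₀ a d → ¬ (b ≡ 0#) → ¬ (δ₀ ≡ 0#) →
      proj₁ (fromCell (b , δ₀ , a , d)) ∙ proj₂ (fromCell (b , δ₀ , a , d)) ≡ I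
    fromCell-inverse b δ₀ a d b≢0 δ₀≢0 = subst
      (λ δ₁ → let c = corner b δ₀ a d in
        mat a b c d ∙ mat (d *ᶠ δ₁ ⁻¹ᶠ) (b *ᶠ δ₁ ⁻¹ᶠ) (c *ᶠ δ₁ ⁻¹ᶠ) (a *ᶠ δ₁ ⁻¹ᶠ) ≡ I)
      (corner-det b δ₀ a d b≢0)
      (mat-inverse a b _ d (λ e → δ₀≢0 (trans (sym (corner-det b δ₀ a d b≢0)) e)))

    nonzero-det : ∀ A A′ → A ∙ A′ ≡ I → ¬ (m₁₂ A ≡ 0#) →
      ¬ (det (m₁₁ A) (m₁₂ A) (m₂₁ A) (m₂₂ A) ≡ 0#)
    nonzero-det A A′ AA′ b≢0 = det≢0 (trans (cong (_∙ A′) (mat-η A)) AA′) b≢0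

    m₁₂≢0 : ∀ {A} → ¬ (b₁₂ 1 1 1 1 A ≡ 𝟘) → ¬ (m₁₂ A ≡ 0#)
    m₁₂≢0 b≢𝟘 e = b≢𝟘 (1×1-ext (trans e (sym (tr-𝟘 1))))

    -- The adjugate has the same trace a + d, so tr A + tr A⁻¹ = (a + d)(1 + δ₀⁻¹): no dependence on
    -- b, and on c only through the determinant δ₀.
    big-cell : ∑⟨ big? ⟩ (λ (A , A′) → ψ (tr A +ᶠ tr A′)) ≡
      ∑⟨ cell? ⟩ (λ (b , δ₀ , a , d) → ψ (a *ᶠ (1# +ᶠ δ₀ ⁻¹ᶠ)) * ψ (d *ᶠ (1# +ᶠ δ₀ ⁻¹ᶠ)))
    big-cell = ∑⟨⟩-bij big? cell?
      (λ (A , _) → m₁₂ A , det (m₁₁ A) (m₁₂ A) (m₂₁ A) (m₂₂ A) , m₁₁ A , m₂₂ A)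
      fromCell
      (λ { (A , A′) (AA′ , b≢𝟘) → m₁₂≢0 b≢𝟘 , nonzero-det A A′ AA′ (m₁₂≢0 b≢𝟘) })
      (λ { (b , δ₀ , a , d) (b≢0 , δ₀≢0) → fromCell-inverse b δ₀ a d b≢0 δ₀≢0 ,
           λ e → b≢0 (trans (sym m₁₂-mat) (trans (cong tr e) (tr-𝟘 1))) })
      (λ { (A , A′) (AA′ , b≢𝟘) → cong₂ _,_ (recover A b≢𝟘)
           (inverse-unique (fromCell-inverse _ _ _ _ (m₁₂≢0 b≢𝟘) (nonzero-det A A′ AA′ (m₁₂≢0 b≢𝟘)))
             (trans (cong (_∙ A′) (recover A b≢𝟘)) AA′)) })
      (λ { (b , δ₀ , a , d) (b≢0 , δ₀≢0) → cong₂ _,_ m₁₂-mat (cong₂ _,_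
           (trans (cong₂ _+ᶠ_ (cong₂ _*ᶠ_ m₁₁-mat m₂₂-mat) (cong₂ _*ᶠ_ m₁₂-mat m₂₁-mat))
                  (corner-det b δ₀ a d b≢0))
           (cong₂ _,_ m₁₁-mat m₂₂-mat)) })
      (λ { (b , δ₀ , a , d) _ → trans (cong ψ (begin
             tr (mat a b _ d) +ᶠ tr (mat (d *ᶠ δ₀ ⁻¹ᶠ) _ _ (a *ᶠ δ₀ ⁻¹ᶠ))
               ≡⟨ cong₂ _+ᶠ_ (tr-mat _ _ _ _) (trans (tr-mat _ _ _ _) (Fᴿ.+-comm _ _)) ⟩
             a +ᶠ d +ᶠ (a *ᶠ δ₀ ⁻¹ᶠ +ᶠ d *ᶠ δ₀ ⁻¹ᶠ)
               ≡⟨ F+.interchange a d _ _ ⟩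
             a +ᶠ a *ᶠ δ₀ ⁻¹ᶠ +ᶠ (d +ᶠ d *ᶠ δ₀ ⁻¹ᶠ)
               ≡⟨ cong₂ _+ᶠ_ (factor a) (factor d) ⟨
             a *ᶠ (1# +ᶠ δ₀ ⁻¹ᶠ) +ᶠ d *ᶠ (1# +ᶠ δ₀ ⁻¹ᶠ) ∎))
           (ψ-hom _ _) })
      where
      factor : ∀ {e} x → x *ᶠ (1# +ᶠ e) ≡ x +ᶠ x *ᶠ e
      factor {e} x = trans (Fᴿ.distribˡ x 1# e) (cong (_+ᶠ x *ᶠ e) (Fᴿ.*-identityʳ x))
      recover : ∀ A → ¬ (b₁₂ 1 1 1 1 A ≡ 𝟘) →
        mat (m₁₁ A) (m₁₂ A) (corner (m₁₂ A) (det (m₁₁ A) (m₁₂ A) (m₂₁ A) (m₂₂ A)) (m₁₁ A) (m₂₂ A)) (m₂₂ A) ≡ A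
      recover A b≢𝟘 = trans (mat-cong refl refl (det-corner _ _ _ _ (m₁₂≢0 b≢𝟘)) refl) (mat-η A)

    -- The sums over a and d vanish unless 1 + δ₀⁻¹ = 0, that is, δ₀ = 1 in characteristic 2; then
    -- each gives q, while b contributes q - 1.
    cell-sum : ∑⟨ cell? ⟩ (λ (b , δ₀ , a , d) →
        ψ (a *ᶠ (1# +ᶠ δ₀ ⁻¹ᶠ)) * ψ (d *ᶠ (1# +ᶠ δ₀ ⁻¹ᶠ))) ≡
      (∣ F ∣ - 1ℤ) * (∣ F ∣ * ∣ F ∣)
    cell-sum = begin
      ∑⟨ cell? ⟩ (λ (b , δ₀ , a , d) → g δ₀ a * g δ₀ d)
        ≡⟨ ∑⟨⟩-× cell? (λ b → ¬? (b ≟ 0#)) (λ _ (δ₀ , _) → ¬? (δ₀ ≟ 0#)) (λ _ _ → id) (λ _ _ → _,_) _ ⟩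
      ∑⟨ (λ b → ¬? (b ≟ 0#)) ⟩ (λ _ → ∑⟨ (λ (δ₀ , _) → ¬? (δ₀ ≟ 0#)) ⟩ (λ (δ₀ , a , d) → g δ₀ a * g δ₀ d))
        ≡⟨ ∑⟨⟩-const (λ b → ¬? (b ≟ 0#)) _ ⟩
      ∑⟨ (λ b → ¬? (b ≟ 0#)) ⟩ (λ _ → 1ℤ) * inner
        ≡⟨ cong₂ _*_ (trans (∑-cong (λ b → ℤP.*-identityʳ (𝟙 (¬? (b ≟ 0#))))) (count-≢ 0#)) inner-value ⟩
      (∣ F ∣ - 1ℤ) * (∣ F ∣ * ∣ F ∣) ∎
      where
      g : F → F → ℤ
      g δ₀ x = ψ (x *ᶠ (1# +ᶠ δ₀ ⁻¹ᶠ))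
      inner : ℤ
      inner = ∑⟨ (λ (δ₀ , _) → ¬? (δ₀ ≟ 0#)) ⟩ (λ ((δ₀ , a , d) : F × F × F) → g δ₀ a * g δ₀ d)
      unit-only : ∀ x → (¬ (x ≡ 0#)) × (1# +ᶠ x ⁻¹ᶠ ≡ 0#) → x ≡ 1#
      unit-only x (x≢0 , e) = begin
        x                     ≡⟨ Fᴿ.*-identityʳ x ⟨
        x *ᶠ 1#
          ≡⟨ cong (x *ᶠ_) (trans (sym (Fᴿ.+-identityʳ 1#)) (trans (cong (1# +ᶠ_) (sym e)) (cancel-double 1# _))) ⟩
        x *ᶠ x ⁻¹ᶠ            ≡⟨ ⁻¹-inverse x x≢0 ⟩
        1#                    ∎
      is-unit : (¬ (1# ≡ 0#)) × (1# +ᶠ 1# ⁻¹ᶠ ≡ 0#)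
      is-unit = (0≢1 ∘ sym) ,
        double (trans (sym (⁻¹-inverse 1# (0≢1 ∘ sym))) (Fᴿ.*-identityˡ _))
      plane : ∀ δ₀ → ∑ {F × F} (λ (a , d) → g δ₀ a * g δ₀ d) ≡
        𝟙 (1# +ᶠ δ₀ ⁻¹ᶠ ≟ 0#) * (∣ F ∣ * ∣ F ∣)
      plane δ₀ = begin
        ∑ {F × F} (λ (a , d) → g δ₀ a * g δ₀ d)     ≡⟨ ∑-× {F} {F} _ ⟩
        ∑ (λ a → ∑ (λ d → g δ₀ a * g δ₀ d))         ≡⟨ ∑-cong (λ a → ∑-*ˡ (g δ₀ a) (g δ₀)) ⟩
        ∑ (λ a → g δ₀ a * ∑ (g δ₀))                 ≡⟨ ∑-*ʳ (∑ (g δ₀)) (g δ₀) ⟩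
        ∑ (g δ₀) * ∑ (g δ₀)                         ≡⟨ cong (λ x → x * x) (∑-ψ-* _) ⟩
        𝟙 e? * ∣ F ∣ * (𝟙 e? * ∣ F ∣)           ≡⟨ idempotent e? ∣ F ∣ ⟩
        𝟙 e? * (∣ F ∣ * ∣ F ∣)                    ∎
        where
        e? : Dec (1# +ᶠ δ₀ ⁻¹ᶠ ≡ 0#)
        e? = 1# +ᶠ δ₀ ⁻¹ᶠ ≟ 0#
        idempotent : ∀ {P : Set} (p : Dec P) x → 𝟙 p * x * (𝟙 p * x) ≡ 𝟙 p * (x * x)
        idempotent (yes _) x = lem x where
          lem : ∀ x → 1ℤ * x * (1ℤ * x) ≡ 1ℤ * (x * x)
          lem = solve-∀
        idempotent (no _)  x = refl
      inner-value : inner ≡ ∣ F ∣ * ∣ F ∣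
      inner-value = begin
        inner
          ≡⟨ ∑⟨⟩-× {F} {F × F} (λ (δ₀ , _) → ¬? (δ₀ ≟ 0#)) (λ δ₀ → ¬? (δ₀ ≟ 0#)) (λ _ → everything?)
               (λ _ _ h → h , tt) (λ _ _ h _ → h) _ ⟩
        ∑⟨ (λ δ₀ → ¬? (δ₀ ≟ 0#)) ⟩ (λ δ₀ → ∑⟨ everything? ⟩ (λ ((a , d) : F × F) → g δ₀ a * g δ₀ d))
          ≡⟨ ∑⟨⟩-cong (λ δ₀ → ¬? (δ₀ ≟ 0#)) (λ δ₀ _ → trans (∑⟨everything⟩ {F × F} _) (plane δ₀)) ⟩
        ∑⟨ (λ δ₀ → ¬? (δ₀ ≟ 0#)) ⟩ (λ δ₀ → 𝟙 (1# +ᶠ δ₀ ⁻¹ᶠ ≟ 0#) * (∣ F ∣ * ∣ F ∣))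
          ≡⟨ ∑⟨⟩-refine (λ δ₀ → ¬? (δ₀ ≟ 0#)) (λ δ₀ → 1# +ᶠ δ₀ ⁻¹ᶠ ≟ 0#) _ ⟩
        ∑⟨ (λ δ₀ → ¬? (δ₀ ≟ 0#) ×-dec (1# +ᶠ δ₀ ⁻¹ᶠ ≟ 0#)) ⟩ (λ _ → ∣ F ∣ * ∣ F ∣)
          ≡⟨ ∑⟨⟩-iff (λ δ₀ → ¬? (δ₀ ≟ 0#) ×-dec (1# +ᶠ δ₀ ⁻¹ᶠ ≟ 0#)) (_≟ 1#) unit-only
               (λ { _ refl → is-unit }) ⟩
        ∑⟨ (_≟ 1#) ⟩ (λ _ → ∣ F ∣ * ∣ F ∣)
          ≡⟨ sift 1# _ ⟩
        ∣ F ∣ * ∣ F ∣ ∎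

    -- For lower triangular matrices both traces depend on the diagonal only, so two independent
    -- Kloosterman sums appear and the entry c counts q times.
    small-cell : ∑⟨ GL-low? 1 1 ⟩ (λ (A , A′) → ψ (tr A +ᶠ tr A′)) ≡ KG 1 * KG 1 * ∣ Mx 1 1 ∣
    small-cell = trans (∑-GL-low {1} {1} _) (begin
      ∑⟨ GL? ⟩ (λ (a , a′) → ∑⟨ GL? ⟩ (λ (d , d′) → ∑ {Mx 1 1} (λ c →
        ψ (tr (blk a 𝟘 c d) +ᶠ tr (blk a′ 𝟘 (d′ ∙ (c ∙ a′)) d′)))))
        ≡⟨ ∑⟨⟩-cong GL? (λ (a , a′) _ → trans (∑⟨⟩-cong GL? (λ (d , d′) _ →
             trans (∑-cong (λ c → trans (cong ψ (trans
               (cong₂ _+ᶠ_ (tr-blk {1} {1} _ _ _ _) (tr-blk {1} {1} _ _ _ _))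
               (F+.interchange (tr a) (tr d) (tr a′) (tr d′)))) (ψ-hom _ _)))
             (trans (∑-const {Mx 1 1} _) (shuffle (∣ Mx 1 1 ∣) (ψ (tr a +ᶠ tr a′)) (ψ (tr d +ᶠ tr d′))))))
             (trans (∑⟨⟩-*ˡ GL? (ψ (tr a +ᶠ tr a′) * ∣ Mx 1 1 ∣) (λ (d , d′) → ψ (tr d +ᶠ tr d′)))
               (ℤP.*-assoc (ψ (tr a +ᶠ tr a′)) _ _))) ⟩
      ∑⟨ GL? ⟩ (λ (a , a′) → ψ (tr a +ᶠ tr a′) * (∣ Mx 1 1 ∣ * KG 1))
        ≡⟨ ∑⟨⟩-*ʳ GL? (∣ Mx 1 1 ∣ * KG 1) (λ (a , a′) → ψ (tr a +ᶠ tr a′)) ⟩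
      KG 1 * (∣ Mx 1 1 ∣ * KG 1)
        ≡⟨ rotate (KG 1) (∣ Mx 1 1 ∣) ⟩
      KG 1 * KG 1 * ∣ Mx 1 1 ∣ ∎)
      where
      shuffle : ∀ a b c → a * (b * c) ≡ b * a * c
      shuffle = solve-∀
      rotate : ∀ a b → a * (b * a) ≡ a * a * b
      rotate = solve-∀

  -- The triangular matrices give q K² and the others (q - 1) q². The common factor q accounts for
  -- q⁻¹ in the middle expression of the theorem.
  KG-2 : KG 2 ≡ + q * (K χ 1# ℤ.^ 2 + (+ q) ℤ.^ 2 - + q)
  KG-2 = begin
    KG 2
      ≡⟨ ∑⟨⟩-split GL? (λ (A , _) → b₁₂ 1 1 1 1 A ≟ 𝟘) _ ⟩
    ∑⟨ GL-low? 1 1 ⟩ (λ (A , A′) → ψ (tr A +ᶠ tr A′)) + ∑⟨ big? ⟩ (λ (A , A′) → ψ (tr A +ᶠ tr A′))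
      ≡⟨ cong₂ _+_ small-cell (trans big-cell cell-sum) ⟩
    KG 1 * KG 1 * ∣ Mx 1 1 ∣ + (∣ F ∣ - 1ℤ) * (∣ F ∣ * ∣ F ∣)
      ≡⟨ cong₂ (λ x y → KG 1 * KG 1 * x + (y - 1ℤ) * (y * y)) card₁ card-F ⟩
    KG 1 * KG 1 * + q + (+ q - 1ℤ) * (+ q * + q)
      ≡⟨ cong (λ k → k * k * + q + (+ q - 1ℤ) * (+ q * + q)) KG-1 ⟩
    K χ 1# * K χ 1# * + q + (+ q - 1ℤ) * (+ q * + q)
      ≡⟨ collect (K χ 1#) (+ q) ⟩
    + q * (K χ 1# ℤ.^ 2 + (+ q) ℤ.^ 2 - + q) ∎
    where
    card₁ : ∣ Mx 1 1 ∣ ≡ + q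
    card₁ = trans (card-Mx 1 1) (cong +_ (trans (ℕP.^-identityʳ _) (ℕP.^-identityʳ q)))
      where import Data.Nat.Properties as ℕP
    collect : ∀ k x → k * k * x + (x - 1ℤ) * (x * x) ≡
      x * (k * (k * 1ℤ) + x * (x * 1ℤ) - x)
    collect = solve-∀

-- Powers of q and Gaussian binomials

module Exponents where

  open import Data.Nat using (_+_; _*_; _^_; _∸_)

  -- 1 + x + ... + x^(k-1), the explicit quotient of x^k - 1 by x - 1, which makes the
  -- natural-number division in `gauss` exact.
  geometric : ℕ → ℕ → ℕ
  geometric x zero    = 0
  geometric x (suc k) = 1 + x * geometric x k

  geometric-sum : ∀ x .{{_ : NonZero x}} k → x ^ k ∸ 1 ≡ geometric x k * (x ∸ 1)
  geometric-sum (suc y) k = cong (_∸ 1) (power k)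
    where
    step : ∀ y g → suc y * (1 + g * y) ≡ 1 + (1 + suc y * g) * y
    step = ℕRing.solve-∀
    power : ∀ k → suc y ^ k ≡ 1 + geometric (suc y) k * y
    power zero    = refl
    power (suc k) = trans (cong (suc y *_) (power k)) (step y (geometric (suc y) k))

  div-exact : ∀ a b .{{_ : NonZero b}} → (a * b) div b ≡ a
  div-exact a (suc b) = ℕD.m*n/n≡m a (suc b)

  pow∸1-nonZero : ∀ {x} → 1 ℕ.< x → ∀ k → NonZero (x ^ suc k ∸ 1)
  pow∸1-nonZero {x} 1<x k = ℕ.>-nonZero (ℕP.m<n⇒0<n∸m
    (ℕP.<-≤-trans 1<x (ℕP.m≤m*n x (x ^ k) {{ℕP.m^n≢0 x k {{ℕ.>-nonZero (ℕP.<-trans (s≤s z≤n) 1<x)}}}})))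

  -- Triangular numbers n(n+1)/2, the dimension of the space of symmetric n × n matrices.
  tri : ℕ → ℕ
  tri zero    = 0
  tri (suc n) = suc n + tri n

  -- m(m-1), the power of q in the number of nonsingular alternating matrices of size 2m.
  alt-exponent : ℕ → ℕ
  alt-exponent zero    = 0
  alt-exponent (suc m) = m * 2 + alt-exponent m

  -- Collected for s = 2m. The first summand, s or (s + 1) + s, comes from |GL(n)| / |GL(s)|, and
  -- the others from the symmetric n × n, nonsingular alternating s × s and symmetric s × s
  -- matrices.
  exponent⁻ exponent⁺ : ℕ → ℕ
  exponent⁻ m = m * 2 + (tri (suc (m * 2)) + (alt-exponent m + tri (m * 2)))
  exponent⁺ m = suc (m * 2 + m * 2) + (tri (suc m * 2) + (alt-exponent m + tri (m * 2)))

  -- The right side is (5n² - 1)/4 at n = 2m + 1; the induction adds 10m + 10 at each step.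
  exponent⁻-value : ∀ m → exponent⁻ m ≡ 5 * m * m + 5 * m + 1
  exponent⁻-value zero    = refl
  exponent⁻-value (suc m) = trans (step m (tri (m * 2)) (alt-exponent m))
    (trans (cong (_+ (10 * m + 10)) (exponent⁻-value m)) (close m))
    where
    -- `tri` and `alt-exponent` are written unfolded at the successor, with t and e for their values
    -- at m.
    step : ∀ m t e →
      suc m * 2 + ((3 + m * 2) + ((2 + m * 2) + ((1 + m * 2) + t)) + ((m * 2 + e) + ((2 + m * 2) + ((1 + m * 2) + t)))) ≡
      m * 2 + (((1 + m * 2) + t) + (e + t)) + (10 * m + 10)
    step = ℕRing.solve-∀
    close : ∀ m → 5 * m * m + 5 * m + 1 + (10 * m + 10) ≡ 5 * suc m * suc m + 5 * suc m + 1
    close = ℕRing.solve-∀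

  -- The right side is (5n² - 2n)/4 at n = 2m + 2.
  exponent⁺-value : ∀ m → exponent⁺ m ≡ 5 * m * m + 9 * m + 4
  exponent⁺-value zero    = refl
  exponent⁺-value (suc m) = trans (step m (tri (m * 2)) (alt-exponent m))
    (trans (cong (_+ (10 * m + 14)) (exponent⁺-value m)) (close m))
    where
    step : ∀ m t e →
      suc (suc m * 2 + suc m * 2) +
        ((4 + m * 2) + ((3 + m * 2) + ((2 + m * 2) + ((1 + m * 2) + t))) + ((m * 2 + e) + ((2 + m * 2) + ((1 + m * 2) + t)))) ≡
      suc (m * 2 + m * 2) + (((2 + m * 2) + ((1 + m * 2) + t)) + (e + t)) + (10 * m + 14)
    step = ℕRing.solve-∀
    close : ∀ m → 5 * m * m + 9 * m + 4 + (10 * m + 14) ≡ 5 * suc m * suc m + 9 * suc m + 4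
    close = ℕRing.solve-∀

  -- The product over odd exponents in A⁻ and A⁺. It originates in `al`, whose recursion contributes
  -- q^(2j-1) - 1 at the jth step.
  odd-factors : ℕ → ℕ → ℕ
  odd-factors q m = prod1 m (λ j → q ^ (2 * j ∸ 1) ∸ 1)

  A⁻-value : ∀ {q} → 1 ℕ.< q → ∀ m → A⁻ q (suc (m * 2)) ≡
    q ^ exponent⁻ m * geometric q (suc (m * 2)) * odd-factors q m
  A⁻-value {q} 1<q m = cong₂ _*_ (cong₂ _*_ (cong (q ^_) exponent) gauss-value)
    (cong (odd-factors q) (ℕD.m*n/n≡m m 2))
    where
    instance
      q≢0 : NonZero q
      q≢0 = ℕ.>-nonZero (ℕP.<-trans (s≤s z≤n) 1<q)
    n = suc (m * 2)
    square : ∀ m → 5 * suc (m * 2) * suc (m * 2) ≡ suc ((5 * m * m + 5 * m + 1) * 4)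
    square = ℕRing.solve-∀
    exponent : (5 * n * n ∸ 1) ℕD./ 4 ≡ exponent⁻ m
    exponent = trans (cong (λ x → (x ∸ 1) ℕD./ 4) (square m))
      (trans (ℕD.m*n/n≡m (5 * m * m + 5 * m + 1) 4) (sym (exponent⁻-value m)))
    gauss-value : gauss q n 1 ≡ geometric q n
    gauss-value = trans (cong₂ _div_
        (trans (ℕP.*-identityˡ _) (geometric-sum q n))
        (trans (ℕP.*-identityˡ _) (cong (_∸ 1) (ℕP.^-identityʳ q))))
      (div-exact (geometric q n) (q ∸ 1) {{ℕ.>-nonZero (ℕP.m<n⇒0<n∸m 1<q)}})

  -- As n is even, q^n - 1 is a power of q² minus 1 and splits off q² - 1, while q^(n-1) - 1 splits
  -- off q - 1; together these are the denominator of the Gaussian binomial.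
  A⁺-value : ∀ {q} → 1 ℕ.< q → ∀ m → A⁺ q (suc m * 2) ≡
    q ^ exponent⁺ m * (geometric (q ^ 2) (suc m) * geometric q (suc (m * 2))) * odd-factors q m
  A⁺-value {q} 1<q m = cong₂ _*_ (cong₂ _*_ (cong (q ^_) exponent) gauss-value)
    (cong (odd-factors q) (ℕD.m*n/n≡m m 2))
    where
    instance
      q≢0 : NonZero q
      q≢0 = ℕ.>-nonZero (ℕP.<-trans (s≤s z≤n) 1<q)
      q²≢0 : NonZero (q ^ 2)
      q²≢0 = ℕP.m^n≢0 q 2
    n = suc m * 2
    square : ∀ m → 5 * (suc m * 2) * (suc m * 2) ≡ (5 * m * m + 9 * m + 4) * 4 + 2 * (suc m * 2)
    square = ℕRing.solve-∀
    exponent : (5 * n * n ∸ 2 * n) ℕD./ 4 ≡ exponent⁺ m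
    exponent = trans (cong (ℕD._/ 4) (trans (cong (_∸ 2 * n) (square m)) (ℕP.m+n∸n≡m ((5 * m * m + 9 * m + 4) * 4) (2 * n))))
      (trans (ℕD.m*n/n≡m (5 * m * m + 9 * m + 4) 4) (sym (exponent⁺-value m)))
    shuffle : ∀ a b c d → 1 * (a * b) * (c * d) ≡ a * c * (1 * b * d)
    shuffle = ℕRing.solve-∀
    gauss-value : gauss q n 2 ≡ geometric (q ^ 2) (suc m) * geometric q (suc (m * 2))
    gauss-value = trans (cong₂ _div_
        (trans (cong₂ (λ x y → 1 * (x ∸ 1) * y)
            (trans (cong (q ^_) (ℕP.*-comm (suc m) 2)) (sym (ℕP.^-*-assoc q 2 (suc m))))
            (geometric-sum q (suc (m * 2))))
          (trans (cong (λ x → 1 * x * (geometric q (suc (m * 2)) * (q ∸ 1))) (geometric-sum (q ^ 2) (suc m)))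
            (shuffle (geometric (q ^ 2) (suc m)) (q ^ 2 ∸ 1) (geometric q (suc (m * 2))) (q ∸ 1))))
        (cong (λ x → 1 * (q ^ 2 ∸ 1) * (x ∸ 1)) (ℕP.^-identityʳ q)))
      (div-exact (geometric (q ^ 2) (suc m) * geometric q (suc (m * 2))) (1 * (q ^ 2 ∸ 1) * (q ∸ 1)) {{ℕP.m*n≢0 (1 * (q ^ 2 ∸ 1)) (q ∸ 1)
        {{ℕP.m*n≢0 1 (q ^ 2 ∸ 1) {{_}} {{pow∸1-nonZero 1<q 1}}}}
        {{ℕ.>-nonZero (ℕP.m<n⇒0<n∸m 1<q)}}}})

  -- For r = 0 the field would have a single element, against 0 ≠ 1.
  1<2^r : ∀ {r} → FiniteField r → 1 ℕ.< 2 ℕ.^ r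
  1<2^r {zero} 𝔽 = contradiction
    (trans (sym (Inverse.strictlyInverseˡ enum 0#))
      (trans (cong (Inverse.to enum) (all-equal (Inverse.from enum 0#) (Inverse.from enum 1#)))
             (Inverse.strictlyInverseˡ enum 1#)))
    0≢1
    where
    open FiniteField 𝔽
    all-equal : ∀ (i j : Fin 1) → i ≡ j
    all-equal zero zero = refl
  1<2^r {suc r} 𝔽 = ℕP.*-monoʳ-≤ 2 (ℕP.m^n>0 2 r)

-- Cancellation and the values of the two sums

module Evaluation {r} (𝔽 : FiniteField r) (χ : FiniteField.AddChar 𝔽)
  (nontrivial : FiniteField.Nontrivial 𝔽 χ) where

  open import Data.Integer using (_+_; _*_; _-_)
  open FiniteSums
  open Matrices 𝔽
  open SiegelParabolic 𝔽
  open CharacterSums 𝔽 χ nontrivial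
  open BlockSums 𝔽 char2
  open Orders 𝔽 char2
  open DoubleCosetSums 𝔽 χ nontrivial
  open KloostermanSums 𝔽 χ nontrivial
  open Exponents

  1<q : 1 ℕ.< q
  1<q = 1<2^r 𝔽

  instance
    q-nonZero : NonZero q
    q-nonZero = ℕ.>-nonZero (ℕP.<-trans (s≤s z≤n) 1<q)

  q^-nonZero : ∀ k → NonZero (q ℕ.^ k)
  q^-nonZero k = ℕP.m^n≢0 q k

  pos-∸1 : ∀ a .{{_ : NonZero a}} → + a - 1ℤ ≡ + (a ℕ.∸ 1)
  pos-∸1 (suc a) = refl

  card-row : ∀ n → ∣ Mx 1 n ∣ ≡ + (q ℕ.^ n)
  card-row n = trans (card-Mx 1 n) (cong +_ (ℕP.^-identityʳ (q ℕ.^ n)))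

  card-column : ∀ n → ∣ Mx n 1 ∣ ≡ + (q ℕ.^ n)
  card-column n = trans (card-Mx n 1) (cong (λ x → + (x ℕ.^ n)) (ℕP.^-identityʳ q))

  empty-unique : (A B : Mx 0 0) → A ≡ B
  empty-unique [] [] = refl

  empty-pair : (p : Mx 0 0 × Mx 0 0) → p ≡ ([] , [])
  empty-pair ([] , []) = refl

  glℕ : ℕ → ℕ
  glℕ zero    = 1
  glℕ (suc n) = (q ℕ.^ suc n ℕ.∸ 1) ℕ.* (q ℕ.^ n ℕ.* glℕ n)

  gl-value : ∀ n → gl n ≡ + glℕ n
  gl-value zero = trans (∑⟨⟩-iff GL? (_≟ ([] , [])) (λ p _ → empty-pair p) (λ _ _ → empty-unique _ _))
    (sift ([] , []) (λ _ → 1ℤ))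
  gl-value (suc n) = begin
    gl (suc n)
      ≡⟨ gl-suc n ⟩
    (∣ Mx 1 (suc n) ∣ - 1ℤ) * (∣ Mx n 1 ∣ * gl n)
      ≡⟨ cong₂ _*_ (trans (cong (_- 1ℤ) (card-row (suc n))) (pos-∸1 (q ℕ.^ suc n) {{q^-nonZero (suc n)}}))
           (trans (cong₂ _*_ (card-column n) (gl-value n)) (sym (ℤP.pos-* (q ℕ.^ n) _))) ⟩
    + (q ℕ.^ suc n ℕ.∸ 1) * + (q ℕ.^ n ℕ.* glℕ n)
      ≡⟨ ℤP.pos-* (q ℕ.^ suc n ℕ.∸ 1) _ ⟨
    + glℕ (suc n) ∎

  glℕ-nonZero : ∀ n → NonZero (glℕ n)
  glℕ-nonZero zero    = _
  glℕ-nonZero (suc n) = ℕP.m*n≢0 _ _ {{pow∸1-nonZero 1<q n}} {{ℕP.m*n≢0 _ _ {{q^-nonZero n}} {{glℕ-nonZero n}}}}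

  sy-value : ∀ n → sy n ≡ + (q ℕ.^ tri n)
  sy-value zero = trans (∑⟨⟩-iff Sym? (_≟ []) (λ B _ → empty-unique B []) (λ _ _ → empty-unique _ _))
    (sift [] (λ _ → 1ℤ))
  sy-value (suc n) = begin
    sy (suc n)
      ≡⟨ sy-+ 1 n ⟩
    sy 1 * (∣ Mx n 1 ∣ * sy n)
      ≡⟨ cong₂ _*_ sy-1 (trans (cong₂ _*_ (card-column n) (sy-value n))
           (sym (ℤP.pos-* (q ℕ.^ n) _))) ⟩
    + q * + (q ℕ.^ n ℕ.* q ℕ.^ tri n)
      ≡⟨ trans (sym (ℤP.pos-* q _)) (cong +_ (trans (sym (ℕP.*-assoc q _ _))
           (sym (ℕP.^-distribˡ-+-* q (suc n) (tri n))))) ⟩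
    + (q ℕ.^ tri (suc n)) ∎
    where
    sy-1 : sy 1 ≡ + q
    sy-1 = trans (∑⟨⟩-iff Sym? everything? (λ _ _ → _) (λ B _ → 1×1-ext (tr-ᵀ B)))
      (trans (∑⟨everything⟩ {Mx 1 1} _) (trans (card-row 1) (cong +_ (ℕP.^-identityʳ q))))

  al-value : ∀ m → al (m ℕ.* 2) ≡ + (q ℕ.^ alt-exponent m ℕ.* odd-factors q m)
  al-value zero = trans (∑⟨⟩-iff NAlt? (_≟ ([] , [])) (λ p _ → empty-pair p)
      (λ (X , _) _ → empty-unique _ _ , subst Alternating (empty-unique 𝟘 X) Alternating-𝟘))
    (sift ([] , []) (λ _ → 1ℤ))
  al-value (suc m) = begin
    al (suc (suc n))
      ≡⟨ al-suc n ⟩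
    (∣ Mx 1 (suc n) ∣ - 1ℤ) * (∣ Mx 1 n ∣ * al n)
      ≡⟨ cong₂ _*_ (trans (cong (_- 1ℤ) (card-row (suc n))) (pos-∸1 (q ℕ.^ suc n) {{q^-nonZero (suc n)}}))
           (trans (cong₂ _*_ (card-row n) (al-value m)) (sym (ℤP.pos-* (q ℕ.^ n) _))) ⟩
    + (q ℕ.^ suc n ℕ.∸ 1) * + (q ℕ.^ n ℕ.* (q ℕ.^ alt-exponent m ℕ.* odd-factors q m))
      ≡⟨ ℤP.pos-* (q ℕ.^ suc n ℕ.∸ 1) _ ⟨
    + ((q ℕ.^ suc n ℕ.∸ 1) ℕ.* (q ℕ.^ n ℕ.* (q ℕ.^ alt-exponent m ℕ.* odd-factors q m)))
      ≡⟨ cong +_ (trans (shuffle (q ℕ.^ suc n ℕ.∸ 1) (q ℕ.^ n) (q ℕ.^ alt-exponent m) (odd-factors q m))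
           (cong₂ ℕ._*_ (sym (ℕP.^-distribˡ-+-* q n (alt-exponent m)))
             (cong (λ k → odd-factors q m ℕ.* (q ℕ.^ (k ℕ.∸ 1) ℕ.∸ 1)) (ℕP.*-comm (suc m) 2)))) ⟩
    + (q ℕ.^ alt-exponent (suc m) ℕ.* odd-factors q (suc m)) ∎
    where
    n : ℕ
    n = m ℕ.* 2
    shuffle : ∀ a b c d → a ℕ.* (b ℕ.* (c ℕ.* d)) ≡ b ℕ.* c ℕ.* (d ℕ.* a)
    shuffle = ℕRing.solve-∀


  -- Common frame for t = 1 and t = 2: Z is the expression in K to be reached, x the surplus factor
  -- of K_{GL(t)} (1 or q), g′ the quotient |GL(n)| / |GL(s)|, and a the constant A⁻ or A⁺. What is
  -- left to check is one identity of natural numbers, N x = |GL(t)| a.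
  module _ (m t : ℕ) (Z : ℤ) (x g′ a : ℕ) where

    private
      s n : ℕ
      s = m ℕ.* 2
      n = s ℕ.+ t

      N : ℕ
      N = g′ ℕ.* (q ℕ.^ tri n ℕ.* (q ℕ.^ alt-exponent m ℕ.* odd-factors q m ℕ.* q ℕ.^ tri s))

    evaluate : KG t ≡ + x * Z → glℕ n ≡ g′ ℕ.* glℕ s → N ℕ.* x ≡ glℕ t ℕ.* a →
      ∀ ws → Enumerates ws (InPσP n s) → sumℤ (λ w → ψ (Tr w)) ws ≡ + a * Z
    evaluate KG-t gl-n N-a ws enum =
      -- Two cancellations: c gathers |GL(s)|, the squared number of t × s blocks and the symmetric
      -- t × t count, shared by both sides. The factor |GL(t)| comes out only after `N-a` has
      -- produced it on the right.
      ℤP.*-cancelˡ-≡ (+ glℕ t) S (+ a * Z) {{glℕ-nonZero t}}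
        (ℤP.*-cancelˡ-≡ (+ c) _ _ {{c-nonZero}} (begin
          + c * (+ glℕ t * S)
            ≡⟨ cong (_* (+ glℕ t * S)) pos-c ⟩
          + glℕ s * (+ μ * (+ μ * + (q ℕ.^ tri t))) * (+ glℕ t * S)
            ≡⟨ shuffle₁ (+ glℕ s) (+ μ) (+ (q ℕ.^ tri t)) (+ glℕ t) S ⟩
          + glℕ s * (+ glℕ t * + μ) * (+ μ * + (q ℕ.^ tri t)) * S
            ≡⟨ cong (_* S) (cong₂ (λ y z → y * z)
                 (cong₂ _*_ (gl-value s) (cong₂ _*_ (gl-value t) card-μ))
                 (cong₂ _*_ card-μ (sy-value t))) ⟨
          gl s * (gl t * ∣ Mx t s ∣) * (∣ Mx t s ∣ * sy t) * S
            ≡⟨ doubleCoset-identity s t ws enum ⟩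
          gl n * sy n * (al s * (KG t * ∣ Mx t s ∣) * (sy s * (∣ Mx t s ∣ * sy t)))
            ≡⟨ cong₂ _*_ (cong₂ _*_ (trans (gl-value n) (trans (cong +_ gl-n) (ℤP.pos-* g′ _))) (sy-value n))
                 (cong₂ _*_ (cong₂ _*_ (al-value m) (cong₂ _*_ KG-t card-μ))
                   (cong₂ _*_ (sy-value s) (cong₂ _*_ card-μ (sy-value t)))) ⟩
          + g′ * + glℕ s * + (q ℕ.^ tri n) * (+ α * (+ x * Z * + μ) *
            (+ (q ℕ.^ tri s) * (+ μ * + (q ℕ.^ tri t))))
            ≡⟨ shuffle₂ (+ g′) (+ glℕ s) (+ (q ℕ.^ tri n)) (+ α) (+ x) Z (+ μ) (+ (q ℕ.^ tri s)) (+ (q ℕ.^ tri t)) ⟩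
          + glℕ s * (+ μ * (+ μ * + (q ℕ.^ tri t))) *
            (+ g′ * (+ (q ℕ.^ tri n) * (+ α * + (q ℕ.^ tri s))) * + x * Z)
            ≡⟨ cong₂ (λ y z → y * (z * Z)) (sym pos-c)
                 (trans (sym pos-Nx) (trans (cong +_ N-a) (ℤP.pos-* (glℕ t) a))) ⟩
          + c * (+ glℕ t * + a * Z)
            ≡⟨ cong (+ c *_) (ℤP.*-assoc (+ glℕ t) (+ a) Z) ⟩
          + c * (+ glℕ t * (+ a * Z)) ∎))
      where
      S : ℤ
      S = sumℤ (λ w → ψ (Tr w)) ws
      μ α c : ℕ
      μ = (q ℕ.^ s) ℕ.^ t
      α = q ℕ.^ alt-exponent m ℕ.* odd-factors q m
      c = glℕ s ℕ.* (μ ℕ.* (μ ℕ.* q ℕ.^ tri t))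
      card-μ : ∣ Mx t s ∣ ≡ + μ
      card-μ = card-Mx t s
      μ-nonZero : NonZero μ
      μ-nonZero = ℕP.m^n≢0 (q ℕ.^ s) t {{q^-nonZero s}}
      c-nonZero : NonZero c
      c-nonZero = ℕP.m*n≢0 _ _ {{glℕ-nonZero s}} {{ℕP.m*n≢0 _ _ {{μ-nonZero}}
        {{ℕP.m*n≢0 _ _ {{μ-nonZero}} {{q^-nonZero (tri t)}}}}}}
      pos-c : + c ≡ + glℕ s * (+ μ * (+ μ * + (q ℕ.^ tri t)))
      pos-c = trans (ℤP.pos-* (glℕ s) _) (cong (+ glℕ s *_)
        (trans (ℤP.pos-* μ _) (cong (+ μ *_) (ℤP.pos-* μ _))))
      pos-Nx : + (N ℕ.* x) ≡ + g′ * (+ (q ℕ.^ tri n) * (+ α * + (q ℕ.^ tri s))) * + x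
      pos-Nx = trans (ℤP.pos-* N x) (cong (_* + x) (trans (ℤP.pos-* g′ _) (cong (+ g′ *_)
        (trans (ℤP.pos-* (q ℕ.^ tri n) _) (cong (+ (q ℕ.^ tri n) *_) (ℤP.pos-* α _))))))
      shuffle₁ : ∀ g u y k z → g * (u * (u * y)) * (k * z) ≡ g * (k * u) * (u * y) * z
      shuffle₁ = solve-∀
      shuffle₂ : ∀ g h y e x z u v w →
        g * h * y * (e * (x * z * u) * (v * (u * w))) ≡
        h * (u * (u * w)) * (g * (y * (e * v)) * x * z)
      shuffle₂ = solve-∀

  module _ (m : ℕ) where

    private
      s : ℕ
      s = m ℕ.* 2

      e = alt-exponent m

      power₄ : ∀ i j k l → q ℕ.^ (i ℕ.+ (j ℕ.+ (k ℕ.+ l))) ≡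
        q ℕ.^ i ℕ.* (q ℕ.^ j ℕ.* (q ℕ.^ k ℕ.* q ℕ.^ l))
      power₄ i j k l = trans (ℕP.^-distribˡ-+-* q i _) (cong (q ℕ.^ i ℕ.*_)
        (trans (ℕP.^-distribˡ-+-* q j _) (cong (q ℕ.^ j ℕ.*_) (ℕP.^-distribˡ-+-* q k l))))

    -- Here g′ = (q^n - 1) q^s with n = s + 1. The factor q - 1 of q^n - 1 is |GL(1)|, and the
    -- cofactor is the Gaussian binomial.
    DC⁻-sum : ∀ ws → Enumerates ws (InPσP (s ℕ.+ 1) s) →
      sumℤ (λ w → ψ (Tr w)) ws ≡ + A⁻ q (s ℕ.+ 1) * K χ 1#
    DC⁻-sum = evaluate m 1 (K χ 1#) 1 ((q ℕ.^ suc s ℕ.∸ 1) ℕ.* q ℕ.^ s) (A⁻ q (s ℕ.+ 1))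
      (trans KG-1 (sym (ℤP.*-identityˡ _)))
      (trans (cong glℕ (ℕP.+-comm s 1)) (sym (ℕP.*-assoc (q ℕ.^ suc s ℕ.∸ 1) _ _)))
      (begin
        (q ℕ.^ suc s ℕ.∸ 1) ℕ.* q ℕ.^ s ℕ.* (q ℕ.^ tri (s ℕ.+ 1) ℕ.* (q ℕ.^ e ℕ.* odd-factors q m ℕ.* q ℕ.^ tri s)) ℕ.* 1
          ≡⟨ cong₂ (λ y z → y ℕ.* q ℕ.^ s ℕ.* (q ℕ.^ tri z ℕ.* (q ℕ.^ e ℕ.* odd-factors q m ℕ.* q ℕ.^ tri s)) ℕ.* 1)
               (geometric-sum q (suc s)) (ℕP.+-comm s 1) ⟩
        geometric q (suc s) ℕ.* (q ℕ.∸ 1) ℕ.* q ℕ.^ s ℕ.*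
          (q ℕ.^ tri (suc s) ℕ.* (q ℕ.^ e ℕ.* odd-factors q m ℕ.* q ℕ.^ tri s)) ℕ.* 1
          ≡⟨ shuffle (geometric q (suc s)) (q ℕ.∸ 1) (q ℕ.^ s) (q ℕ.^ tri (suc s)) (q ℕ.^ e)
               (odd-factors q m) (q ℕ.^ tri s) ⟩
        (q ℕ.∸ 1) ℕ.* (1 ℕ.* 1) ℕ.* (q ℕ.^ s ℕ.* (q ℕ.^ tri (suc s) ℕ.* (q ℕ.^ e ℕ.* q ℕ.^ tri s)) ℕ.*
          geometric q (suc s) ℕ.* odd-factors q m)
          ≡⟨ cong₂ ℕ._*_ (cong (λ y → (y ℕ.∸ 1) ℕ.* (1 ℕ.* 1)) (sym (ℕP.^-identityʳ q)))
               (trans (cong (λ y → y ℕ.* geometric q (suc s) ℕ.* odd-factors q m)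
                 (sym (power₄ s (tri (suc s)) e (tri s))))
                 (trans (sym (A⁻-value 1<q m)) (cong (A⁻ q) (ℕP.+-comm 1 s)))) ⟩
        glℕ 1 ℕ.* A⁻ q (s ℕ.+ 1) ∎)
      where
      shuffle : ∀ a b c d f g h → a ℕ.* b ℕ.* c ℕ.* (d ℕ.* (f ℕ.* g ℕ.* h)) ℕ.* 1 ≡
        b ℕ.* (1 ℕ.* 1) ℕ.* (c ℕ.* (d ℕ.* (f ℕ.* h)) ℕ.* a ℕ.* g)
      shuffle = ℕRing.solve-∀

    -- Here |GL(2)| = (q² - 1) q (q - 1): its factor q is met by x = q from K_{GL(2)}, and the other
    -- two are the denominator of the Gaussian binomial.
    DC⁺-sum : ∀ ws → Enumerates ws (InPσP (s ℕ.+ 2) s) →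
      sumℤ (λ w → ψ (Tr w)) ws ≡ + A⁺ q (s ℕ.+ 2) * (K χ 1# ℤ.^ 2 + (+ q) ℤ.^ 2 - + q)
    DC⁺-sum = evaluate m 2 (K χ 1# ℤ.^ 2 + (+ q) ℤ.^ 2 - + q) q
      ((q ℕ.^ suc (suc s) ℕ.∸ 1) ℕ.* (q ℕ.^ suc s ℕ.* ((q ℕ.^ suc s ℕ.∸ 1) ℕ.* q ℕ.^ s))) (A⁺ q (s ℕ.+ 2))
      KG-2
      (trans (cong glℕ (ℕP.+-comm s 2))
        (regroup (q ℕ.^ suc (suc s) ℕ.∸ 1) (q ℕ.^ suc s) (q ℕ.^ suc s ℕ.∸ 1) (q ℕ.^ s) (glℕ s)))
      (begin
        g ℕ.* (q ℕ.^ tri (s ℕ.+ 2) ℕ.* (q ℕ.^ e ℕ.* odd-factors q m ℕ.* q ℕ.^ tri s)) ℕ.* q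
          ≡⟨ cong₂ (λ y z → y ℕ.* (q ℕ.^ tri z ℕ.* (q ℕ.^ e ℕ.* odd-factors q m ℕ.* q ℕ.^ tri s)) ℕ.* q)
               (cong₂ (λ y z → y ℕ.* (q ℕ.^ suc s ℕ.* (z ℕ.* q ℕ.^ s)))
                 (trans (cong (λ k → q ℕ.^ k ℕ.∸ 1) (ℕP.*-comm (suc m) 2))
                   (trans (cong (ℕ._∸ 1) (sym (ℕP.^-*-assoc q 2 (suc m))))
                     (geometric-sum (q ℕ.^ 2) {{q^-nonZero 2}} (suc m))))
                 (geometric-sum q (suc s)))
               (ℕP.+-comm s 2) ⟩
        G₂ ℕ.* (q ℕ.^ 2 ℕ.∸ 1) ℕ.* (q ℕ.^ suc s ℕ.* (G₁ ℕ.* (q ℕ.∸ 1) ℕ.* q ℕ.^ s)) ℕ.*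
          (q ℕ.^ tri (suc (suc s)) ℕ.* (q ℕ.^ e ℕ.* odd-factors q m ℕ.* q ℕ.^ tri s)) ℕ.* q
          ≡⟨ shuffle G₂ (q ℕ.^ 2 ℕ.∸ 1) (q ℕ.^ suc s) G₁ (q ℕ.∸ 1) (q ℕ.^ s) (q ℕ.^ tri (suc (suc s)))
               (q ℕ.^ e) (odd-factors q m) (q ℕ.^ tri s) q ⟩
        (q ℕ.^ 2 ℕ.∸ 1) ℕ.* (q ℕ.* ((q ℕ.∸ 1) ℕ.* (1 ℕ.* 1))) ℕ.*
          (q ℕ.^ suc s ℕ.* q ℕ.^ s ℕ.* (q ℕ.^ tri (suc (suc s)) ℕ.* (q ℕ.^ e ℕ.* q ℕ.^ tri s)) ℕ.*
            (G₂ ℕ.* G₁) ℕ.* odd-factors q m)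
          ≡⟨ cong₂ ℕ._*_
               (cong (λ y → (q ℕ.^ 2 ℕ.∸ 1) ℕ.* (y ℕ.* ((y ℕ.∸ 1) ℕ.* (1 ℕ.* 1)))) (sym (ℕP.^-identityʳ q)))
               (trans (cong (λ y → y ℕ.* (G₂ ℕ.* G₁) ℕ.* odd-factors q m)
                 (trans (cong (ℕ._* (q ℕ.^ tri (suc (suc s)) ℕ.* (q ℕ.^ e ℕ.* q ℕ.^ tri s)))
                     (sym (ℕP.^-distribˡ-+-* q (suc s) s)))
                   (sym (power₄ (suc (s ℕ.+ s)) (tri (suc (suc s))) e (tri s)))))
                 (trans (sym (A⁺-value 1<q m)) (cong (A⁺ q) (ℕP.+-comm 2 s)))) ⟩
        glℕ 2 ℕ.* A⁺ q (s ℕ.+ 2) ∎)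
      where
      g G₁ G₂ : ℕ
      g  = (q ℕ.^ suc (suc s) ℕ.∸ 1) ℕ.* (q ℕ.^ suc s ℕ.* ((q ℕ.^ suc s ℕ.∸ 1) ℕ.* q ℕ.^ s))
      G₁ = geometric q (suc s)
      G₂ = geometric (q ℕ.^ 2) (suc m)
      regroup : ∀ a b c d f → a ℕ.* (b ℕ.* (c ℕ.* (d ℕ.* f))) ≡ a ℕ.* (b ℕ.* (c ℕ.* d)) ℕ.* f
      regroup = ℕRing.solve-∀
      shuffle : ∀ a b c d f g h i j k l →
        a ℕ.* b ℕ.* (c ℕ.* (d ℕ.* f ℕ.* g)) ℕ.* (h ℕ.* (i ℕ.* j ℕ.* k)) ℕ.* l ≡
        b ℕ.* (l ℕ.* (f ℕ.* (1 ℕ.* 1))) ℕ.* (c ℕ.* g ℕ.* (h ℕ.* (i ℕ.* k)) ℕ.* (a ℕ.* d) ℕ.* j)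
      shuffle = ℕRing.solve-∀

-- Parity of n and the two cases of the theorem

odd-form : ∀ n → n % 2 ≡ 1 → ∃ λ m → n ≡ m ℕ.* 2 ℕ.+ 1
odd-form n h = n ℕ./ 2 , trans (ℕD.m≡m%n+[m/n]*n n 2)
  (trans (cong (ℕ._+ n ℕ./ 2 ℕ.* 2) h) (ℕP.+-comm 1 _))

even-form : ∀ n → n % 2 ≡ 0 → n ≥ 2 → ∃ λ m → n ≡ m ℕ.* 2 ℕ.+ 2
even-form n h n≥2 with n ℕ./ 2 in half
... | zero  = contradiction n≥2 (subst (λ k → ¬ (k ≥ 2)) (sym n≡) λ ())
  where
  n≡ : n ≡ 0
  n≡ = trans (ℕD.m≡m%n+[m/n]*n n 2) (cong₂ (λ x y → x ℕ.+ y ℕ.* 2) h half)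
... | suc m = m , trans (ℕD.m≡m%n+[m/n]*n n 2)
  (trans (cong₂ (λ x y → x ℕ.+ y ℕ.* 2) h half) (ℕP.+-comm 2 (m ℕ.* 2)))

open import Data.Integer using (ℤ; +_; _+_; _*_; _-_; _^_)

theorem4 : ∀ (r : ℕ) (𝔽 : FiniteField r) →
    (χ : FiniteField.AddChar 𝔽) → FiniteField.Nontrivial 𝔽 χ →
    (∀ (n : ℕ) → n % 2 ≡ 1 →
    (ws : List (FiniteField.Mat 𝔽 (n Data.Nat.+ n))) →
    FiniteField.Enumerates 𝔽 ws (FiniteField.InDC⁻ 𝔽 n) →
    FiniteField.sumℤ 𝔽 (λ w → FiniteField.apply 𝔽 χ (FiniteField.Tr 𝔽 w)) ws
    ≡ (+ A⁻ (FiniteField.q 𝔽) n) * FiniteField.K 𝔽 χ (FiniteField.1# 𝔽))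
    ×
    (∀ (n : ℕ) → n % 2 ≡ 0 → n ≥ 2 →
    (ws : List (FiniteField.Mat 𝔽 (n Data.Nat.+ n))) →
    FiniteField.Enumerates 𝔽 ws (FiniteField.InDC⁺ 𝔽 n) →
    ((+ FiniteField.q 𝔽)
    * FiniteField.sumℤ 𝔽 (λ w → FiniteField.apply 𝔽 χ (FiniteField.Tr 𝔽 w)) ws
    ≡ (+ A⁺ (FiniteField.q 𝔽) n) * FiniteField.K-GL2 𝔽 χ (FiniteField.1# 𝔽))
    ×
    (FiniteField.sumℤ 𝔽 (λ w → FiniteField.apply 𝔽 χ (FiniteField.Tr 𝔽 w)) ws
    ≡ (+ A⁺ (FiniteField.q 𝔽) n)
    * ((FiniteField.K 𝔽 χ (FiniteField.1# 𝔽) ^ 2)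
    + (+ FiniteField.q 𝔽) ^ 2 - (+ FiniteField.q 𝔽))))
theorem4 r 𝔽 χ nontrivial = minus , plus
  where
  open FiniteField 𝔽 using (InPσP; Enumerates; InDC⁻; InDC⁺; sumℤ; apply; Tr; K; K-GL2; q; 1#)
  open Evaluation 𝔽 χ nontrivial
  open KloostermanSums 𝔽 χ nontrivial using (KG-2; K-GL2≡KG)

  minus : ∀ n → n % 2 ≡ 1 → ∀ ws → Enumerates ws (InDC⁻ n) →
    sumℤ (λ w → apply χ (Tr w)) ws ≡ (+ A⁻ q n) * K χ 1#
  minus n h ws enum with odd-form n h
  ... | m , refl = DC⁻-sum m ws
    -- The truncated n ∸ 1 in `InDC⁻` becomes the even number 2m.
    (subst (λ s → Enumerates ws (InPσP (m ℕ.* 2 ℕ.+ 1) s)) (ℕP.m+n∸n≡m (m ℕ.* 2) 1) enum)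

  plus : ∀ n → n % 2 ≡ 0 → n ≥ 2 → ∀ ws → Enumerates ws (InDC⁺ n) →
    ((+ q) * sumℤ (λ w → apply χ (Tr w)) ws ≡ (+ A⁺ q n) * K-GL2 χ 1#) ×
    (sumℤ (λ w → apply χ (Tr w)) ws ≡ (+ A⁺ q n) * ((K χ 1# ^ 2) + (+ q) ^ 2 - (+ q)))
  plus n h n≥2 ws enum with even-form n h n≥2
  ... | m , refl = (begin
      (+ q) * sumℤ (λ w → apply χ (Tr w)) ws ≡⟨ cong (+ q *_) value ⟩
      (+ q) * ((+ A⁺ q (m ℕ.* 2 ℕ.+ 2)) * Z) ≡⟨ exchange (+ q) (+ A⁺ q (m ℕ.* 2 ℕ.+ 2)) Z ⟩
      -- The equation with q⁻¹ is stated multiplied by q, and q Z is exactly K_{GL(2)}(ψ;1).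
      (+ A⁺ q (m ℕ.* 2 ℕ.+ 2)) * (+ q * Z)   ≡⟨ cong ((+ A⁺ q (m ℕ.* 2 ℕ.+ 2)) *_) (trans K-GL2≡KG KG-2) ⟨
      (+ A⁺ q (m ℕ.* 2 ℕ.+ 2)) * K-GL2 χ 1#  ∎) , value
    where
    Z : ℤ
    Z = (K χ 1# ^ 2) + (+ q) ^ 2 - (+ q)
    value : sumℤ (λ w → apply χ (Tr w)) ws ≡ (+ A⁺ q (m ℕ.* 2 ℕ.+ 2)) * Z
    value = DC⁺-sum m ws
      (subst (λ s → Enumerates ws (InPσP (m ℕ.* 2 ℕ.+ 2) s)) (ℕP.m+n∸n≡m (m ℕ.* 2) 2) enum)
    exchange : ∀ a b c → a * (b * c) ≡ b * (a * c)
    exchange = solve-∀
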